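{- Let $p$ be a prime, let $h$ be a non-negative integer and let $s$ be an integer such that $\gcd(s,15)=1$ if $p\in\{2,3\}$, and $s=1$ if $p=5$; put $q=p^{15h+s}$. Then the $3$-dimensional vector space $V(3,q^5)$ over $\mathbb{F}_{q^5}$ contains a scattered $\mathbb{F}_q$-subspace of $\mathbb{F}_q$-dimension $7$.
   Context: $V(r,q^n)$ denotes an $r$-dimensional vector space over the finite field $\mathbb{F}_{q^n}$; it is also an $rn$-dimensional vector space over $\mathbb{F}_q$. An $\mathbb{F}_q$-subspace $U$ of $V(r,q^n)$ is called scattered if $U\neq\{0\}$ and every $1$-dimensional $\mathbb{F}_{q^n}$-subspace of $V(r,q^n)$ meets $U$ in an $\mathbb{F}_q$-subspace of $\mathbb{F}_q$-dimension at most $1$. -}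

module Defs where

open import Level using (Level; _⊔_) renaming (suc to lsuc)
open import Algebra.Bundles using (CommutativeRing)
open import Data.Nat using (ℕ; zero; suc)
open import Data.Fin using (Fin; zero; suc)
open import Data.Product using (Σ; ∃; ∃-syntax; _×_; _,_)
open import Relation.Nullary using (¬_)
open import Relation.Binary.PropositionalEquality using (_≡_)

module _ {c ℓ : Level} (K : CommutativeRing c ℓ) where
  open CommutativeRing K using (Carrier; _≈_; _+_; _*_; -_; 0#; 1#)

  IsField : Set (c ⊔ ℓ)
  IsField = (¬ (1# ≈ 0#)) × (∀ x → ¬ (x ≈ 0#) → ∃[ y ] (x * y ≈ 1#))

  HasCard : ℕ → Set (c ⊔ ℓ)
  HasCard N = Σ (Fin N → Carrier) λ f →
      (∀ i j → f i ≈ f j → i ≡ j) × (∀ x → ∃[ i ] (f i ≈ x))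

  record Subfield : Set (lsuc (c ⊔ ℓ)) where
    field
      In       : Carrier → Set (c ⊔ ℓ)
      In-resp  : ∀ {x y} → x ≈ y → In x → In y
      In-0     : In 0#
      In-1     : In 1#
      In-+     : ∀ {x y} → In x → In y → In (x + y)
      In-neg   : ∀ {x} → In x → In (- x)
      In-*     : ∀ {x y} → In x → In y → In (x * y)
      In-inv   : ∀ {x y} → In x → x * y ≈ 1# → In y

  SubfieldCard : Subfield → ℕ → Set (c ⊔ ℓ)
  SubfieldCard F N = Σ (Fin N → Carrier) λ f →
      (∀ i → Subfield.In F (f i)) ×
      (∀ i j → f i ≈ f j → i ≡ j) ×
      (∀ x → Subfield.In F x → ∃[ i ] (f i ≈ x))

  Vec : ℕ → Set c
  Vec r = Fin r → Carrier

  _≈V_ : ∀ {r} → Vec r → Vec r → Set ℓ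
  u ≈V v = ∀ i → u i ≈ v i

  0V : ∀ {r} → Vec r
  0V i = 0#

  _+V_ : ∀ {r} → Vec r → Vec r → Vec r
  (u +V v) i = u i + v i

  _·V_ : ∀ {r} → Carrier → Vec r → Vec r
  (a ·V v) i = a * v i

  lincomb : ∀ {r} (k : ℕ) → (Fin k → Carrier) → (Fin k → Vec r) → Vec r
  lincomb zero    a u = 0V
  lincomb (suc k) a u = (a zero ·V u zero) +V lincomb k (λ i → a (suc i)) (λ i → u (suc i))

  module _ (F : Subfield) where
    open Subfield F

    FIndependent : ∀ {r k} → (Fin k → Vec r) → Set (c ⊔ ℓ)
    FIndependent {k = k} u = ∀ (a : Fin k → Carrier) → (∀ i → In (a i)) →
      lincomb k a u ≈V 0V → ∀ i → a i ≈ 0#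

    FSpan : ∀ {r k} → (Fin k → Vec r) → Vec r → Set (c ⊔ ℓ)
    FSpan {k = k} u v = ∃[ a ] ((∀ i → In (a i)) × (v ≈V lincomb k a u))

    FSubspaceOfDim : ∀ {r} → ℕ → (Vec r → Set (c ⊔ ℓ)) → Set (c ⊔ ℓ)
    FSubspaceOfDim {r} k U = Σ (Fin k → Vec r) λ u →
      FIndependent u × (∀ v → (U v → FSpan u v) × (FSpan u v → U v))

    FDimAtMostOne : ∀ {r} → (Vec r → Set (c ⊔ ℓ)) → Set (c ⊔ ℓ)
    FDimAtMostOne W = ∀ w₁ w₂ → W w₁ → W w₂ →
      ∃[ a ] ∃[ b ] (In a × In b × ¬ (a ≈ 0# × b ≈ 0#) ×
                     ((a ·V w₁) +V (b ·V w₂)) ≈V 0V)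

    KSpan : ∀ {r} → Vec r → Vec r → Set (c ⊔ ℓ)
    KSpan v w = ∃[ λ' ] (w ≈V (λ' ·V v))

    Scattered : ∀ {r} → (Vec r → Set (c ⊔ ℓ)) → Set (c ⊔ ℓ)
    Scattered U = (∃[ x ] (U x × ¬ (x ≈V 0V))) ×
      (∀ v → ¬ (v ≈V 0V) → FDimAtMostOne (λ w → U w × KSpan v w))

{-# OPTIONS --safe #-}
{-
Put θ x = x^q and look for U = {(x , f (x , b) + a , θ x + b) : x ∈ K, a, b ∈ F}, where f : K ⊕ F → K is
F-linear, hence given by its values φ ∈ K⁶ on a basis.  For λ ∉ F the equation λ (x , θ x) = (x′ , θ x′ + 1)
has exactly one solution x, so the pairs of F-independent, K-proportional vectors of {(x , θ x + b)} are
parametrised, up to F-linear substitutions, by λ ∈ K \ F modulo λ ↦ a + b λ; these are D = q³ + q² + q + 1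
classes.  The space U fails to be scattered iff λ f(u) - f(u′) lies in V λ = ⟨1 , λ⟩ for one of them, where
u = (x , 0) and u′ = (x′ , 1).  For a random φ each of these events has probability q⁻³, two of them are
independent, and three are independent unless the three classes lie in one orbit of PGL₂(F).  If every φ
had n ≥ 1 bad classes, averaging 12 + 5 n (n - 1) ≤ 12 n + n (n - 1) (n - 2) over φ would contradict
these probabilities for every q ≥ 2.
-}
module Submission where

open import Defs
open import Level using (Level; _⊔_)
open import Algebra.Bundles using (CommutativeRing)
open import Data.Nat using (ℕ; zero; suc; _^_; z≤n; s≤s; NonZero)
import Data.Nat as Nat
import Data.Nat.Properties as ℕₚ
open import Data.Nat.Primality using (Prime)
open import Data.Nat.Tactic.RingSolver using (solve-∀)
open import Data.Integer.GCD using (gcd)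
open import Data.Bool using (if_then_else_)
open import Data.Fin using (Fin; zero; suc)
open import Data.Fin.Properties using (any?; _≟_)
open import Data.Fin.Permutation using (Permutation′; permutation; _⟨$⟩ʳ_)
open import Data.Sum using (_⊎_; inj₁; inj₂; [_,_]′)
open import Data.Product using (_×_; _,_; proj₁; proj₂; ∃; ∃-syntax)
open import Data.Vec.Functional using () renaming (_∷_ to _◂_; [] to ◇)
open import Data.Empty using (⊥; ⊥-elim)
open import Function using (_∘_; id)
open import Relation.Nullary using (¬_; Dec; yes; no; does; contradiction; ¬?; _×-dec_)
open import Relation.Nullary.Decidable using (map′; decidable-stable)
open import Relation.Binary.PropositionalEquality as ≡ using (_≡_; _≢_)

-- The mean number of bad classes is D / q³, which exceeds 1 (it is 15/8 for q = 2), so the union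
-- bound yields no good φ and higher moments are needed. The inequality for n says (n - 1) (n - 3)
-- (n - 4) ≥ 0, true at every positive integer and false at 0, rewritten in falling factorials. The
-- Bonferroni choice (n - 1) (n - 2) (n - 3) ≥ 0 is too weak at q = 2; the roots 1, 3, 4 leave a
-- small margin there.
--
-- Independence is linear algebra: λ f(u) - f(u′) is a K-linear form in φ, and an event is
-- independent of others as soon as some direction ψ kills their forms but not its own. For ψ with
-- coordinates in F, λ ∉ F makes a form vanish at ψ only if ψ kills both u and u′, so such
-- directions come from duality over F. For three classes duality fails only inside an orbit of
-- PGL₂(F), which consists of at most q + 1 classes. Hence at most D (q² - q) ordered triples are
-- exceptional, and dropping one event bounds their probability by q⁻⁶.

-- Finite sums of naturals, indicators and falling factorials.

module Counting where
  open Nat using (_+_; _*_; _∸_; _≤_; _<_)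
  import Algebra.Properties.Semiring.Sum ℕₚ.+-*-semiring as S

  private variable
    a b : Level
    P : Set a
    Q : Set b
    n : ℕ

  opaque
    sum : (Fin n → ℕ) → ℕ
    sum = S.sum

    sum-cong : {f g : Fin n → ℕ} → (∀ i → f i ≡ g i) → sum f ≡ sum g
    sum-cong = S.sum-cong-≗

    sum-permute : (f : Fin n → ℕ) (π : Permutation′ n) → sum f ≡ sum (λ i → f (π ⟨$⟩ʳ i))
    sum-permute = S.sum-permute

    sum-+ : (f g : Fin n → ℕ) → sum (λ i → f i + g i) ≡ sum f + sum g
    sum-+ = S.∑-distrib-+

    sum-swap : ∀ {m} (f : Fin m → Fin n → ℕ) → sum (λ i → sum (f i)) ≡ sum (λ j → sum (λ i → f i j))
    sum-swap = S.∑-comm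

    sum-*ˡ : ∀ c (f : Fin n → ℕ) → sum (λ i → c * f i) ≡ c * sum f
    sum-*ˡ c f = ≡.sym (S.*-distribˡ-sum c f)

    sum-*ʳ : ∀ c (f : Fin n → ℕ) → sum (λ i → f i * c) ≡ sum f * c
    sum-*ʳ c f = ≡.sym (S.*-distribʳ-sum c f)

    sum-mono : {f g : Fin n → ℕ} → (∀ i → f i ≤ g i) → sum f ≤ sum g
    sum-mono {zero}  f≤g = z≤n
    sum-mono {suc n} f≤g = ℕₚ.+-mono-≤ (f≤g zero) (sum-mono (f≤g ∘ suc))

    sum-const : ∀ n c → sum {n} (λ _ → c) ≡ n * c
    sum-const zero    c = ≡.refl
    sum-const (suc n) c = ≡.cong (c +_) (sum-const n c)

    sum-find : (f g : Fin n → ℕ) → sum f < sum g → ∃[ i ] f i < g i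
    sum-find {zero}  f g ()
    sum-find {suc n} f g f<g with f zero Nat.<? g zero
    ... | yes f₀<g₀ = zero , f₀<g₀
    ... | no  f₀≮g₀ with sum-find (f ∘ suc) (g ∘ suc) (ℕₚ.≰⇒> λ g≤f → ℕₚ.<⇒≱ f<g (ℕₚ.+-mono-≤ (ℕₚ.≮⇒≥ f₀≮g₀) g≤f))
    ...   | i , lt = suc i , lt

  ind : Dec P → ℕ
  ind d = if does d then 1 else 0

  ind-yes : (d : Dec P) → P → ind d ≡ 1
  ind-yes (yes _) _ = ≡.refl
  ind-yes (no ¬p) p = contradiction p ¬p

  ind-no : (d : Dec P) → ¬ P → ind d ≡ 0
  ind-no (yes p) ¬p = contradiction p ¬p
  ind-no (no _)  _  = ≡.refl

  ind-mono : (d : Dec P) (e : Dec Q) → (P → Q) → ind d ≤ ind e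
  ind-mono (yes p) e f = ℕₚ.≤-reflexive (≡.sym (ind-yes e (f p)))
  ind-mono (no _)  e f = z≤n

  ind-cong : (d : Dec P) (e : Dec Q) → (P → Q) → (Q → P) → ind d ≡ ind e
  ind-cong d e f g = ℕₚ.≤-antisym (ind-mono d e f) (ind-mono e d g)

  ind-idem : (d : Dec P) → ind d * ind d ≡ ind d
  ind-idem (yes _) = ≡.refl
  ind-idem (no _)  = ≡.refl

  sum-zero : (f : Fin n → ℕ) → (∀ i → f i ≡ 0) → sum f ≡ 0
  sum-zero {n} f f≡0 = ≡.trans (sum-cong f≡0) (≡.trans (sum-const n 0) (ℕₚ.*-zeroʳ n))

  opaque
    unfolding sum

    sum-single : (f : Fin n → ℕ) (i : Fin n) → (∀ j → i ≢ j → f j ≡ 0) → sum f ≡ f i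
    sum-single f zero    h =
      ≡.trans (≡.cong (f zero +_) (sum-zero (f ∘ suc) (λ j → h (suc j) λ ()))) (ℕₚ.+-identityʳ _)
    sum-single f (suc i) h =
      ≡.trans (≡.cong (_+ sum (f ∘ suc)) (h zero λ ()))
              (sum-single (f ∘ suc) i (λ j i≢j → h (suc j) λ { ≡.refl → i≢j ≡.refl }))

    term≤sum : (f : Fin n → ℕ) → ∀ i → f i ≤ sum f
    term≤sum f zero    = ℕₚ.m≤m+n _ _
    term≤sum f (suc i) = ℕₚ.≤-trans (term≤sum (f ∘ suc) i) (ℕₚ.m≤n+m _ (f zero))

  module _ {p} {P : Fin n → Set p} (P? : ∀ i → Dec (P i)) where

    sum-ind-1 : ∀ i → P i → (∀ j → P j → i ≡ j) → sum (ind ∘ P?) ≡ 1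
    sum-ind-1 i pi uniq = ≡.trans (sum-single _ i (λ j i≢j → ind-no (P? j) (i≢j ∘ uniq j))) (ind-yes (P? i) pi)

    sum-ind-∃ : (∃? : Dec (∃ P)) → (∀ i j → P i → P j → i ≡ j) → sum (ind ∘ P?) ≡ ind ∃?
    sum-ind-∃ (yes (i , pi)) uniq = sum-ind-1 i pi (λ j → uniq i j pi)
    sum-ind-∃ (no ∄)         uniq = sum-zero _ (λ i → ind-no (P? i) (λ pi → ∄ (i , pi)))

    sum-ind-≤1 : (∀ i j → P i → P j → i ≡ j) → sum (ind ∘ P?) ≤ 1
    sum-ind-≤1 uniq = ℕₚ.≤-trans (ℕₚ.≤-reflexive (sum-ind-∃ (any? P?) uniq)) (ind-mono (any? P?) (yes P?) (λ _ → P?))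

    ind-∃≤sum : (∃? : Dec (∃ P)) → ind ∃? ≤ sum (ind ∘ P?)
    ind-∃≤sum (no ∄) = z≤n
    ind-∃≤sum (yes (i , pi)) = ℕₚ.≤-trans (ℕₚ.≤-reflexive (≡.sym (ind-yes (P? i) pi))) (term≤sum (ind ∘ P?) i)

  off : Fin n → Fin n → ℕ
  off i j = ind (¬? (i ≟ j))

  off-idem : ∀ (i j : Fin n) → off i j * off i j ≡ off i j
  off-idem i j = ind-idem (¬? (i ≟ j))

  -- The diagonal term is restored by addition, so sums over distinct indices never involve
  -- truncated subtraction.
  sum-off : ∀ i (g : Fin n → ℕ) → sum (λ k → off i k * g k) + g i ≡ sum g
  sum-off i g = begin
    sum (λ k → off i k * g k) + g i                          ≡⟨ ≡.cong (sum (λ k → off i k * g k) +_) diag ⟨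
    sum (λ k → off i k * g k) + sum (λ k → ind (i ≟ k) * g k) ≡⟨ sum-+ _ (λ k → ind (i ≟ k) * g k) ⟨
    sum (λ k → off i k * g k + ind (i ≟ k) * g k)            ≡⟨ sum-cong pointwise ⟩
    sum g                                                    ∎
    where
    open ≡.≡-Reasoning
    diag : sum (λ k → ind (i ≟ k) * g k) ≡ g i
    diag = ≡.trans (sum-single _ i (λ j i≢j → ≡.cong (_* g j) (ind-no (i ≟ j) i≢j)))
                   (≡.trans (≡.cong (_* g i) (ind-yes (i ≟ i) ≡.refl)) (ℕₚ.*-identityˡ _))
    pointwise : ∀ k → off i k * g k + ind (i ≟ k) * g k ≡ g k
    pointwise k with i ≟ k
    ... | yes _ = ℕₚ.*-identityˡ _
    ... | no  _ = ≡.trans (ℕₚ.+-identityʳ _) (ℕₚ.*-identityˡ _)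

  -- For the indicator χ of a set with n members these are n (n - 1) and n (n - 1) (n - 2), the
  -- numbers of ordered tuples of distinct members.
  pairs triples : (Fin n → ℕ) → ℕ
  pairs   χ = sum λ i → sum λ j → off i j * (χ i * χ j)
  triples χ = sum λ i → sum λ j → sum λ k → off i j * (off i k * (off j k * (χ i * (χ j * χ k))))

  module _ (χ : Fin n → ℕ) (χ-idem : ∀ i → χ i * χ i ≡ χ i) where
    open ≡.≡-Reasoning
    private
      s = sum χ

      row : Fin n → ℕ
      row i = sum λ j → off i j * (χ i * χ j)

      row-sum : ∀ i → row i + χ i ≡ χ i * s
      row-sum i = begin
        row i + χ i                                 ≡⟨ ≡.cong₂ _+_ (sum-cong (λ j → x*[y*z]≡y*[x*z] (off i j) (χ i) (χ j))) (≡.sym (χ-idem i)) ⟩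
        sum (λ j → χ i * (off i j * χ j)) + χ i * χ i ≡⟨ ≡.cong (_+ χ i * χ i) (sum-*ˡ (χ i) (λ j → off i j * χ j)) ⟩
        χ i * sum (λ j → off i j * χ j) + χ i * χ i  ≡⟨ ℕₚ.*-distribˡ-+ (χ i) (sum (λ j → off i j * χ j)) (χ i) ⟨
        χ i * (sum (λ j → off i j * χ j) + χ i)      ≡⟨ ≡.cong (χ i *_) (sum-off i χ) ⟩
        χ i * s                                     ∎
        where
        x*[y*z]≡y*[x*z] : ∀ x y z → x * (y * z) ≡ y * (x * z)
        x*[y*z]≡y*[x*z] = solve-∀

    pairs+sum : pairs χ + s ≡ s * s
    pairs+sum = begin
      sum row + s              ≡⟨ sum-+ row χ ⟨
      sum (λ i → row i + χ i)  ≡⟨ sum-cong row-sum ⟩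
      sum (λ i → χ i * s)      ≡⟨ sum-*ʳ s χ ⟩
      s * s                    ∎

    private
      cell : Fin n → Fin n → ℕ
      cell i j = sum λ k → off i j * (off i k * (off j k * (χ i * (χ j * χ k))))

      -- For i ≠ j the sum over k omits exactly k = i and k = j. As χ is idempotent, each omitted
      -- term would have contributed `off i j * (χ i * χ j)`.
      cell-sum : ∀ i j → cell i j + 2 * (off i j * (χ i * χ j)) ≡ off i j * (χ i * χ j) * s
      cell-sum i j = begin
        cell i j + 2 * m
          ≡⟨ ≡.cong₂ _+_ (≡.trans (sum-cong (λ k → factor (off i j) (off i k) (off j k) (χ i) (χ j) (χ k))) (sum-*ˡ m g)) twice ⟩
        m * sum g + (m * (off i j * χ j) + m * χ i)
          ≡⟨ distrib m (sum g) (off i j * χ j) (χ i) ⟩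
        m * (sum g + off i j * χ j + χ i)
          ≡⟨ ≡.cong (λ z → m * (z + χ i)) (sum-off j (λ k → off i k * χ k)) ⟩
        m * (sum (λ k → off i k * χ k) + χ i)
          ≡⟨ ≡.cong (m *_) (sum-off i χ) ⟩
        m * s ∎
        where
        m = off i j * (χ i * χ j)
        g : Fin n → ℕ
        g k = off j k * (off i k * χ k)
        factor : ∀ o p r x y z → o * (p * (r * (x * (y * z)))) ≡ o * (x * y) * (r * (p * z))
        factor = solve-∀
        distrib : ∀ m g a b → m * g + (m * a + m * b) ≡ m * (g + a + b)
        distrib = solve-∀
        regroup : ∀ o x y → o * (x * y) * (o * y) + o * (x * y) * x ≡ (o * o) * (x * (y * y)) + o * ((x * x) * y)
        regroup = solve-∀
        double : ∀ m → m + m ≡ 2 * m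
        double = solve-∀
        twice : 2 * m ≡ m * (off i j * χ j) + m * χ i
        twice = ≡.sym (begin
          m * (off i j * χ j) + m * χ i
            ≡⟨ regroup (off i j) (χ i) (χ j) ⟩
          (off i j * off i j) * (χ i * (χ j * χ j)) + off i j * ((χ i * χ i) * χ j)
            ≡⟨ ≡.cong₂ _+_ (≡.cong₂ (λ o y → o * (χ i * y)) (off-idem i j) (χ-idem j)) (≡.cong (λ x → off i j * (x * χ j)) (χ-idem i)) ⟩
          m + m ≡⟨ double m ⟩
          2 * m ∎)

    triples+pairs : triples χ + 2 * pairs χ ≡ pairs χ * s
    triples+pairs = begin
      triples χ + 2 * pairs χ
        ≡⟨ ≡.cong (triples χ +_) (sum-*ˡ 2 row) ⟨
      triples χ + sum (λ i → 2 * row i)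
        ≡⟨ sum-+ (λ i → sum (cell i)) (λ i → 2 * row i) ⟨
      sum (λ i → sum (cell i) + 2 * row i)
        ≡⟨ sum-cong (λ i → ≡.cong (sum (cell i) +_) (sum-*ˡ 2 (λ j → off i j * (χ i * χ j)))) ⟨
      sum (λ i → sum (cell i) + sum (λ j → 2 * (off i j * (χ i * χ j))))
        ≡⟨ sum-cong (λ i → sum-+ (cell i) (λ j → 2 * (off i j * (χ i * χ j)))) ⟨
      sum (λ i → sum (λ j → cell i j + 2 * (off i j * (χ i * χ j))))
        ≡⟨ sum-cong (λ i → sum-cong (cell-sum i)) ⟩
      sum (λ i → sum (λ j → off i j * (χ i * χ j) * s))
        ≡⟨ sum-cong (λ i → sum-*ʳ s (λ j → off i j * (χ i * χ j))) ⟩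
      sum (λ i → row i * s)
        ≡⟨ sum-*ʳ s row ⟩
      pairs χ * s ∎

    pairs-cast : ∀ {m} → s ≡ suc m → pairs χ ≡ suc m * m
    pairs-cast {m} s≡ = ℕₚ.+-cancelʳ-≡ (suc m) _ _ (begin
      pairs χ + suc m    ≡⟨ ≡.cong (pairs χ +_) s≡ ⟨
      pairs χ + s        ≡⟨ pairs+sum ⟩
      s * s              ≡⟨ ≡.cong₂ _*_ s≡ s≡ ⟩
      suc m * suc m      ≡⟨ square m ⟩
      suc m * m + suc m  ∎)
      where
      square : ∀ m → suc m * suc m ≡ suc m * m + suc m
      square = solve-∀

  module _ (χ : Fin n → ℕ) (χ-idem : ∀ i → χ i * χ i ≡ χ i) where
    open ℕₚ.≤-Reasoning

    -- With m + 1 = s the difference of the two sides is m (m - 2) (m - 3).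
    moment-inequality : sum χ ≢ 0 → 12 + 5 * pairs χ ≤ 12 * sum χ + triples χ
    moment-inequality s≢0 with sum χ in s≡
    ... | zero  = contradiction ≡.refl s≢0
    -- `2 * pairs χ` is added to both sides so that `triples+pairs` can replace `triples χ` by a
    -- product.
    ... | suc m = ℕₚ.+-cancelʳ-≤ (2 * pairs χ) _ _ (begin
        12 + 5 * pairs χ + 2 * pairs χ          ≡⟨ ≡.cong (λ p → 12 + 5 * p + 2 * p) p≡ ⟩
        12 + 5 * (suc m * m) + 2 * (suc m * m)  ≤⟨ cubic m ⟩
        12 * suc m + suc m * m * suc m          ≡⟨ ≡.cong₂ (λ x y → 12 * suc m + x * y) p≡ s≡ ⟨
        12 * suc m + pairs χ * sum χ            ≡⟨ ≡.cong (12 * suc m +_) (triples+pairs χ χ-idem) ⟨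
        12 * suc m + (triples χ + 2 * pairs χ)  ≡⟨ ℕₚ.+-assoc (12 * suc m) (triples χ) _ ⟨
        12 * suc m + triples χ + 2 * pairs χ    ∎)
      where
      p≡ : pairs χ ≡ suc m * m
      p≡ = pairs-cast χ χ-idem s≡
      expand : ∀ k → 12 * suc (3 + k) + suc (3 + k) * (3 + k) * suc (3 + k)
                   ≡ 12 + 5 * (suc (3 + k) * (3 + k)) + 2 * (suc (3 + k) * (3 + k)) + (3 + k) * ((1 + k) * k)
      expand = solve-∀
      -- Equality holds at m = 0, 2 and 3; from 3 on, m = 3 + k turns the difference into a
      -- polynomial in k with natural coefficients.
      cubic : ∀ m → 12 + 5 * (suc m * m) + 2 * (suc m * m) ≤ 12 * suc m + suc m * m * suc m
      cubic 0 = ℕₚ.≤-refl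
      cubic 1 = ℕₚ.≤ᵇ⇒≤ _ _ _
      cubic 2 = ℕₚ.≤-refl
      cubic (suc (suc (suc k))) = ℕₚ.≤-trans (ℕₚ.m≤m+n _ _) (ℕₚ.≤-reflexive (≡.sym (expand k)))

-- A ring solver with integer coefficients.

-- The solver coefficient (a , b) stands for the integer a - b.
module IntegerSolver {c ℓ} (K : CommutativeRing c ℓ) where
  open CommutativeRing K hiding (zero)
  open import Algebra.Bundles using (RawRing)
  open import Algebra.Properties.Ring ring using (-‿distribˡ-*; -‿distribʳ-*; -0#≈0#; -‿involutive)
  open import Algebra.Properties.AbelianGroup +-abelianGroup using (⁻¹-∙-comm)
  open import Algebra.Properties.Semiring.Mult semiring using (×-homo-+; ×1-homo-*; ×-congˡ) renaming (_×_ to _·_)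
  open import Algebra.Solver.Ring.AlmostCommutativeRing using (fromCommutativeRing; _-Raw-AlmostCommutative⟶_)
  open import Algebra.Properties.CommutativeSemigroup +-commutativeSemigroup using (interchange)
  open import Data.Maybe using (Maybe; just; nothing)
  open import Relation.Binary.Reasoning.Setoid setoid

  private
    coefficients : RawRing _ _
    coefficients = record
      { Carrier = ℕ × ℕ
      ; _≈_ = _≡_
      ; _+_ = λ (a , b) (c , d) → a Nat.+ c , b Nat.+ d
      ; _*_ = λ (a , b) (c , d) → a Nat.* c Nat.+ b Nat.* d , a Nat.* d Nat.+ b Nat.* c
      ; -_  = λ (a , b) → b , a
      ; 0#  = 0 , 0
      ; 1#  = 1 , 0
      }

    difference : ℕ × ℕ → Carrier
    difference (a , b) = a · 1# - b · 1#

    -- The first two clauses make the constants of the solver reduce to 0# and 1#.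
    ⟦_⟧ : ℕ × ℕ → Carrier
    ⟦ 0 , 0 ⟧ = 0#
    ⟦ 1 , 0 ⟧ = 1#
    ⟦ x ⟧     = difference x

    canonical : ∀ x → ⟦ x ⟧ ≈ difference x
    canonical (0 , 0) = sym (-‿inverseʳ 0#)
    canonical (1 , 0) = sym (trans (+-cong (+-identityʳ 1#) -0#≈0#) (+-identityʳ 1#))
    canonical (0 , suc _) = refl
    canonical (1 , suc _) = refl
    canonical (suc (suc _) , _) = refl

    +-homo : ∀ x y → difference (RawRing._+_ coefficients x y) ≈ difference x + difference y
    +-homo (a , b) (c , d) = begin
      (a Nat.+ c) · 1# - (b Nat.+ d) · 1#          ≈⟨ +-cong (×-homo-+ 1# a c) (-‿cong (×-homo-+ 1# b d)) ⟩
      (a · 1# + c · 1#) - (b · 1# + d · 1#)        ≈⟨ +-congˡ (⁻¹-∙-comm _ _) ⟨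
      (a · 1# + c · 1#) + (- (b · 1#) - d · 1#)    ≈⟨ interchange _ _ _ _ ⟩
      (a · 1# - b · 1#) + (c · 1# - d · 1#)        ∎

    expand : ∀ a b c d → (a - b) * (c - d) ≈ (a * c + b * d) - (a * d + b * c)
    expand a b c d = begin
      (a - b) * (c - d)                                  ≈⟨ distribʳ _ _ _ ⟩
      a * (c - d) + - b * (c - d)                        ≈⟨ +-cong (distribˡ _ _ _) (distribˡ _ _ _) ⟩
      (a * c + a * - d) + (- b * c + - b * - d)          ≈⟨ +-cong (+-congˡ (sym (-‿distribʳ-* a d))) (+-cong (sym (-‿distribˡ-* b c)) neg*neg) ⟩
      (a * c - a * d) + (- (b * c) + b * d)              ≈⟨ +-congˡ (+-comm _ _) ⟩
      (a * c - a * d) + (b * d - b * c)                  ≈⟨ interchange _ _ _ _ ⟩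
      (a * c + b * d) + (- (a * d) - b * c)              ≈⟨ +-congˡ (⁻¹-∙-comm _ _) ⟩
      (a * c + b * d) - (a * d + b * c)                  ∎
      where
      neg*neg : - b * - d ≈ b * d
      neg*neg = trans (sym (-‿distribˡ-* b (- d))) (trans (-‿cong (sym (-‿distribʳ-* b d))) (-‿involutive _))

    product-sum : ∀ a b c d → (a Nat.* c Nat.+ b Nat.* d) · 1# ≈ (a · 1#) * (c · 1#) + (b · 1#) * (d · 1#)
    product-sum a b c d = trans (×-homo-+ 1# (a Nat.* c) (b Nat.* d)) (+-cong (×1-homo-* a c) (×1-homo-* b d))

    *-homo : ∀ x y → difference (RawRing._*_ coefficients x y) ≈ difference x * difference y
    *-homo (a , b) (c , d) = trans (+-cong (product-sum a b c d) (-‿cong (product-sum a b d c))) (sym (expand _ _ _ _))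

    -‿homo : ∀ x → difference (RawRing.-_ coefficients x) ≈ - difference x
    -‿homo (a , b) = begin
      b · 1# - a · 1#        ≈⟨ +-comm _ _ ⟩
      - (a · 1#) + b · 1#    ≈⟨ +-congˡ (-‿involutive _) ⟨
      - (a · 1#) - - (b · 1#) ≈⟨ ⁻¹-∙-comm _ _ ⟩
      - (a · 1# - b · 1#)    ∎

    morphism : coefficients -Raw-AlmostCommutative⟶ fromCommutativeRing K
    morphism = record
      { ⟦_⟧    = ⟦_⟧
      ; +-homo = λ x y → trans (canonical (RawRing._+_ coefficients x y)) (trans (+-homo x y) (sym (+-cong (canonical x) (canonical y))))
      ; *-homo = λ x y → trans (canonical (RawRing._*_ coefficients x y)) (trans (*-homo x y) (sym (*-cong (canonical x) (canonical y))))
      ; -‿homo = λ x → trans (canonical (RawRing.-_ coefficients x)) (trans (-‿homo x) (sym (-‿cong (canonical x))))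
      ; 0-homo = refl
      ; 1-homo = refl
      }

    cross-cancel : ∀ a b c d → a + d ≈ c + b → a - b ≈ c - d
    cross-cancel a b c d eq = begin
      a - b                  ≈⟨ +-identityʳ _ ⟨
      (a - b) + 0#           ≈⟨ +-congˡ (-‿inverseʳ d) ⟨
      (a - b) + (d - d)      ≈⟨ interchange _ _ _ _ ⟩
      (a + d) + (- b - d)    ≈⟨ +-cong eq (+-comm _ _) ⟩
      (c + b) + (- d - b)    ≈⟨ interchange _ _ _ _ ⟩
      (c - d) + (b - b)      ≈⟨ +-congˡ (-‿inverseʳ b) ⟩
      (c - d) + 0#           ≈⟨ +-identityʳ _ ⟩
      c - d                  ∎

    -- Equality as integers is sound in every characteristic. Distinct integers may still agree in
    -- K, hence `nothing` rather than a refutation.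
    _coeff≟_ : ∀ x y → Maybe (⟦ x ⟧ ≈ ⟦ y ⟧)
    (a , b) coeff≟ (c , d) with a Nat.+ d Nat.≟ c Nat.+ b
    ... | no _   = nothing
    ... | yes eq = just (trans (canonical (a , b)) (trans (cross-cancel _ _ _ _
                     (trans (sym (×-homo-+ 1# a d)) (trans (×-congˡ eq) (×-homo-+ 1# c b)))) (sym (canonical (c , d)))))

  open import Algebra.Solver.Ring coefficients (fromCommutativeRing K) morphism _coeff≟_ public
    using (Polynomial; solve; con; _:=_; _:+_; _:*_; _:-_; :-_)

  :0 :1 : ∀ {n} → Polynomial n
  :0 = con (0 , 0)
  :1 = con (1 , 0)

-- Fields: inverses, finite products, polynomial functions and their roots.

module FieldProperties {c ℓ} (K : CommutativeRing c ℓ) (isField : IsField K) where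
  open CommutativeRing K hiding (zero)
  open IntegerSolver K
  open import Algebra.Properties.Semiring.Exp semiring using () renaming (_^_ to _^ᴷ_)
  open import Algebra.Properties.CommutativeMonoid.Sum *-commutativeMonoid public using ()
    renaming (sum to prod; sum-cong-≋ to prod-cong; sum-replicate to prod-replicate; sum-permute to prod-permute; ∑-distrib-+ to prod-distrib-*)
  open import Relation.Binary.Reasoning.Setoid setoid

  1≉0 : ¬ 1# ≈ 0#
  1≉0 = proj₁ isField

  x-y≈0⇒x≈y : ∀ {x y} → x - y ≈ 0# → x ≈ y
  x-y≈0⇒x≈y {x} {y} eq = begin
    x            ≈⟨ solve 2 (λ x y → x := (x :- y) :+ y) refl x y ⟩
    (x - y) + y  ≈⟨ +-congʳ eq ⟩
    0# + y       ≈⟨ +-identityˡ y ⟩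
    y            ∎

  x≈y⇒x-y≈0 : ∀ {x y} → x ≈ y → x - y ≈ 0#
  x≈y⇒x-y≈0 {x} {y} eq = trans (+-congʳ eq) (-‿inverseʳ y)

  module _ {x : Carrier} (x≉0 : ¬ x ≈ 0#) where
    inv : Carrier
    inv = proj₁ (proj₂ isField x x≉0)

    inv-inverseʳ : x * inv ≈ 1#
    inv-inverseʳ = proj₂ (proj₂ isField x x≉0)

    x*[y*x⁻¹]≈y : ∀ y → x * (y * inv) ≈ y
    x*[y*x⁻¹]≈y y = begin
      x * (y * inv)  ≈⟨ solve 3 (λ x y z → x :* (y :* z) := y :* (x :* z)) refl x y inv ⟩
      y * (x * inv)  ≈⟨ *-congˡ inv-inverseʳ ⟩
      y * 1#         ≈⟨ *-identityʳ y ⟩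
      y              ∎

    *-cancelˡ-0 : ∀ {y} → x * y ≈ 0# → y ≈ 0#
    *-cancelˡ-0 {y} eq = begin
      y              ≈⟨ x*[y*x⁻¹]≈y y ⟨
      x * (y * inv)  ≈⟨ *-assoc x y inv ⟨
      x * y * inv    ≈⟨ *-congʳ eq ⟩
      0# * inv       ≈⟨ zeroˡ inv ⟩
      0#             ∎

    *-cancelˡ-≈ : ∀ {y z} → x * y ≈ x * z → y ≈ z
    *-cancelˡ-≈ {y} {z} eq = x-y≈0⇒x≈y (*-cancelˡ-0 (begin
      x * (y - z)    ≈⟨ solve 3 (λ x y z → x :* (y :- z) := x :* y :- x :* z) refl x y z ⟩
      x * y - x * z  ≈⟨ x≈y⇒x-y≈0 eq ⟩
      0#             ∎))

    x*y≉0 : ∀ {y} → ¬ y ≈ 0# → ¬ x * y ≈ 0#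
    x*y≉0 y≉0 xy≈0 = y≉0 (*-cancelˡ-0 xy≈0)

  x^n≉0 : ∀ {x} n → ¬ x ≈ 0# → ¬ x ^ᴷ n ≈ 0#
  x^n≉0 zero    x≉0 = 1≉0
  x^n≉0 (suc n) x≉0 = x*y≉0 x≉0 (x^n≉0 n x≉0)

  prod≉0 : ∀ {n} (f : Fin n → Carrier) → (∀ i → ¬ f i ≈ 0#) → ¬ prod f ≈ 0#
  prod≉0 {zero}  f f≉0 = 1≉0
  prod≉0 {suc n} f f≉0 = x*y≉0 (f≉0 zero) (prod≉0 (f ∘ suc) (f≉0 ∘ suc))

  prod-one : ∀ {n} (f : Fin n → Carrier) → (∀ i → f i ≈ 1#) → prod f ≈ 1#
  prod-one {zero}  f f≈1 = refl
  prod-one {suc n} f f≈1 = trans (*-cong (f≈1 zero) (prod-one (f ∘ suc) (f≈1 ∘ suc))) (*-identityˡ 1#)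

  prod-zero : ∀ {n} (f : Fin n → Carrier) i → f i ≈ 0# → prod f ≈ 0#
  prod-zero f zero    f₀≈0 = trans (*-congʳ f₀≈0) (zeroˡ _)
  prod-zero f (suc i) fᵢ≈0 = trans (*-congˡ (prod-zero (f ∘ suc) i fᵢ≈0)) (zeroʳ _)

  prod-single : ∀ {n} (f : Fin n → Carrier) i → (∀ j → i ≢ j → f j ≈ 1#) → prod f ≈ f i
  prod-single f zero    h = trans (*-congˡ (prod-one (f ∘ suc) (λ j → h (suc j) λ ()))) (*-identityʳ _)
  prod-single f (suc i) h =
    trans (*-cong (h zero λ ()) (prod-single (f ∘ suc) i (λ j i≢j → h (suc j) λ { ≡.refl → i≢j ≡.refl }))) (*-identityˡ _)

  -- In Poly n the degree is strictly less than n.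
  data Poly : ℕ → (Carrier → Carrier) → Set (c ⊔ ℓ) where
    nil    : ∀ {g} → (∀ x → g x ≈ 0#) → Poly 0 g
    horner : ∀ {n g h} a → Poly n h → (∀ x → g x ≈ a + x * h x) → Poly (suc n) g

  module _ where
    private variable
      n : ℕ
      g h : Carrier → Carrier

    poly-resp : (∀ x → g x ≈ h x) → Poly n g → Poly n h
    poly-resp g≈h (nil z)        = nil (λ x → trans (sym (g≈h x)) (z x))
    poly-resp g≈h (horner a p e) = horner a p (λ x → trans (sym (g≈h x)) (e x))

    poly-weaken : Poly n g → Poly (suc n) g
    poly-weaken (nil z)        = horner 0# (nil (λ _ → refl)) (λ x → trans (z x) (sym (trans (+-identityˡ _) (zeroʳ x))))
    poly-weaken (horner a p e) = horner a (poly-weaken p) e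

    poly-+ : Poly n g → Poly n h → Poly n (λ x → g x + h x)
    poly-+ (nil y) (nil z) = nil (λ x → trans (+-cong (y x) (z x)) (+-identityˡ 0#))
    poly-+ (horner {h = g′} a p e) (horner {h = h′} b q f) = horner (a + b) (poly-+ p q) λ x →
      trans (+-cong (e x) (f x))
            (solve 5 (λ a x u b v → a :+ x :* u :+ (b :+ x :* v) := a :+ b :+ x :* (u :+ v)) refl a x (g′ x) b (h′ x))

    poly-* : ∀ b → Poly n g → Poly n (λ x → b * g x)
    poly-* b (nil z) = nil (λ x → trans (*-congˡ (z x)) (zeroʳ b))
    poly-* b (horner {h = h} a p e) = horner (b * a) (poly-* b p) λ x →
      trans (*-congˡ (e x)) (solve 4 (λ b a x y → b :* (a :+ x :* y) := b :* a :+ x :* (b :* y)) refl b a x (h x))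

    poly-shift : Poly n g → Poly (suc n) (λ x → x * g x)
    poly-shift p = horner 0# p (λ x → sym (+-identityˡ _))

  poly-^ : ∀ n → Poly (suc n) (_^ᴷ n)
  poly-^ zero    = horner 1# (nil (λ _ → refl)) (λ x → sym (trans (+-congˡ (zeroʳ x)) (+-identityʳ 1#)))
  poly-^ (suc n) = poly-shift (poly-^ n)

  poly-weaken-to : ∀ {m n g} → m Nat.≤ n → Poly m g → Poly n g
  poly-weaken-to m≤n p with ℕₚ.≤⇒≤′ m≤n
  ... | m≤′n = go m≤′n p
    where
    go : ∀ {m n g} → m Nat.≤′ n → Poly m g → Poly n g
    go (Nat.≤′-reflexive ≡.refl) p = p
    go (Nat.≤′-step m≤′n)        p = poly-weaken (go m≤′n p)

  -- Synthetic division along the Horner form: if `k` is the quotient of the inner function `h`, the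
  -- new quotient is `h r + x * k x`.
  poly-divide : ∀ {n g} → Poly (suc n) g → ∀ r → ∃[ h ] Poly n h × (∀ x → g x ≈ g r + (x - r) * h x)
  poly-divide {zero} {g} (horner {h = h} a (nil z) e) r = h , nil z , λ x → begin
    g x                  ≈⟨ e x ⟩
    a + x * h x          ≈⟨ +-congˡ (trans (*-congˡ (z x)) (zeroʳ x)) ⟩
    a + 0#               ≈⟨ +-congˡ (trans (*-congˡ (z r)) (zeroʳ r)) ⟨
    a + r * h r          ≈⟨ e r ⟨
    g r                  ≈⟨ +-identityʳ _ ⟨
    g r + 0#             ≈⟨ +-congˡ (trans (*-congˡ (z x)) (zeroʳ _)) ⟨
    g r + (x - r) * h x  ∎
  poly-divide {suc n} {g} (horner {h = h} a p e) r with poly-divide p r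
  ... | k , k-poly , k-eq = (λ x → h r + x * k x) , horner (h r) k-poly (λ _ → refl) , λ x → begin
    g x                                     ≈⟨ e x ⟩
    a + x * h x                             ≈⟨ +-congˡ (*-congˡ (k-eq x)) ⟩
    a + x * (h r + (x - r) * k x)           ≈⟨ solve 5 (λ a x r u v → a :+ x :* (u :+ (x :- r) :* v) := a :+ r :* u :+ (x :- r) :* (u :+ x :* v)) refl a x r (h r) (k x) ⟩
    a + r * h r + (x - r) * (h r + x * k x) ≈⟨ +-congʳ (e r) ⟨
    g r + (x - r) * (h r + x * k x)         ∎

  -- Dividing out one root leaves the other points as roots of the quotient, because K has no zero
  -- divisors. This is the tool that turns agreement on F into an identity on K.
  poly-vanish : ∀ {n g} → Poly n g → (a : Fin n → Carrier) → (∀ i j → a i ≈ a j → i ≡ j) →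
                (∀ i → g (a i) ≈ 0#) → ∀ x → g x ≈ 0#
  poly-vanish {zero}  (nil z) a a-inj root x = z x
  poly-vanish {suc n} {g} p a a-inj root x with poly-divide p (a zero)
  ... | h , h-poly , h-eq = begin
    g x                                ≈⟨ h-eq x ⟩
    g (a zero) + (x - a zero) * h x    ≈⟨ +-cong (root zero) (*-congˡ (poly-vanish h-poly (a ∘ suc) suc-inj h-root x)) ⟩
    0# + (x - a zero) * 0#             ≈⟨ trans (+-identityˡ _) (zeroʳ _) ⟩
    0#                                 ∎
    where
    suc-inj : ∀ i j → a (suc i) ≈ a (suc j) → i ≡ j
    suc-inj i j eq with a-inj (suc i) (suc j) eq
    ... | ≡.refl = ≡.refl
    h-root : ∀ i → h (a (suc i)) ≈ 0#
    h-root i = *-cancelˡ-0 {a (suc i) - a zero} (λ d≈0 → contradiction (a-inj (suc i) zero (x-y≈0⇒x≈y d≈0)) λ ()) (begin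
      (a (suc i) - a zero) * h (a (suc i))                 ≈⟨ +-identityˡ _ ⟨
      0# + (a (suc i) - a zero) * h (a (suc i))            ≈⟨ +-congʳ (root zero) ⟨
      g (a zero) + (a (suc i) - a zero) * h (a (suc i))    ≈⟨ h-eq (a (suc i)) ⟨
      g (a (suc i))                                        ≈⟨ root (suc i) ⟩
      0#                                                   ∎)

  prod-monic : ∀ m (a : Fin m → Carrier) → ∃[ r ] Poly m r × (∀ x → prod (λ i → x - a i) ≈ x ^ᴷ m + r x)
  prod-monic zero    a = (λ _ → 0#) , nil (λ _ → refl) , λ x → sym (+-identityʳ 1#)
  prod-monic (suc m) a with prod-monic m (a ∘ suc)
  ... | r , r-poly , r-eq =
    (λ x → x * r x + (- a zero * x ^ᴷ m + - a zero * r x)) ,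
    poly-+ (poly-shift r-poly) (poly-+ (poly-* (- a zero) (poly-^ m)) (poly-* (- a zero) (poly-weaken r-poly))) ,
    λ x → trans (*-congˡ (r-eq x))
      (solve 4 (λ x a u v → (x :- a) :* (u :+ v) := x :* u :+ (x :* v :+ (:- a :* u :+ :- a :* v))) refl x (a zero) (x ^ᴷ m) (r x))

  -- Only the degree of the lower part matters, so no binomial coefficient appears; for m = q the
  -- lower part is later identified by its values on F.
  [x+1]^m-monic : ∀ m → ∃[ r ] Poly m r × (∀ x → (x + 1#) ^ᴷ m ≈ x ^ᴷ m + r x)
  [x+1]^m-monic zero    = (λ _ → 0#) , nil (λ _ → refl) , λ x → sym (+-identityʳ 1#)
  [x+1]^m-monic (suc m) with [x+1]^m-monic m
  ... | r , r-poly , r-eq =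
    (λ x → x * r x + (x ^ᴷ m + r x)) ,
    poly-+ (poly-shift r-poly) (poly-+ (poly-^ m) (poly-weaken r-poly)) ,
    λ x → trans (*-congˡ (r-eq x))
      (solve 3 (λ x u v → (x :+ :1) :* (u :+ v) := x :* u :+ (x :* v :+ (u :+ v))) refl x (x ^ᴷ m) (r x))

-- Permutations of an enumerated set.

module Enumeration {c ℓ} (K : CommutativeRing c ℓ) {p} (P : CommutativeRing.Carrier K → Set p)
  (n : ℕ) (f : Fin n → CommutativeRing.Carrier K) (f-in : ∀ i → P (f i))
  (f-inj : ∀ i j → CommutativeRing._≈_ K (f i) (f j) → i ≡ j)
  (f-surj : ∀ x → P x → ∃[ i ] CommutativeRing._≈_ K (f i) x) where
  open CommutativeRing K hiding (zero)

  index : ∀ x → P x → Fin n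
  index x px = proj₁ (f-surj x px)

  f-index : ∀ x (px : P x) → f (index x px) ≈ x
  f-index x px = proj₂ (f-surj x px)

  module _ (σ τ : Carrier → Carrier) (σ-in : ∀ x → P x → P (σ x)) (τ-in : ∀ x → P x → P (τ x))
           (σ-cong : ∀ {x y} → x ≈ y → σ x ≈ σ y) (τ-cong : ∀ {x y} → x ≈ y → τ x ≈ τ y)
           (σ-τ : ∀ x → σ (τ x) ≈ x) (τ-σ : ∀ x → τ (σ x) ≈ x) where
    private
      lift : (ρ : Carrier → Carrier) → (∀ x → P x → P (ρ x)) → Fin n → Fin n
      lift ρ ρ-in i = index (ρ (f i)) (ρ-in (f i) (f-in i))

      lift-inverse : ∀ (ρ : Carrier → Carrier) ρ-in ω ω-in → (∀ {x y} → x ≈ y → ρ x ≈ ρ y) → (∀ x → ρ (ω x) ≈ x) →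
                     ∀ i → lift ρ ρ-in (lift ω ω-in i) ≡ i
      lift-inverse ρ ρ-in ω ω-in ρ-cong ρ-ω i =
        f-inj _ _ (trans (f-index _ _) (trans (ρ-cong (f-index _ _)) (ρ-ω (f i))))

    bijection : Permutation′ n
    bijection = permutation (lift σ σ-in) (lift τ τ-in)
      (lift-inverse σ σ-in τ τ-in σ-cong σ-τ) (lift-inverse τ τ-in σ σ-in τ-cong τ-σ)

    f-bijection : ∀ i → f (bijection ⟨$⟩ʳ i) ≈ σ (f i)
    f-bijection i = f-index _ _

-- The finite fields F and K, and the Frobenius map θ.

module FiniteField {c ℓ} (K : CommutativeRing c ℓ) (isField : IsField K)
  (q : ℕ) (cardK : HasCard K (q ^ 5)) (F : Subfield K) (cardF : SubfieldCard K F q) where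
  open CommutativeRing K hiding (zero)
  open IntegerSolver K
  open FieldProperties K isField
  open Subfield F
  open Counting using (sum; sum-cong; sum-permute)
  open import Algebra.Properties.Semiring.Exp semiring using (^-congˡ) renaming (_^_ to _^ᴷ_)
  open import Algebra.Properties.CommutativeSemiring.Exp commutativeSemiring using () renaming (^-distrib-* to ^ᴷ-distrib-*)
  open import Data.Unit using (⊤)
  open import Relation.Binary.Reasoning.Setoid setoid

  el : Fin (q ^ 5) → Carrier
  el = proj₁ cardK

  el-inj : ∀ i j → el i ≈ el j → i ≡ j
  el-inj = proj₁ (proj₂ cardK)

  private
    module AllK = Enumeration K (λ _ → ⊤) (q ^ 5) el _ el-inj (λ x _ → proj₂ (proj₂ cardK) x)

  ix : Carrier → Fin (q ^ 5)
  ix x = AllK.index x _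

  el-ix : ∀ x → el (ix x) ≈ x
  el-ix x = AllK.f-index x _

  infix 4 _≈?_
  opaque
    _≈?_ : ∀ x y → Dec (x ≈ y)
    x ≈? y = map′ (λ eq → trans (sym (el-ix x)) (trans (reflexive (≡.cong el eq)) (el-ix y)))
                  (λ x≈y → el-inj _ _ (trans (el-ix x) (trans x≈y (sym (el-ix y)))))
                  (ix x ≟ ix y)

  elF : Fin q → Carrier
  elF = proj₁ cardF

  elF-in : ∀ i → In (elF i)
  elF-in = proj₁ (proj₂ cardF)

  elF-inj : ∀ i j → elF i ≈ elF j → i ≡ j
  elF-inj = proj₁ (proj₂ (proj₂ cardF))

  elF-surj : ∀ x → In x → ∃[ i ] elF i ≈ x
  elF-surj = proj₂ (proj₂ (proj₂ cardF))

  opaque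
    In? : ∀ x → Dec (In x)
    In? x = map′ (λ (i , eq) → In-resp eq (elF-in i)) (elF-surj x) (any? (λ i → elF i ≈? x))

  In-sub : ∀ {x y} → In x → In y → In (x - y)
  In-sub x∈F y∈F = In-+ x∈F (In-neg y∈F)

  In-inverse : ∀ {x} (x≉0 : ¬ x ≈ 0#) → In x → In (inv x≉0)
  In-inverse x≉0 x∈F = In-inv x∈F (inv-inverseʳ x≉0)

  2≤q : 2 Nat.≤ q
  2≤q = injective⇒≤ {f = g} g-inj
    where
    open import Data.Fin.Properties using (injective⇒≤)
    i₀ = elF-surj 0# In-0
    i₁ = elF-surj 1# In-1
    i₀≢i₁ : proj₁ i₀ ≢ proj₁ i₁
    i₀≢i₁ eq = 1≉0 (trans (sym (proj₂ i₁)) (trans (reflexive (≡.cong elF (≡.sym eq))) (proj₂ i₀)))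
    g : Fin 2 → Fin q
    g zero = proj₁ i₀
    g (suc zero) = proj₁ i₁
    g-inj : ∀ {i j} → g i ≡ g j → i ≡ j
    g-inj {zero} {zero} _ = ≡.refl
    g-inj {zero} {suc zero} eq = ⊥-elim (i₀≢i₁ eq)
    g-inj {suc zero} {zero} eq = ⊥-elim (i₀≢i₁ (≡.sym eq))
    g-inj {suc zero} {suc zero} _ = ≡.refl

  module _ (g : Carrier → ℕ) (g-cong : ∀ {x y} → x ≈ y → g x ≡ g y) (a : Carrier) where
    sum-translate : sum (λ i → g (el i + a)) ≡ sum (λ i → g (el i))
    sum-translate = ≡.sym (≡.trans (sum-permute (g ∘ el) π)
                                   (sum-cong (λ i → g-cong (AllK.f-bijection (_+ a) (_- a) _ _ +-congʳ +-congʳ inv₁ inv₂ i))))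
      where
      inv₁ : ∀ x → (x - a) + a ≈ x
      inv₁ x = solve 2 (λ x a → (x :- a) :+ a := x) refl x a
      inv₂ : ∀ x → (x + a) - a ≈ x
      inv₂ x = solve 2 (λ x a → (x :+ a) :- a := x) refl x a
      π = AllK.bijection (_+ a) (_- a) _ _ +-congʳ +-congʳ inv₁ inv₂

  -- Multiplication by a permutes the nonzero elements of F; zero is replaced by 1 in the products.
  fermat : ∀ {a} → In a → a ^ᴷ q ≈ a
  fermat {a} a∈F with a ≈? 0#
  ... | yes a≈0 = trans (^-congˡ q a≈0) (trans (0^ (ℕₚ.≤-trans (s≤s z≤n) 2≤q)) (sym a≈0))
    where
    0^ : ∀ {n} → 1 Nat.≤ n → 0# ^ᴷ n ≈ 0#
    0^ (s≤s _) = zeroˡ _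
  ... | no a≉0 = begin
    a ^ᴷ q                               ≈⟨ prod-replicate q ⟨
    prod {q} (λ _ → a)                   ≈⟨ prod-cong (λ i → split (elF i)) ⟨
    prod (λ i → h (elF i) * k (elF i))   ≈⟨ prod-distrib-* (h ∘ elF) (k ∘ elF) ⟩
    prod (h ∘ elF) * prod (k ∘ elF)      ≈⟨ *-cong prod-h prod-k ⟩
    1# * a                               ≈⟨ *-identityˡ a ⟩
    a                                    ∎
    where
    -- The constant a is split as `h * k`: `h` carries it at the q - 1 nonzero elements, where the
    -- permutation gives product 1, and `k` carries the one factor left over at zero.
    g h k : Carrier → Carrier
    g x = if does (x ≈? 0#) then 1# else x
    h x = if does (x ≈? 0#) then 1# else a
    k x = if does (x ≈? 0#) then a else 1#
    split : ∀ x → h x * k x ≈ a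
    split x with x ≈? 0#
    ... | yes _ = *-identityˡ a
    ... | no  _ = *-identityʳ a
    g-cong : ∀ {x y} → x ≈ y → g x ≈ g y
    g-cong {x} {y} x≈y with x ≈? 0# | y ≈? 0#
    ... | yes _   | yes _   = refl
    ... | no  _   | no  _   = x≈y
    ... | yes x≈0 | no y≉0  = contradiction (trans (sym x≈y) x≈0) y≉0
    ... | no  x≉0 | yes y≈0 = contradiction (trans x≈y y≈0) x≉0
    g-scale : ∀ x → g (a * x) ≈ h x * g x
    g-scale x with x ≈? 0# | a * x ≈? 0#
    ... | yes _   | yes _    = sym (*-identityˡ 1#)
    ... | no  _   | no  _    = refl
    ... | yes x≈0 | no ax≉0  = contradiction (trans (*-congˡ x≈0) (zeroʳ a)) ax≉0
    ... | no  x≉0 | yes ax≈0 = contradiction (*-cancelˡ-0 a≉0 ax≈0) x≉0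
    g≉0 : ∀ x → ¬ g x ≈ 0#
    g≉0 x with x ≈? 0#
    ... | yes _  = 1≉0
    ... | no x≉0 = x≉0
    module InF = Enumeration K In q elF elF-in elF-inj elF-surj
    a⁻¹ = inv a≉0
    args₁ : ∀ x → a * (a⁻¹ * x) ≈ x
    args₁ x = trans (*-congˡ (*-comm a⁻¹ x)) (x*[y*x⁻¹]≈y a≉0 x)
    args₂ : ∀ x → a⁻¹ * (a * x) ≈ x
    args₂ x = trans (solve 3 (λ x y z → x :* (y :* z) := y :* (x :* z)) refl a⁻¹ a x) (args₁ x)
    π = InF.bijection (a *_) (a⁻¹ *_) (λ _ → In-* a∈F) (λ _ → In-* (In-inverse a≉0 a∈F)) *-congˡ *-congˡ args₁ args₂
    prod-h : prod (h ∘ elF) ≈ 1#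
    prod-h = *-cancelˡ-≈ (prod≉0 (g ∘ elF) (g≉0 ∘ elF)) (begin
      prod (g ∘ elF) * prod (h ∘ elF)       ≈⟨ *-comm _ _ ⟩
      prod (h ∘ elF) * prod (g ∘ elF)       ≈⟨ prod-distrib-* (h ∘ elF) (g ∘ elF) ⟨
      prod (λ i → h (elF i) * g (elF i))    ≈⟨ prod-cong (λ i → g-scale (elF i)) ⟨
      prod (λ i → g (a * elF i))            ≈⟨ prod-cong (λ i → g-cong (InF.f-bijection (a *_) (a⁻¹ *_) (λ _ → In-* a∈F) (λ _ → In-* (In-inverse a≉0 a∈F)) *-congˡ *-congˡ args₁ args₂ i)) ⟨
      prod (λ i → g (elF (π ⟨$⟩ʳ i)))       ≈⟨ prod-permute (g ∘ elF) π ⟨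
      prod (g ∘ elF)                        ≈⟨ *-identityʳ _ ⟨
      prod (g ∘ elF) * 1#                   ∎)
    i₀ = proj₁ (elF-surj 0# In-0)
    elF-i₀ = proj₂ (elF-surj 0# In-0)
    prod-k : prod (k ∘ elF) ≈ a
    prod-k = trans (prod-single (k ∘ elF) i₀ k≈1) k≈a
      where
      k≈1 : ∀ j → i₀ ≢ j → k (elF j) ≈ 1#
      k≈1 j i₀≢j with elF j ≈? 0#
      ... | yes eq = contradiction (elF-inj _ _ (trans elF-i₀ (sym eq))) i₀≢j
      ... | no  _  = refl
      k≈a : k (elF i₀) ≈ a
      k≈a with elF i₀ ≈? 0#
      ... | yes _ = refl
      ... | no ne = contradiction elF-i₀ ne

  θ : Carrier → Carrier
  θ x = x ^ᴷ q

  θ-cong : ∀ {x y} → x ≈ y → θ x ≈ θ y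
  θ-cong = ^-congˡ q

  θ-* : ∀ x y → θ (x * y) ≈ θ x * θ y
  θ-* x y = ^ᴷ-distrib-* x y q

  θ-F : ∀ {a} → In a → θ a ≈ a
  θ-F = fermat

  θ-0 : θ 0# ≈ 0#
  θ-0 = θ-F In-0

  θ≉0 : ∀ {x} → ¬ x ≈ 0# → ¬ θ x ≈ 0#
  θ≉0 = x^n≉0 q

  -- Both identities hold on the q elements of F, and their two sides differ by a polynomial of degree below q.
  θ-+1 : ∀ x → θ (x + 1#) ≈ θ x + 1#
  θ-+1 x with [x+1]^m-monic q
  ... | r , r-poly , r-eq = begin
    θ (x + 1#)   ≈⟨ r-eq x ⟩
    θ x + r x    ≈⟨ +-congˡ (x-y≈0⇒x≈y (poly-vanish diff elF elF-inj root x)) ⟩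
    θ x + 1#     ∎
    where
    diff : Poly q (λ x → r x + - 1#)
    diff = poly-+ r-poly (poly-weaken-to (ℕₚ.≤-trans (s≤s z≤n) 2≤q)
             (horner (- 1#) (nil (λ _ → refl)) (λ x → sym (trans (+-congˡ (zeroʳ x)) (+-identityʳ _)))))
    root : ∀ i → r (elF i) - 1# ≈ 0#
    root i = begin
      r b - 1#                     ≈⟨ solve 3 (λ r t o → r :- o := (t :+ r) :- (t :+ o)) refl (r b) (θ b) 1# ⟩
      (θ b + r b) - (θ b + 1#)     ≈⟨ +-cong (r-eq b) (-‿cong (+-congʳ (sym (θ-F (elF-in i))))) ⟨
      θ (b + 1#) - (b + 1#)        ≈⟨ x≈y⇒x-y≈0 (θ-F (In-+ (elF-in i) In-1)) ⟩
      0#                           ∎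
      where b = elF i

  prod-x-elF : ∀ x → prod (λ i → x - elF i) ≈ θ x - x
  prod-x-elF x with prod-monic q elF
  ... | r , r-poly , r-eq = begin
    prod (λ i → x - elF i)   ≈⟨ r-eq x ⟩
    θ x + r x                ≈⟨ solve 3 (λ t r x → t :+ r := t :- x :+ (r :+ x)) refl (θ x) (r x) x ⟩
    (θ x - x) + (r x + x)    ≈⟨ +-congˡ (poly-vanish diff elF elF-inj root x) ⟩
    (θ x - x) + 0#           ≈⟨ +-identityʳ _ ⟩
    θ x - x                  ∎
    where
    diff : Poly q (λ x → r x + x)
    -- `2≤q` keeps the monomial x below degree q.
    diff = poly-+ r-poly (poly-weaken-to 2≤q (poly-resp *-identityʳ (poly-^ 1)))
    root : ∀ i → r (elF i) + elF i ≈ 0#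
    root i = begin
      r (elF i) + elF i        ≈⟨ +-comm _ _ ⟩
      elF i + r (elF i)        ≈⟨ +-congʳ (θ-F (elF-in i)) ⟨
      θ (elF i) + r (elF i)    ≈⟨ r-eq (elF i) ⟨
      prod (λ j → elF i - elF j) ≈⟨ prod-zero (λ j → elF i - elF j) i (-‿inverseʳ (elF i)) ⟩
      0#                       ∎

  -- `prod-x-elF` splits `θ x - x` into the factors `x - a` with a in F, and a product of nonzero
  -- elements is nonzero.
  θ-fixed : ∀ {x} → θ x ≈ x → In x
  θ-fixed {x} θx≈x with any? (λ i → x - elF i ≈? 0#)
  ... | yes (i , eq) = In-resp (sym (x-y≈0⇒x≈y eq)) (elF-in i)
  ... | no ∄ = contradiction (trans (prod-x-elF x) (x≈y⇒x-y≈0 θx≈x)) (prod≉0 (λ i → x - elF i) (λ i eq → ∄ (i , eq)))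

  -- Dividing by y reduces additivity to `θ-+1`, because θ is multiplicative.
  θ-+ : ∀ x y → θ (x + y) ≈ θ x + θ y
  θ-+ x y with y ≈? 0#
  ... | yes y≈0 = begin
    θ (x + y)   ≈⟨ θ-cong (trans (+-congˡ y≈0) (+-identityʳ x)) ⟩
    θ x         ≈⟨ +-identityʳ _ ⟨
    θ x + 0#    ≈⟨ +-congˡ (trans (θ-cong y≈0) θ-0) ⟨
    θ x + θ y   ∎
  ... | no y≉0 = begin
    θ (x + y)             ≈⟨ θ-cong (+-congʳ (x*[y*x⁻¹]≈y y≉0 x)) ⟨
    θ (y * z + y)         ≈⟨ θ-cong (solve 2 (λ y z → y :* z :+ y := y :* (z :+ :1)) refl y z) ⟩
    θ (y * (z + 1#))      ≈⟨ θ-* y (z + 1#) ⟩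
    θ y * θ (z + 1#)      ≈⟨ *-congˡ (θ-+1 z) ⟩
    θ y * (θ z + 1#)      ≈⟨ solve 2 (λ y z → y :* (z :+ :1) := y :* z :+ y) refl (θ y) (θ z) ⟩
    θ y * θ z + θ y       ≈⟨ +-congʳ (θ-* y z) ⟨
    θ (y * z) + θ y       ≈⟨ +-congʳ (θ-cong (x*[y*x⁻¹]≈y y≉0 x)) ⟩
    θ x + θ y             ∎
    where z = x * inv y≉0

  θ-neg : ∀ x → θ (- x) ≈ - θ x
  θ-neg x = begin
    θ (- x)        ≈⟨ θ-cong (solve 1 (λ x → :- x := :- :1 :* x) refl x) ⟩
    θ (- 1# * x)   ≈⟨ θ-* (- 1#) x ⟩
    θ (- 1#) * θ x ≈⟨ *-congʳ (θ-F (In-neg In-1)) ⟩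
    - 1# * θ x     ≈⟨ solve 1 (λ x → :- :1 :* x := :- x) refl (θ x) ⟩
    - θ x          ∎

  θ-sub : ∀ x y → θ (x - y) ≈ θ x - θ y
  θ-sub x y = trans (θ-+ x (- y)) (+-congˡ (θ-neg y))

  θ-injective : ∀ {x y} → θ x ≈ θ y → x ≈ y
  θ-injective {x} {y} eq with x - y ≈? 0#
  ... | yes d≈0 = x-y≈0⇒x≈y d≈0
  ... | no  d≉0 = contradiction (trans (θ-sub x y) (x≈y⇒x-y≈0 eq)) (θ≉0 d≉0)

  -- Pigeonhole: a missed value y together with the values of the injective θ would give
  -- `suc (q ^ 5)` distinct elements.
  θ-surjective : ∀ y → ∃[ x ] θ x ≈ y
  θ-surjective y with any? (λ i → θ (el i) ≈? y)
  ... | yes (i , eq) = el i , eq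
  ... | no ∄ = contradiction (injective⇒≤ {f = g} g-inj) ℕₚ.1+n≰n
    where
    open import Data.Fin.Properties using (injective⇒≤)
    g : Fin (suc (q ^ 5)) → Fin (q ^ 5)
    g zero    = ix y
    g (suc i) = ix (θ (el i))
    ix-inj : ∀ {x z} → ix x ≡ ix z → x ≈ z
    ix-inj {x} {z} eq = trans (sym (el-ix x)) (trans (reflexive (≡.cong el eq)) (el-ix z))
    g-inj : ∀ {i j} → g i ≡ g j → i ≡ j
    g-inj {zero}  {zero}  _  = ≡.refl
    g-inj {zero}  {suc j} eq = ⊥-elim (∄ (j , sym (ix-inj eq)))
    g-inj {suc i} {zero}  eq = ⊥-elim (∄ (i , ix-inj eq))
    g-inj {suc i} {suc j} eq = ≡.cong suc (el-inj i j (θ-injective (ix-inj eq)))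

-- F-spans, dimension by counting, and the affine classes outside F.

module Spans {c ℓ} (K : CommutativeRing c ℓ) (isField : IsField K)
  (q : ℕ) (cardK : HasCard K (q ^ 5)) (F : Subfield K) (cardF : SubfieldCard K F q) where
  open CommutativeRing K hiding (zero)
  open IntegerSolver K
  open FieldProperties K isField
  open FiniteField K isField q cardK F cardF
  open Subfield F
  open Counting
  open import Algebra.Properties.Semiring.Sum semiring using () renaming (sum to ∑ᴷ)
  open import Data.Unit.Polymorphic using (⊤; tt)
  import Relation.Binary.Reasoning.Setoid setoid as ≈-R

  lin : ∀ {k} → (Fin k → Carrier) → (Fin k → Carrier) → Carrier
  lin a e = ∑ᴷ (λ i → a i * e i)

  -- Membership peels off one coefficient at a time, with coefficients indexed by `Fin q`; this
  -- makes it decidable and countable by induction on k.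
  Span : ∀ k → (Fin k → Carrier) → Carrier → Set ℓ
  Span zero    e x = x ≈ 0#
  Span (suc k) e x = ∃[ i ] Span k (e ∘ suc) (x - elF i * e zero)

  Indep : ∀ k → (Fin k → Carrier) → Set ℓ
  Indep zero    e = ⊤
  Indep (suc k) e = ¬ Span k (e ∘ suc) (e zero) × Indep k (e ∘ suc)

  opaque
    span? : ∀ k e x → Dec (Span k e x)
    span? zero    e x = x ≈? 0#
    span? (suc k) e x = any? (λ i → span? k (e ∘ suc) (x - elF i * e zero))

  span-resp : ∀ k e {x y} → x ≈ y → Span k e x → Span k e y
  span-resp zero    e x≈y s       = trans (sym x≈y) s
  span-resp (suc k) e x≈y (i , s) = i , span-resp k (e ∘ suc) (+-congʳ x≈y) s

  span-lin : ∀ k e (a : Fin k → Carrier) → (∀ i → In (a i)) → Span k e (lin a e)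
  span-lin zero    e a a∈F = refl
  span-lin (suc k) e a a∈F with elF-surj (a zero) (a∈F zero)
  ... | i , eq = i , span-resp k (e ∘ suc) (begin
      lin (a ∘ suc) (e ∘ suc)                                       ≈⟨ solve 2 (λ x y → y := (x :+ y) :- x) refl (a zero * e zero) (lin (a ∘ suc) (e ∘ suc)) ⟩
      (a zero * e zero + lin (a ∘ suc) (e ∘ suc)) - a zero * e zero  ≈⟨ +-congˡ (-‿cong (*-congʳ eq)) ⟨
      lin a e - elF i * e zero                                      ∎)
      (span-lin k (e ∘ suc) (a ∘ suc) (a∈F ∘ suc))
    where open ≈-R

  span-coords : ∀ k e {x} → Span k e x → ∃[ a ] (∀ i → In (a i)) × x ≈ lin {k} a e
  span-coords zero    e x≈0     = (λ ()) , (λ ()) , x≈0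
  span-coords (suc k) e {x} (i , s) with span-coords k (e ∘ suc) s
  ... | a , a∈F , eq = elF i ◂ a , (λ { zero → elF-in i ; (suc j) → a∈F j }) , (begin
      x                                         ≈⟨ solve 2 (λ x y → x := y :+ (x :- y)) refl x (elF i * e zero) ⟩
      elF i * e zero + (x - elF i * e zero)     ≈⟨ +-congˡ eq ⟩
      elF i * e zero + lin a (e ∘ suc)          ∎)
    where open ≈-R

  lin-combine : ∀ {k} c (a b e : Fin k → Carrier) → lin a e - c * lin b e ≈ lin (λ i → a i - c * b i) e
  lin-combine {zero}  c a b e = solve 1 (λ c → :0 :- c :* :0 := :0) refl c
  lin-combine {suc k} c a b e = trans
    (solve 6 (λ c a b e x y → (a :* e :+ x) :- c :* (b :* e :+ y) := (a :- c :* b) :* e :+ (x :- c :* y)) refl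
       c (a zero) (b zero) (e zero) (lin (a ∘ suc) (e ∘ suc)) (lin (b ∘ suc) (e ∘ suc)))
    (+-congˡ (lin-combine c (a ∘ suc) (b ∘ suc) (e ∘ suc)))

  span-combine : ∀ k e {x y c} → In c → Span k e x → Span k e y → Span k e (x - c * y)
  span-combine k e {x} {y} {c} c∈F sx sy with span-coords k e sx | span-coords k e sy
  ... | a , a∈F , x≈ | b , b∈F , y≈ =
    span-resp k e (sym (trans (+-cong x≈ (-‿cong (*-congˡ y≈))) (lin-combine c a b e)))
      (span-lin k e _ (λ i → In-sub (a∈F i) (In-* c∈F (b∈F i))))

  span-cancel : ∀ k e {x c} → In c → ¬ c ≈ 0# → Span k e (c * x) → Span k e x
  span-cancel k e {x} {c} c∈F c≉0 s =
    span-resp k e (begin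
      0# - (- inv c≉0) * (c * x)   ≈⟨ solve 3 (λ i c x → :0 :- (:- i) :* (c :* x) := c :* (x :* i)) refl (inv c≉0) c x ⟩
      c * (x * inv c≉0)            ≈⟨ x*[y*x⁻¹]≈y c≉0 x ⟩
      x                            ∎)
      (span-combine k e (In-neg (In-inverse c≉0 c∈F)) (span-0 k e) s)
    where
    open ≈-R
    span-0 : ∀ k e → Span k e 0#
    span-0 k e = span-resp k e (lin-0 k e) (span-lin k e (λ _ → 0#) (λ _ → In-0))
      where
      lin-0 : ∀ k (e : Fin k → Carrier) → lin (λ _ → 0#) e ≈ 0#
      lin-0 zero    e = refl
      lin-0 (suc k) e = trans (+-cong (zeroˡ _) (lin-0 k (e ∘ suc))) (+-identityˡ 0#)

  span-unique : ∀ k e → Indep (suc k) e → ∀ {x} i j →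
                Span k (e ∘ suc) (x - elF i * e zero) → Span k (e ∘ suc) (x - elF j * e zero) → i ≡ j
  span-unique k e (e₀∉ , _) {x} i j si sj with elF j - elF i ≈? 0#
  ... | yes d≈0 = ≡.sym (elF-inj j i (x-y≈0⇒x≈y d≈0))
  ... | no  d≉0 = contradiction (span-cancel k (e ∘ suc) (In-sub (elF-in j) (elF-in i)) d≉0
      (span-resp k (e ∘ suc)
        (solve 4 (λ x a b e → (x :- a :* e) :- :1 :* (x :- b :* e) := (b :- a) :* e) refl x (elF i) (elF j) (e zero))
        (span-combine k (e ∘ suc) In-1 si sj))) e₀∉

  -- Independence makes the first coefficient unique, so the span is a disjoint union of q
  -- translates of the span of the remaining elements.
  span-card : ∀ k e → Indep k e → sum (λ i → ind (span? k e (el i))) ≡ q ^ k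
  span-card zero e _ = sum-ind-1 (λ i → span? 0 e (el i)) (ix 0#) (el-ix 0#)
    (λ j eq → el-inj _ _ (trans (el-ix 0#) (sym eq)))
  span-card (suc k) e indep@(_ , indep′) = begin
    sum (λ i → ind (span? (suc k) e (el i)))
      ≡⟨ sum-cong (λ i → ≡.sym (sum-ind-∃ (λ j → span? k e′ (el i - elF j * e zero)) (span? (suc k) e (el i)) (span-unique k e indep))) ⟩
    sum (λ i → sum (λ j → ind (span? k e′ (el i - elF j * e zero))))
      ≡⟨ sum-swap (λ i j → ind (span? k e′ (el i - elF j * e zero))) ⟩
    sum (λ j → sum (λ i → ind (span? k e′ (el i - elF j * e zero))))
      ≡⟨ sum-cong (λ j → sum-translate (λ x → ind (span? k e′ x)) resp (- (elF j * e zero))) ⟩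
    sum {q} (λ j → sum (λ i → ind (span? k e′ (el i))))
      ≡⟨ sum-const q _ ⟩
    q Nat.* sum (λ i → ind (span? k e′ (el i)))
      ≡⟨ ≡.cong (q Nat.*_) (span-card k e′ indep′) ⟩
    q Nat.* q ^ k ∎
    where
    open ≡.≡-Reasoning
    e′ = e ∘ suc
    resp : ∀ {x y} → x ≈ y → ind (span? k e′ x) ≡ ind (span? k e′ y)
    resp x≈y = ind-cong (span? k e′ _) (span? k e′ _) (span-resp k e′ x≈y) (span-resp k e′ (sym x≈y))

  instance
    q-nonZero : NonZero q
    q-nonZero = Nat.>-nonZero (ℕₚ.≤-trans (s≤s z≤n) 2≤q)

  indep-extend : ∀ k e → Indep k e → k Nat.< 5 → ∃[ x ] ¬ Span k e x
  indep-extend k e indep k<5 with sum-find (λ i → ind (span? k e (el i))) (λ _ → 1)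
      (≡.subst₂ Nat._<_ (≡.sym (span-card k e indep)) (≡.sym (≡.trans (sum-const (q ^ 5) 1) (ℕₚ.*-identityʳ _)))
        (ℕₚ.^-monoʳ-< q 2≤q k<5))
  ... | i , lt = el i , λ s → ℕₚ.<-irrefl (ind-yes (span? k e (el i)) s) lt

  indep-exists : ∀ k → k Nat.≤ 5 → ∃[ e ] Indep k e
  indep-exists zero    _ = ◇ , tt
  indep-exists (suc k) k<5 with indep-exists k (ℕₚ.<⇒≤ k<5)
  ... | e , indep with indep-extend k e indep k<5
  ...   | x , x∉ = x ◂ e , x∉ , indep

  -- A sixth independent element would give `q ^ 6` elements inside K. Together with `indep-exists`
  -- this recovers the degree 5 of K over F from cardinalities.
  indep-spans : ∀ e → Indep 5 e → ∀ x → Span 5 e x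
  indep-spans e indep x with span? 5 e x
  ... | yes s = s
  ... | no x∉ = contradiction
      (≡.subst₂ Nat._≤_ (span-card 6 (x ◂ e) (x∉ , indep)) (≡.trans (sum-const (q ^ 5) 1) (ℕₚ.*-identityʳ _))
        (sum-mono (λ i → ind-mono (span? 6 (x ◂ e) (el i)) (yes tt) (λ _ → tt {ℓ}))))
      (ℕₚ.<⇒≱ (ℕₚ.^-monoʳ-< q 2≤q (ℕₚ.n<1+n 5)))

  indep⇒lin≈0 : ∀ k e → Indep k e → (a : Fin k → Carrier) → (∀ i → In (a i)) → lin a e ≈ 0# → ∀ i → a i ≈ 0#
  indep⇒lin≈0 (suc k) e (e₀∉ , indep) a a∈F eq = λ { zero → a₀≈0 ; (suc i) → indep⇒lin≈0 k (e ∘ suc) indep (a ∘ suc) (a∈F ∘ suc) rest≈0 i }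
    where
    open ≈-R
    rest = lin (a ∘ suc) (e ∘ suc)
    a₀≈0 : a zero ≈ 0#
    a₀≈0 = decidable-stable (a zero ≈? 0#) λ a₀≉0 → e₀∉ (span-cancel k (e ∘ suc) (In-neg (a∈F zero)) (λ -a≈0 → a₀≉0 (begin
      a zero       ≈⟨ solve 1 (λ a → a := :- :- a) refl (a zero) ⟩
      - - a zero   ≈⟨ -‿cong -a≈0 ⟩
      - 0#         ≈⟨ solve 0 (:- :0 := :0) refl ⟩
      0#           ∎))
      (span-resp k (e ∘ suc) (begin
        rest                                           ≈⟨ solve 3 (λ a e r → r := (a :* e :+ r) :+ :- a :* e) refl (a zero) (e zero) rest ⟩
        (a zero * e zero + rest) + - a zero * e zero   ≈⟨ +-congʳ eq ⟩
        0# + - a zero * e zero                         ≈⟨ +-identityˡ _ ⟩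
        - a zero * e zero                              ∎)
      (span-lin k (e ∘ suc) (a ∘ suc) (a∈F ∘ suc))))
    rest≈0 : rest ≈ 0#
    rest≈0 = begin
      rest                       ≈⟨ +-identityˡ _ ⟨
      0# + rest                  ≈⟨ +-congʳ (trans (*-congʳ a₀≈0) (zeroˡ _)) ⟨
      a zero * e zero + rest     ≈⟨ eq ⟩
      0#                         ∎

  -- The F-span of 1 and λ′. Between elements outside F, `V λ′ μ` is an equivalence relation: μ = a
  -- + b λ′ with b ≠ 0.
  V : Carrier → Carrier → Set (c ⊔ ℓ)
  V λ′ x = ∃[ a ] ∃[ b ] In a × In b × x ≈ a + b * λ′

  private
    pair : Carrier → Fin 2 → Carrier
    pair λ′ = λ′ ◂ (1# ◂ ◇)

    V⇒Span : ∀ {λ′ x} → V λ′ x → Span 2 (pair λ′) x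
    V⇒Span {λ′} {x} (a , b , a∈F , b∈F , eq) = span-resp 2 (pair λ′)
      (trans (solve 3 (λ a b l → b :* l :+ (a :* :1 :+ :0) := a :+ b :* l) refl a b λ′) (sym eq))
      (span-lin 2 (pair λ′) (b ◂ (a ◂ ◇)) (λ { zero → b∈F ; (suc zero) → a∈F }))

    Span⇒V : ∀ {λ′ x} → Span 2 (pair λ′) x → V λ′ x
    Span⇒V {λ′} s with span-coords 2 (pair λ′) s
    ... | a , a∈F , eq = a (suc zero) , a zero , a∈F (suc zero) , a∈F zero ,
      trans eq (solve 3 (λ a b l → b :* l :+ (a :* :1 :+ :0) := a :+ b :* l) refl (a (suc zero)) (a zero) λ′)

    Span⇒In : ∀ {x} → Span 1 (1# ◂ ◇) x → In x
    Span⇒In {x} (i , eq) = In-resp (sym (trans (x-y≈0⇒x≈y eq) (*-identityʳ _))) (elF-in i)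

    In⇒Span : ∀ {x} → In x → Span 1 (1# ◂ ◇) x
    In⇒Span {x} x∈F with elF-surj x x∈F
    ... | i , eq = i , x≈y⇒x-y≈0 (trans (sym eq) (sym (*-identityʳ _)))

  opaque
    V? : ∀ λ′ x → Dec (V λ′ x)
    V? λ′ x = map′ Span⇒V V⇒Span (span? 2 (pair λ′) x)

  V-resp : ∀ {λ′ x y} → x ≈ y → V λ′ x → V λ′ y
  V-resp x≈y (a , b , a∈F , b∈F , eq) = a , b , a∈F , b∈F , trans (sym x≈y) eq

  V-card : ∀ {λ′} → ¬ In λ′ → sum (λ i → ind (V? λ′ (el i))) ≡ q ^ 2
  V-card {λ′} λ∉F = ≡.trans
    (sum-cong (λ i → ind-cong (V? λ′ (el i)) (span? 2 (pair λ′) (el i)) V⇒Span Span⇒V))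
    (span-card 2 (pair λ′) ((λ s → λ∉F (Span⇒In s)) , 1≉0 , tt))

  In-card : sum (λ i → ind (In? (el i))) ≡ q
  In-card = ≡.trans
    (sum-cong (λ i → ind-cong (In? (el i)) (span? 1 (1# ◂ ◇) (el i)) In⇒Span Span⇒In))
    (≡.trans (span-card 1 (1# ◂ ◇) (1≉0 , tt)) (ℕₚ.*-identityʳ q))

  V-refl : ∀ {λ′} → V λ′ λ′
  V-refl {λ′} = 0# , 1# , In-0 , In-1 , solve 1 (λ l → l := :0 :+ :1 :* l) refl λ′

  In⇒V : ∀ {λ′ a} → In a → V λ′ a
  In⇒V {λ′} {a} a∈F = a , 0# , a∈F , In-0 , solve 2 (λ l a → a := a :+ :0 :* l) refl λ′ a

  V-trans : ∀ {λ′ μ ν} → V λ′ μ → V μ ν → V λ′ ν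
  V-trans {λ′} (a , b , a∈F , b∈F , eq) (c , d , c∈F , d∈F , eq′) =
    c + d * a , d * b , In-+ c∈F (In-* d∈F a∈F) , In-* d∈F b∈F ,
    trans eq′ (trans (+-congˡ (*-congˡ eq)) (solve 5 (λ c d a b l → c :+ d :* (a :+ b :* l) := c :+ d :* a :+ d :* b :* l) refl c d a b λ′))

  V-sym : ∀ {λ′ μ} → ¬ In μ → V λ′ μ → V μ λ′
  V-sym {λ′} {μ} μ∉F (a , b , a∈F , b∈F , eq) =
    - a * b⁻¹ , b⁻¹ , In-* (In-neg a∈F) (In-inverse b≉0 b∈F) , In-inverse b≉0 b∈F , sym (begin
      - a * b⁻¹ + b⁻¹ * μ              ≈⟨ +-congˡ (*-congˡ eq) ⟩
      - a * b⁻¹ + b⁻¹ * (a + b * λ′)   ≈⟨ solve 4 (λ a b i l → :- a :* i :+ i :* (a :+ b :* l) := b :* (l :* i)) refl a b b⁻¹ λ′ ⟩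
      b * (λ′ * b⁻¹)                   ≈⟨ x*[y*x⁻¹]≈y b≉0 λ′ ⟩
      λ′                               ∎)
    where
    open ≈-R
    b≉0 : ¬ b ≈ 0#
    b≉0 b≈0 = μ∉F (In-resp (sym (trans eq (trans (+-congˡ (trans (*-congʳ b≈0) (zeroˡ _))) (+-identityʳ a)))) a∈F)
    b⁻¹ = inv b≉0

  record Representatives : Set (c ⊔ ℓ) where
    field
      D      : ℕ
      Λ      : Fin D → Carrier
      Λ∉F    : ∀ i → ¬ In (Λ i)
      Λ-inj  : ∀ i j → V (Λ i) (Λ j) → i ≡ j
      Λ-surj : ∀ x → ¬ In x → ∃[ i ] V (Λ i) x

  private
    representatives-of : ∀ m (g : Fin m → Carrier) → ∃[ D ] ∃ λ (Λ : Fin D → Carrier) →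
      (∀ i → ¬ In (Λ i)) × (∀ i j → V (Λ i) (Λ j) → i ≡ j) × (∀ k → ¬ In (g k) → ∃[ i ] V (Λ i) (g k))
    representatives-of zero g = 0 , ◇ , (λ ()) , (λ ()) , λ ()
    representatives-of (suc m) g with representatives-of m (g ∘ suc)
    ... | D , Λ , Λ∉F , Λ-inj , Λ-surj with In? (g zero) | any? (λ i → V? (Λ i) (g zero))
    ... | yes g₀∈F | _ = D , Λ , Λ∉F , Λ-inj , λ { zero g₀∉F → contradiction g₀∈F g₀∉F ; (suc k) → Λ-surj k }
    ... | no _ | yes v = D , Λ , Λ∉F , Λ-inj , λ { zero _ → v ; (suc k) → Λ-surj k }
    ... | no g₀∉F | no ∄ = suc D , g zero ◂ Λ , (λ { zero → g₀∉F ; (suc i) → Λ∉F i }) , inj , surj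
      where
      inj : ∀ i j → V ((g zero ◂ Λ) i) ((g zero ◂ Λ) j) → i ≡ j
      inj zero    zero    v = ≡.refl
      inj zero    (suc j) v = ⊥-elim (∄ (j , V-sym (Λ∉F j) v))
      inj (suc i) zero    v = ⊥-elim (∄ (i , v))
      inj (suc i) (suc j) v = ≡.cong suc (Λ-inj i j v)
      surj : ∀ k → ¬ In (g k) → ∃[ i ] V ((g zero ◂ Λ) i) (g k)
      surj zero    _ = zero , V-refl
      surj (suc k) h with Λ-surj k h
      ... | i , v = suc i , v

  opaque
    representatives : Representatives
    representatives with representatives-of (q ^ 5) el
    ... | D , Λ , Λ∉F , Λ-inj , Λ-surj = record
      { D = D ; Λ = Λ ; Λ∉F = Λ∉F ; Λ-inj = Λ-inj
      ; Λ-surj = λ x x∉F → let i , v = Λ-surj (ix x) (λ h → x∉F (In-resp (el-ix x) h)) in i , V-resp (el-ix x) v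
      }

  open Representatives representatives public

  V-unique : ∀ {x} → ¬ In x → ∀ i j → V (Λ i) x → V (Λ j) x → i ≡ j
  V-unique x∉F i j vi vj = Λ-inj i j (V-trans vi (V-sym x∉F vj))

  private
    -- The planes `V (Λ l)` all contain F and are disjoint outside it, so x lies in exactly one of
    -- them if it is outside F and in all D of them otherwise.
    cover : ∀ x → sum (λ l → ind (V? (Λ l) x)) Nat.+ ind (In? x) ≡ 1 Nat.+ D Nat.* ind (In? x)
    cover x with In? x
    ... | yes x∈F = begin
      sum (λ l → ind (V? (Λ l) x)) Nat.+ 1 ≡⟨ ≡.cong (Nat._+ 1) (sum-cong (λ l → ind-yes (V? (Λ l) x) (In⇒V x∈F))) ⟩
      sum {D} (λ l → 1) Nat.+ 1            ≡⟨ ≡.cong (Nat._+ 1) (sum-const D 1) ⟩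
      D Nat.* 1 Nat.+ 1                    ≡⟨ ℕₚ.+-comm (D Nat.* 1) 1 ⟩
      1 Nat.+ D Nat.* 1                    ∎
      where open ≡.≡-Reasoning
    ... | no x∉F with Λ-surj x x∉F
    ...   | i , v = begin
      sum (λ l → ind (V? (Λ l) x)) Nat.+ 0 ≡⟨ ℕₚ.+-identityʳ _ ⟩
      sum (λ l → ind (V? (Λ l) x))         ≡⟨ sum-ind-1 (λ l → V? (Λ l) x) i v (λ j → V-unique x∉F i j v) ⟩
      1                                    ≡⟨ ≡.cong suc (ℕₚ.*-zeroʳ D) ⟨
      1 Nat.+ D Nat.* 0                    ∎
      where open ≡.≡-Reasoning

    -- Incidences between elements and planes are counted in two ways; this is D (q² - q) = q⁵ - q
    -- without subtraction.
    D-equation : D Nat.* q ^ 2 Nat.+ q ≡ q ^ 5 Nat.* 1 Nat.+ D Nat.* q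
    D-equation = begin
      D Nat.* q ^ 2 Nat.+ q
        ≡⟨ ≡.cong₂ Nat._+_ (≡.trans (sum-cong (λ l → V-card (Λ∉F l))) (sum-const D (q ^ 2))) In-card ⟨
      sum (λ l → sum (λ i → ind (V? (Λ l) (el i)))) Nat.+ sum (λ i → ind (In? (el i)))
        ≡⟨ ≡.cong (Nat._+ sum (λ i → ind (In? (el i)))) (sum-swap (λ i l → ind (V? (Λ l) (el i)))) ⟨
      sum (λ i → sum (λ l → ind (V? (Λ l) (el i)))) Nat.+ sum (λ i → ind (In? (el i)))
        ≡⟨ sum-+ (λ i → sum (λ l → ind (V? (Λ l) (el i)))) (λ i → ind (In? (el i))) ⟨
      sum (λ i → sum (λ l → ind (V? (Λ l) (el i))) Nat.+ ind (In? (el i)))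
        ≡⟨ sum-cong (λ i → cover (el i)) ⟩
      sum (λ i → 1 Nat.+ D Nat.* ind (In? (el i)))
        ≡⟨ sum-+ (λ _ → 1) (λ i → D Nat.* ind (In? (el i))) ⟩
      sum {q ^ 5} (λ _ → 1) Nat.+ sum (λ i → D Nat.* ind (In? (el i)))
        ≡⟨ ≡.cong₂ Nat._+_ (sum-const (q ^ 5) 1) (≡.trans (sum-*ˡ D (λ i → ind (In? (el i)))) (≡.cong (D Nat.*_) In-card)) ⟩
      q ^ 5 Nat.* 1 Nat.+ D Nat.* q ∎
      where open ≡.≡-Reasoning

  D-value : D ≡ 1 Nat.+ q Nat.+ q Nat.* q Nat.+ q Nat.* q Nat.* q
  D-value = value q D 2≤q D-equation
    where
    value : ∀ q D → 2 Nat.≤ q → D Nat.* q ^ 2 Nat.+ q ≡ q ^ 5 Nat.* 1 Nat.+ D Nat.* q →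
            D ≡ 1 Nat.+ q Nat.+ q Nat.* q Nat.+ q Nat.* q Nat.* q
    value 1 D (s≤s ()) _
    -- The cancelled factor is q (q - 1), with q = r + 2.
    value (suc (suc r)) D _ eq = ℕₚ.*-cancelʳ-≡ _ _ (suc (suc r) Nat.* suc r)
      (ℕₚ.+-cancelʳ-≡ (D Nat.* suc (suc r) Nat.+ suc (suc r)) _ _ (≡.trans (left r D) (≡.trans eq (right r D))))
      where
      left : ∀ r D → let q = suc (suc r) in
             D Nat.* (q Nat.* suc r) Nat.+ (D Nat.* q Nat.+ q) ≡ D Nat.* (q Nat.* (q Nat.* 1)) Nat.+ q
      left = solve-∀
      right : ∀ r D → let q = suc (suc r) in
              (q Nat.* (q Nat.* (q Nat.* (q Nat.* (q Nat.* 1))))) Nat.* 1 Nat.+ D Nat.* q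
              ≡ (1 Nat.+ q Nat.+ q Nat.* q Nat.+ q Nat.* q Nat.* q) Nat.* (q Nat.* suc r) Nat.+ (D Nat.* q Nat.+ q)
      right = solve-∀

-- Linear algebra over F: dot products and duality.

module Separation {c ℓ} (K : CommutativeRing c ℓ) (isField : IsField K)
  (q : ℕ) (cardK : HasCard K (q ^ 5)) (F : Subfield K) (cardF : SubfieldCard K F q) where
  open CommutativeRing K hiding (zero)
  open IntegerSolver K
  open FieldProperties K isField
  open FiniteField K isField q cardK F cardF
  open Spans K isField q cardK F cardF
  open Subfield F
  open import Algebra.Properties.Semiring.Sum semiring using () renaming (sum-cong-≋ to ∑ᴷ-cong)
  open import Relation.Binary.Reasoning.Setoid setoid

  lin-cong : ∀ {n} {a b e f : Fin n → Carrier} → (∀ i → a i ≈ b i) → (∀ i → e i ≈ f i) → lin a e ≈ lin b f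
  lin-cong a≈b e≈f = ∑ᴷ-cong (λ i → *-cong (a≈b i) (e≈f i))

  lin-comm : ∀ {n} (a e : Fin n → Carrier) → lin a e ≈ lin e a
  lin-comm a e = ∑ᴷ-cong (λ i → *-comm (a i) (e i))

  lin-zeroˡ : ∀ {n} (a e : Fin n → Carrier) → (∀ i → a i ≈ 0#) → lin a e ≈ 0#
  lin-zeroˡ {zero}  a e a≈0 = refl
  lin-zeroˡ {suc n} a e a≈0 =
    trans (+-cong (trans (*-congʳ (a≈0 zero)) (zeroˡ _)) (lin-zeroˡ (a ∘ suc) (e ∘ suc) (a≈0 ∘ suc))) (+-identityˡ 0#)

  lin-zeroʳ : ∀ {n} (a e : Fin n → Carrier) → (∀ i → e i ≈ 0#) → lin a e ≈ 0#
  lin-zeroʳ a e e≈0 = trans (lin-comm a e) (lin-zeroˡ e a e≈0)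

  lin-addˡ : ∀ {n} κ (a b e : Fin n → Carrier) → lin (λ i → a i + κ * b i) e ≈ lin a e + κ * lin b e
  lin-addˡ {zero}  κ a b e = solve 1 (λ κ → :0 := :0 :+ κ :* :0) refl κ
  lin-addˡ {suc n} κ a b e = trans (+-congˡ (lin-addˡ κ (a ∘ suc) (b ∘ suc) (e ∘ suc)))
    (solve 6 (λ κ a b e x y → (a :+ κ :* b) :* e :+ (x :+ κ :* y) := (a :* e :+ x) :+ κ :* (b :* e :+ y)) refl
      κ (a zero) (b zero) (e zero) (lin (a ∘ suc) (e ∘ suc)) (lin (b ∘ suc) (e ∘ suc)))

  lin-addʳ : ∀ {n} κ (a e f : Fin n → Carrier) → lin a (λ i → e i + κ * f i) ≈ lin a e + κ * lin a f
  lin-addʳ κ a e f = trans (lin-comm a _) (trans (lin-addˡ κ e f a) (+-cong (lin-comm e a) (*-congˡ (lin-comm f a))))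

  lin-lin : ∀ k {n} (a : Fin k → Carrier) (ts : Fin k → Fin n → Carrier) (ψ : Fin n → Carrier) →
            lin (λ j → lin a (λ i → ts i j)) ψ ≈ lin a (λ i → lin (ts i) ψ)
  lin-lin zero    a ts ψ = lin-zeroˡ _ ψ (λ _ → refl)
  lin-lin (suc k) a ts ψ = begin
    lin (λ j → a zero * ts zero j + lin (a ∘ suc) (λ i → ts (suc i) j)) ψ
      ≈⟨ lin-cong {e = ψ} (λ j → +-comm _ _) (λ _ → refl) ⟩
    lin (λ j → lin (a ∘ suc) (λ i → ts (suc i) j) + a zero * ts zero j) ψ
      ≈⟨ lin-addˡ (a zero) (λ j → lin (a ∘ suc) (λ i → ts (suc i) j)) (ts zero) ψ ⟩
    lin (λ j → lin (a ∘ suc) (λ i → ts (suc i) j)) ψ + a zero * lin (ts zero) ψ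
      ≈⟨ +-congʳ (lin-lin k (a ∘ suc) (ts ∘ suc) ψ) ⟩
    lin (a ∘ suc) (λ i → lin (ts (suc i)) ψ) + a zero * lin (ts zero) ψ
      ≈⟨ +-comm _ _ ⟩
    a zero * lin (ts zero) ψ + lin (a ∘ suc) (λ i → lin (ts (suc i)) ψ) ∎

  lin-in : ∀ {n} (a e : Fin n → Carrier) → (∀ i → In (a i)) → (∀ i → In (e i)) → In (lin a e)
  lin-in {zero}  a e a∈F e∈F = In-0
  lin-in {suc n} a e a∈F e∈F = In-+ (In-* (a∈F zero) (e∈F zero)) (lin-in (a ∘ suc) (e ∘ suc) (a∈F ∘ suc) (e∈F ∘ suc))

  θ-lin : ∀ {n} (a e : Fin n → Carrier) → (∀ i → In (a i)) → θ (lin a e) ≈ lin a (θ ∘ e)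
  θ-lin {zero}  a e a∈F = θ-0
  θ-lin {suc n} a e a∈F = begin
    θ (a zero * e zero + lin (a ∘ suc) (e ∘ suc))          ≈⟨ θ-+ _ _ ⟩
    θ (a zero * e zero) + θ (lin (a ∘ suc) (e ∘ suc))      ≈⟨ +-cong (θ-* _ _) (θ-lin (a ∘ suc) (e ∘ suc) (a∈F ∘ suc)) ⟩
    θ (a zero) * θ (e zero) + lin (a ∘ suc) (θ ∘ e ∘ suc)  ≈⟨ +-congʳ (*-congʳ (θ-F (a∈F zero))) ⟩
    a zero * θ (e zero) + lin (a ∘ suc) (θ ∘ e ∘ suc)      ∎

  unit : ∀ {n} → Fin n → Fin n → Carrier
  unit zero    zero    = 1#
  unit zero    (suc _) = 0#
  unit (suc _) zero    = 0#
  unit (suc i) (suc j) = unit i j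

  unit-in : ∀ {n} (i j : Fin n) → In (unit i j)
  unit-in zero    zero    = In-1
  unit-in zero    (suc _) = In-0
  unit-in (suc _) zero    = In-0
  unit-in (suc i) (suc j) = unit-in i j

  lin-unit : ∀ {n} (t : Fin n → Carrier) j → lin t (unit j) ≈ t j
  lin-unit t zero    = trans (+-cong (*-identityʳ _) (lin-zeroʳ (t ∘ suc) _ (λ _ → refl))) (+-identityʳ _)
  lin-unit t (suc j) = trans (+-cong (zeroʳ _) (lin-unit (t ∘ suc) j)) (+-identityˡ _)

  Spanned Separated : ∀ {k n} → (Fin k → Fin n → Carrier) → (Fin n → Carrier) → Set (c ⊔ ℓ)
  Spanned   ts t = ∃[ a ] (∀ i → In (a i)) × (∀ j → t j ≈ lin a (λ i → ts i j))
  Separated ts t = ∃[ ψ ] (∀ j → In (ψ j)) × (∀ i → lin (ts i) ψ ≈ 0#) × ¬ lin t ψ ≈ 0#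

  -- Gaussian elimination by induction on k. If `ts zero` is spanned by the other vectors it is
  -- redundant; otherwise some ψ kills the others but not `ts zero`, which then serves as pivot.
  separate : ∀ k {n} (ts : Fin k → Fin n → Carrier) → (∀ i j → In (ts i j)) →
             ∀ t → (∀ j → In (t j)) → Spanned ts t ⊎ Separated ts t
  separate zero ts ts∈F t t∈F with any? (λ j → ¬? (t j ≈? 0#))
  ... | yes (j , tj≉0) = inj₂ (unit j , unit-in j , (λ ()) , λ eq → tj≉0 (trans (sym (lin-unit t j)) eq))
  ... | no ∄ = inj₁ ((λ ()) , (λ ()) , λ j → decidable-stable (t j ≈? 0#) (λ h → ∄ (j , h)))
  separate (suc k) ts ts∈F t t∈F with separate k (ts ∘ suc) (ts∈F ∘ suc) (ts zero) (ts∈F zero)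
  ... | inj₁ (a , a∈F , s≈) with separate k (ts ∘ suc) (ts∈F ∘ suc) t t∈F
  ...   | inj₁ (b , b∈F , t≈) = inj₁ (0# ◂ b , (λ { zero → In-0 ; (suc i) → b∈F i }) ,
          λ j → trans (t≈ j) (sym (trans (+-congʳ (zeroˡ _)) (+-identityˡ _))))
  ...   | inj₂ (ψ , ψ∈F , ts⊥ , t⊥̸) = inj₂ (ψ , ψ∈F , (λ { zero → s⊥ ; (suc i) → ts⊥ i }) , t⊥̸)
    where
    s⊥ : lin (ts zero) ψ ≈ 0#
    s⊥ = begin
      lin (ts zero) ψ                               ≈⟨ lin-cong {e = ψ} s≈ (λ _ → refl) ⟩
      lin (λ j → lin a (λ i → ts (suc i) j)) ψ      ≈⟨ lin-lin k a (ts ∘ suc) ψ ⟩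
      lin a (λ i → lin (ts (suc i)) ψ)              ≈⟨ lin-zeroʳ a _ ts⊥ ⟩
      0#                                            ∎
  separate (suc k) {n} ts ts∈F t t∈F | inj₂ (ψ , ψ∈F , ts⊥ , s⊥̸) with separate k (ts ∘ suc) (ts∈F ∘ suc) t′ t′∈F
    where
    -- Chosen so that `t′`, which is t plus γ times the pivot, is killed by ψ.
    γ = - (lin t ψ * inv s⊥̸)
    γ∈F : In γ
    γ∈F = In-neg (In-* (lin-in t ψ t∈F ψ∈F) (In-inverse s⊥̸ (lin-in (ts zero) ψ (ts∈F zero) ψ∈F)))
    t′ : Fin n → Carrier
    t′ j = t j + γ * ts zero j
    t′∈F : ∀ j → In (t′ j)
    t′∈F j = In-+ (t∈F j) (In-* γ∈F (ts∈F zero j))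
  ... | inj₁ (b , b∈F , t≈) = inj₁ ((lin t ψ * inv s⊥̸) ◂ b ,
        (λ { zero → In-* (lin-in t ψ t∈F ψ∈F) (In-inverse s⊥̸ (lin-in (ts zero) ψ (ts∈F zero) ψ∈F)) ; (suc i) → b∈F i }) ,
        λ j → trans (solve 3 (λ t c s → t := c :* s :+ (t :+ :- c :* s)) refl (t j) (lin t ψ * inv s⊥̸) (ts zero j)) (+-congˡ (t≈ j)))
  ... | inj₂ (ω , ω∈F , ts⊥ω , t′⊥̸) = inj₂ (χ , χ∈F , (λ { zero → s⊥χ ; (suc i) → ts⊥χ i }) , t⊥̸χ)
    where
    s = ts zero
    i = inv s⊥̸
    -- χ is ω corrected by the multiple of ψ that makes it kill s; its value on t is then
    -- `lin t′ ω`, which is nonzero.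
    δ = - (lin s ω * i)
    χ : Fin n → Carrier
    χ j = ω j + δ * ψ j
    δ∈F : In δ
    δ∈F = In-neg (In-* (lin-in s ω (ts∈F zero) ω∈F) (In-inverse s⊥̸ (lin-in s ψ (ts∈F zero) ψ∈F)))
    χ∈F : ∀ j → In (χ j)
    χ∈F j = In-+ (ω∈F j) (In-* δ∈F (ψ∈F j))
    s⊥χ : lin s χ ≈ 0#
    s⊥χ = begin
      lin s χ                           ≈⟨ lin-addʳ δ s ω ψ ⟩
      lin s ω + δ * lin s ψ             ≈⟨ solve 3 (λ o i p → o :+ :- (o :* i) :* p := o :- p :* (o :* i)) refl (lin s ω) i (lin s ψ) ⟩
      lin s ω - lin s ψ * (lin s ω * i) ≈⟨ +-congˡ (-‿cong (x*[y*x⁻¹]≈y s⊥̸ (lin s ω))) ⟩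
      lin s ω - lin s ω                 ≈⟨ -‿inverseʳ _ ⟩
      0#                                ∎
    ts⊥χ : ∀ m → lin (ts (suc m)) χ ≈ 0#
    ts⊥χ m = trans (lin-addʳ δ (ts (suc m)) ω ψ)
      (trans (+-cong (ts⊥ω m) (trans (*-congˡ (ts⊥ m)) (zeroʳ δ))) (+-identityˡ 0#))
    t⊥̸χ : ¬ lin t χ ≈ 0#
    t⊥̸χ eq = t′⊥̸ (begin
      lin (λ j → t j + - (lin t ψ * i) * s j) ω  ≈⟨ lin-addˡ (- (lin t ψ * i)) t s ω ⟩
      lin t ω + - (lin t ψ * i) * lin s ω        ≈⟨ solve 4 (λ a b i o → a :+ :- (b :* i) :* o := a :+ :- (o :* i) :* b) refl (lin t ω) (lin t ψ) i (lin s ω) ⟩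
      lin t ω + δ * lin t ψ                      ≈⟨ lin-addʳ δ t ω ψ ⟨
      lin t χ                                    ≈⟨ eq ⟩
      0#                                         ∎)

-- Proportional pairs, the forms Φ and their independence.

module Points {c ℓ} (K : CommutativeRing c ℓ) (isField : IsField K)
  (q : ℕ) (cardK : HasCard K (q ^ 5)) (F : Subfield K) (cardF : SubfieldCard K F q) where
  open CommutativeRing K hiding (zero)
  open IntegerSolver K
  open FieldProperties K isField
  open FiniteField K isField q cardK F cardF
  open Spans K isField q cardK F cardF
  open Separation K isField q cardK F cardF
  open Subfield F
  open Counting
  import Relation.Binary.Reasoning.Setoid setoid as ≈-R

  opaque
    basis : Fin 5 → Carrier
    basis = proj₁ (indep-exists 5 ℕₚ.≤-refl)

    basis-indep : Indep 5 basis
    basis-indep = proj₂ (indep-exists 5 ℕₚ.≤-refl)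

  opaque
    coordinates : ∀ x → ∃[ a ] (∀ i → In (a i)) × x ≈ lin a basis
    coordinates x = span-coords 5 basis (indep-spans basis basis-indep x)

  -- A vector t ∈ F⁶ stands for the point (ξ t , ζ t) of K²: these points form the
  -- 6-dimensional F-subspace {(x , θ x + b)} of K².
  ξ ζ : (Fin 6 → Carrier) → Carrier
  ξ t = lin (t ∘ suc) basis
  ζ t = θ (ξ t) + t zero

  ξ-lin : ∀ {k} (a : Fin k → Carrier) ts {t} → (∀ j → t j ≈ lin a (λ i → ts i j)) → ξ t ≈ lin a (ξ ∘ ts)
  ξ-lin {k} a ts t≈ = trans (lin-cong {e = basis} (t≈ ∘ suc) (λ _ → refl)) (lin-lin k a (λ i j → ts i (suc j)) basis)

  ζ-lin : ∀ {k} (a : Fin k → Carrier) (a∈F : ∀ i → In (a i)) ts {t} →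
          (∀ j → t j ≈ lin a (λ i → ts i j)) → ζ t ≈ lin a (ζ ∘ ts)
  ζ-lin a a∈F ts {t} t≈ = begin
    θ (ξ t) + t zero                              ≈⟨ +-cong (trans (θ-cong (ξ-lin a ts t≈)) (θ-lin a (ξ ∘ ts) a∈F)) (t≈ zero) ⟩
    lin a (θ ∘ ξ ∘ ts) + lin a (λ i → ts i zero)  ≈⟨ +-congˡ (*-identityˡ _) ⟨
    lin a (θ ∘ ξ ∘ ts) + 1# * lin a (λ i → ts i zero) ≈⟨ lin-addʳ 1# a (θ ∘ ξ ∘ ts) (λ i → ts i zero) ⟨
    lin a (λ i → θ (ξ (ts i)) + 1# * ts i zero)   ≈⟨ lin-cong {a = a} (λ _ → refl) (λ i → +-congˡ (*-identityˡ _)) ⟩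
    lin a (ζ ∘ ts)                                ∎
    where open ≈-R

  -- With x = `ξ u`, proportionality means λ′ (x , θ x) = (λ′ x , θ (λ′ x) + 1). Its second
  -- coordinate is the equation `θξ-u`, which determines x because θ is bijective.
  record Point (λ′ : Carrier) : Set (c ⊔ ℓ) where
    field
      u u′  : Fin 6 → Carrier
      u∈F   : ∀ j → In (u j)
      u′∈F  : ∀ j → In (u′ j)
      u₀    : u zero ≈ 0#
      u′₀   : u′ zero ≈ 1#
      ξ-u′  : ξ u′ ≈ λ′ * ξ u
      θξ-u  : θ (ξ u) * (λ′ - θ λ′) ≈ 1#

  point : ∀ λ′ → ¬ In λ′ → Point λ′
  point λ′ λ∉F = record
    { u = 0# ◂ a
    ; u′ = 1# ◂ b
    ; u∈F = λ { zero → In-0 ; (suc j) → proj₁ (proj₂ (coordinates x)) j }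
    ; u′∈F = λ { zero → In-1 ; (suc j) → proj₁ (proj₂ (coordinates (λ′ * x))) j }
    ; u₀ = refl
    ; u′₀ = refl
    ; ξ-u′ = trans (sym (proj₂ (proj₂ (coordinates (λ′ * x))))) (*-congˡ x≈)
    ; θξ-u = trans (*-congʳ (trans (θ-cong (sym x≈)) (proj₂ root))) (trans (*-comm _ _) (inv-inverseʳ d≉0))
    }
    where
    d≉0 : ¬ λ′ - θ λ′ ≈ 0#
    d≉0 d≈0 = λ∉F (θ-fixed (sym (x-y≈0⇒x≈y d≈0)))
    root : ∃[ x ] θ x ≈ inv d≉0
    root = θ-surjective (inv d≉0)
    x = proj₁ root
    a b : Fin 5 → Carrier
    a = proj₁ (coordinates x)
    b = proj₁ (coordinates (λ′ * x))
    x≈ : x ≈ lin a basis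
    x≈ = proj₂ (proj₂ (coordinates x))

  opaque
    points : ∀ i → Point (Λ i)
    points i = point (Λ i) (Λ∉F i)

  module _ (i : Fin D) where
    open Point (points i) public

  -- The class i belongs to the K-line through (X i , Y i): `u i` stands for this vector and `u′ i`
  -- for its multiple by `Λ i`.
  X Y : Fin D → Carrier
  X i = ξ (u i)
  Y i = θ (X i)

  ζ-u : ∀ i → ζ (u i) ≈ Y i
  ζ-u i = trans (+-congˡ (u₀ i)) (+-identityʳ _)

  ζ-u′ : ∀ i → ζ (u′ i) ≈ Λ i * Y i
  ζ-u′ i = begin
    θ (ξ (u′ i)) + u′ i zero            ≈⟨ +-cong (trans (θ-cong (ξ-u′ i)) (θ-* (Λ i) (X i))) (u′₀ i) ⟩
    θ (Λ i) * Y i + 1#                  ≈⟨ +-congˡ (θξ-u i) ⟨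
    θ (Λ i) * Y i + Y i * (Λ i - θ (Λ i)) ≈⟨ solve 3 (λ t y l → t :* y :+ y :* (l :- t) := l :* y) refl (θ (Λ i)) (Y i) (Λ i) ⟩
    Λ i * Y i                           ∎
    where open ≈-R

  Y≉0 : ∀ i → ¬ Y i ≈ 0#
  Y≉0 i Y≈0 = 1≉0 (trans (sym (θξ-u i)) (trans (*-congʳ Y≈0) (zeroˡ _)))

  X≉0 : ∀ i → ¬ X i ≈ 0#
  X≉0 i X≈0 = Y≉0 i (trans (θ-cong X≈0) θ-0)

  -- Otherwise κ = X j / X i lies in F, and Λ i - κ Λ j is fixed by θ.
  det≉0 : ∀ {i j} → i ≢ j → ¬ X i * Y j ≈ X j * Y i
  det≉0 {i} {j} i≢j eq = i≢j (≡.sym (Λ-inj j i (w , κ , θ-fixed θw≈w , κ∈F ,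
    solve 3 (λ l k m → l := (l :- k :* m) :+ k :* m) refl (Λ i) κ (Λ j))))
    where
    open ≈-R
    κ = X j * inv (X≉0 i)
    X≈ : X j ≈ κ * X i
    X≈ = trans (sym (x*[y*x⁻¹]≈y (X≉0 i) (X j))) (*-comm _ _)
    κY : Y j ≈ κ * Y i
    κY = *-cancelˡ-≈ (X≉0 i) (begin
      X i * Y j       ≈⟨ eq ⟩
      X j * Y i       ≈⟨ *-congʳ X≈ ⟩
      κ * X i * Y i   ≈⟨ solve 3 (λ k x y → k :* x :* y := x :* (k :* y)) refl κ (X i) (Y i) ⟩
      X i * (κ * Y i) ∎)
    κ∈F : In κ
    κ∈F = θ-fixed (*-cancelˡ-≈ (Y≉0 i) (begin
      Y i * θ κ       ≈⟨ *-comm _ _ ⟩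
      θ κ * Y i       ≈⟨ θ-* κ (X i) ⟨
      θ (κ * X i)     ≈⟨ θ-cong X≈ ⟨
      Y j             ≈⟨ κY ⟩
      κ * Y i         ≈⟨ *-comm _ _ ⟩
      Y i * κ         ∎))
    w = Λ i - κ * Λ j
    scaled : κ * (Λ j - θ (Λ j)) ≈ Λ i - θ (Λ i)
    scaled = *-cancelˡ-≈ (Y≉0 i) (begin
      Y i * (κ * (Λ j - θ (Λ j)))   ≈⟨ solve 3 (λ y k d → y :* (k :* d) := k :* y :* d) refl (Y i) κ (Λ j - θ (Λ j)) ⟩
      κ * Y i * (Λ j - θ (Λ j))     ≈⟨ *-congʳ κY ⟨
      Y j * (Λ j - θ (Λ j))         ≈⟨ θξ-u j ⟩
      1#                            ≈⟨ θξ-u i ⟨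
      Y i * (Λ i - θ (Λ i))         ∎)
    θw≈w : θ w ≈ w
    θw≈w = begin
      θ (Λ i - κ * Λ j)             ≈⟨ trans (θ-sub _ _) (+-congˡ (-‿cong (trans (θ-* κ (Λ j)) (*-congʳ (θ-F κ∈F))))) ⟩
      θ (Λ i) - κ * θ (Λ j)         ≈⟨ solve 5 (λ l m s t k → s :- k :* t := (l :- k :* m) :- ((l :- s) :- k :* (m :- t))) refl (Λ i) (Λ j) (θ (Λ i)) (θ (Λ j)) κ ⟩
      w - ((Λ i - θ (Λ i)) - κ * (Λ j - θ (Λ j))) ≈⟨ +-congˡ (-‿cong (x≈y⇒x-y≈0 (sym scaled))) ⟩
      w - 0#                        ≈⟨ solve 1 (λ w → w :- :0 := w) refl w ⟩
      w                             ∎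

  -- A K-linear form in φ. Class i is bad for φ when the value lies in `V (Λ i)`, the set of
  -- differences that the two free scalars in F of the middle coordinate can absorb.
  Φ : Fin D → (Fin 6 → Carrier) → Carrier
  Φ i φ = Λ i * lin (u i) φ - lin (u′ i) φ

  Φ-add : ∀ i κ φ ψ → Φ i (λ j → φ j + κ * ψ j) ≈ Φ i φ + κ * Φ i ψ
  Φ-add i κ φ ψ = trans (+-cong (*-congˡ (lin-addʳ κ (u i) φ ψ)) (-‿cong (lin-addʳ κ (u′ i) φ ψ)))
    (solve 6 (λ l k a b c d → l :* (a :+ k :* b) :- (c :+ k :* d) := (l :* a :- c) :+ k :* (l :* b :- d)) refl
      (Λ i) κ (lin (u i) φ) (lin (u i) ψ) (lin (u′ i) φ) (lin (u′ i) ψ))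

  Φ-cong : ∀ i {φ ψ} → (∀ j → φ j ≈ ψ j) → Φ i φ ≈ Φ i ψ
  Φ-cong i φ≈ψ = +-cong (*-congˡ (lin-cong {a = u i} (λ _ → refl) φ≈ψ)) (-‿cong (lin-cong {a = u′ i} (λ _ → refl) φ≈ψ))

  Φ-zero : ∀ i {ψ} → lin (u i) ψ ≈ 0# → lin (u′ i) ψ ≈ 0# → Φ i ψ ≈ 0#
  Φ-zero i p≈0 p′≈0 = trans (+-cong (*-congˡ p≈0) (-‿cong p′≈0)) (solve 1 (λ l → l :* :0 :- :0 := :0) refl (Λ i))

  -- For ψ over F both dot products lie in F. As 1 and `Λ i` are F-independent, the form can vanish
  -- only if both products do.
  Φ≉0 : ∀ i {ψ} → (∀ j → In (ψ j)) → (¬ lin (u i) ψ ≈ 0#) ⊎ (¬ lin (u′ i) ψ ≈ 0#) → ¬ Φ i ψ ≈ 0#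
  Φ≉0 i {ψ} ψ∈F ne Φ≈0 with lin (u i) ψ ≈? 0#
  ... | no p≉0 = Λ∉F i (In-resp (begin
      lin (u′ i) ψ * inv p≉0           ≈⟨ *-congʳ (x-y≈0⇒x≈y Φ≈0) ⟨
      Λ i * lin (u i) ψ * inv p≉0      ≈⟨ solve 3 (λ l p v → l :* p :* v := p :* (l :* v)) refl (Λ i) (lin (u i) ψ) (inv p≉0) ⟩
      lin (u i) ψ * (Λ i * inv p≉0)    ≈⟨ x*[y*x⁻¹]≈y p≉0 (Λ i) ⟩
      Λ i                              ∎)
      (In-* (lin-in (u′ i) ψ (u′∈F i) ψ∈F) (In-inverse p≉0 (lin-in (u i) ψ (u∈F i) ψ∈F))))
    where open ≈-R
  ... | yes p≈0 = [ (λ p≉0 → p≉0 p≈0) , (λ p′≉0 → p′≉0 (begin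
      lin (u′ i) ψ        ≈⟨ x-y≈0⇒x≈y Φ≈0 ⟨
      Λ i * lin (u i) ψ   ≈⟨ trans (*-congˡ p≈0) (zeroʳ _) ⟩
      0#                  ∎)) ]′ ne
    where open ≈-R

  point-separation₁ : ∀ i → ∃[ ψ ] ¬ Φ i ψ ≈ 0#
  point-separation₁ i with separate 0 {6} (λ ()) (λ ()) (u i) (u∈F i)
  ... | inj₂ (ψ , ψ∈F , _ , ne) = ψ , Φ≉0 i {ψ} ψ∈F (inj₁ ne)
  ... | inj₁ (a , _ , u≈) = contradiction (ξ-lin a (λ ()) u≈) (X≉0 i)

  -- Without such a ψ, `u i` would be an F-combination of `u j` and `u′ j`, which puts (X i , Y i)
  -- on the K-line of class j, against `det≉0`.
  point-separation₂ : ∀ {i j} → i ≢ j → ∃[ ψ ] Φ j ψ ≈ 0# × ¬ Φ i ψ ≈ 0#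
  point-separation₂ {i} {j} i≢j with separate 2 ts (λ { zero → u∈F j ; (suc zero) → u′∈F j }) (u i) (u∈F i)
    where ts = u j ◂ (u′ j ◂ ◇)
  ... | inj₂ (ψ , ψ∈F , ts⊥ , ne) = ψ , Φ-zero j {ψ} (ts⊥ zero) (ts⊥ (suc zero)) , Φ≉0 i {ψ} ψ∈F (inj₁ ne)
  ... | inj₁ (a , a∈F , u≈) = contradiction (begin
      X i * Y j             ≈⟨ *-congʳ X≈ ⟩
      A * X j * Y j         ≈⟨ solve 3 (λ a x y → a :* x :* y := x :* (a :* y)) refl A (X j) (Y j) ⟩
      X j * (A * Y j)       ≈⟨ *-congˡ Y≈ ⟨
      X j * Y i             ∎) (det≉0 i≢j)
    where
    open ≈-R
    ts = u j ◂ (u′ j ◂ ◇)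
    a₀ = a zero
    a₁ = a (suc zero)
    A = a₀ + a₁ * Λ j
    collect : ∀ x → a₀ * x + (a₁ * (Λ j * x) + 0#) ≈ A * x
    collect = solve 4 (λ a b l x → a :* x :+ (b :* (l :* x) :+ :0) := (a :+ b :* l) :* x) refl a₀ a₁ (Λ j)
    X≈ : X i ≈ A * X j
    X≈ = trans (ξ-lin a ts u≈) (trans (+-congˡ (+-congʳ (*-congˡ (ξ-u′ j)))) (collect (X j)))
    Y≈ : Y i ≈ A * Y j
    Y≈ = trans (sym (ζ-u i)) (trans (ζ-lin a a∈F ts u≈)
      (trans (+-cong (*-congˡ (ζ-u j)) (+-congʳ (*-congˡ (ζ-u′ j)))) (collect (Y j))))

  -- S k i says that Λ i is the image of Λ k under an element of PGL₂(F) that moves ∞.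
  S : Fin D → Fin D → Set (c ⊔ ℓ)
  S k i = ∃[ d ] V (Λ k) (Λ i * (Λ k + elF d))

  opaque
    S? : ∀ k i → Dec (S k i)
    S? k i = any? (λ d → V? (Λ k) (Λ i * (Λ k + elF d)))

  module _ {i j k : Fin D} (i≢k : i ≢ k) (k≢j : k ≢ j) (i≢j : i ≢ j)
           {a₀ a₁ b₀ b₁ B C : Carrier} (a₀∈F : In a₀) (a₁∈F : In a₁) (b₀∈F : In b₀) (b₁∈F : In b₁)
           (Xk  : X k ≈ (a₀ + a₁ * Λ i) * X i + B * X j)
           (Yk  : Y k ≈ (a₀ + a₁ * Λ i) * Y i + B * Y j)
           (ΛXk : Λ k * X k ≈ (b₀ + b₁ * Λ i) * X i + C * X j)
           (ΛYk : Λ k * Y k ≈ (b₀ + b₁ * Λ i) * Y i + C * Y j) where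
    private
      open ≈-R
      A = a₀ + a₁ * Λ i
      A′ = b₀ + b₁ * Λ i
      E = Λ k * A - A′
      E′ = Λ k * B - C

      relation : ∀ {z zi zj} → z ≈ A * zi + B * zj → Λ k * z ≈ A′ * zi + C * zj → E * zi + E′ * zj ≈ 0#
      relation {z} {zi} {zj} z≈ Λz≈ = begin
        E * zi + E′ * zj
          ≈⟨ solve 7 (λ l a a′ b c x y → (l :* a :- a′) :* x :+ (l :* b :- c) :* y := l :* (a :* x :+ b :* y) :- (a′ :* x :+ c :* y)) refl (Λ k) A A′ B C zi zj ⟩
        Λ k * (A * zi + B * zj) - (A′ * zi + C * zj)
          ≈⟨ +-cong (*-congˡ (sym z≈)) (-‿cong (sym Λz≈)) ⟩
        Λ k * z - Λ k * z
          ≈⟨ -‿inverseʳ _ ⟩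
        0# ∎

      -- Cramer's rule: E′ is eliminated, and the remaining determinant is nonzero by `det≉0`.
      E≈0 : E ≈ 0#
      E≈0 = *-cancelˡ-0 {X i * Y j - X j * Y i} (λ h → det≉0 i≢j (x-y≈0⇒x≈y h)) (begin
        (X i * Y j - X j * Y i) * E
          ≈⟨ solve 6 (λ e e′ x y z w → (x :* w :- y :* z) :* e := (e :* x :+ e′ :* y) :* w :- (e :* z :+ e′ :* w) :* y) refl E E′ (X i) (X j) (Y i) (Y j) ⟩
        (E * X i + E′ * X j) * Y j - (E * Y i + E′ * Y j) * X j
          ≈⟨ +-cong (*-congʳ (relation Xk ΛXk)) (-‿cong (*-congʳ (relation Yk ΛYk))) ⟩
        0# * Y j - 0# * X j
          ≈⟨ solve 2 (λ x y → :0 :* x :- :0 :* y := :0) refl (Y j) (X j) ⟩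
        0# ∎)

      ΛA≈A′ : Λ k * A ≈ A′
      ΛA≈A′ = x-y≈0⇒x≈y E≈0

      A≈a₀ : a₁ ≈ 0# → A ≈ a₀
      A≈a₀ a₁≈0 = trans (+-congˡ (trans (*-congʳ a₁≈0) (zeroˡ _))) (+-identityʳ a₀)

      -- If a₁ = 0 then A = a₀. For a₀ = 0 class k would lie on the line of class j; for a₀ ≠ 0 the
      -- relation `ΛA≈A′` would put `Λ k` into the affine class of `Λ i`.
      a₁≉0 : ¬ a₁ ≈ 0#
      a₁≉0 a₁≈0 with a₀ ≈? 0#
      ... | yes a₀≈0 = det≉0 k≢j (begin
          X k * Y j                    ≈⟨ *-congʳ (drop Xk) ⟩
          B * X j * Y j                ≈⟨ solve 3 (λ b x y → b :* x :* y := x :* (b :* y)) refl B (X j) (Y j) ⟩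
          X j * (B * Y j)              ≈⟨ *-congˡ (drop Yk) ⟨
          X j * Y k                    ∎)
        where
        drop : ∀ {z zi zj} → z ≈ A * zi + B * zj → z ≈ B * zj
        drop z≈ = trans z≈ (trans (+-congʳ (trans (*-congʳ (trans (A≈a₀ a₁≈0) a₀≈0)) (zeroˡ _))) (+-identityˡ _))
      ... | no a₀≉0 = i≢k (Λ-inj i k
          (v * b₀ , v * b₁ , In-* v∈F b₀∈F , In-* v∈F b₁∈F , (begin
            Λ k                    ≈⟨ x*[y*x⁻¹]≈y a₀≉0 (Λ k) ⟨
            a₀ * (Λ k * v)         ≈⟨ solve 3 (λ a l v → a :* (l :* v) := v :* (l :* a)) refl a₀ (Λ k) v ⟩
            v * (Λ k * a₀)         ≈⟨ *-congˡ (trans (*-congˡ (sym (A≈a₀ a₁≈0))) ΛA≈A′) ⟩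
            v * (b₀ + b₁ * Λ i)    ≈⟨ solve 4 (λ v b c l → v :* (b :+ c :* l) := v :* b :+ v :* c :* l) refl v b₀ b₁ (Λ i) ⟩
            v * b₀ + v * b₁ * Λ i  ∎)))
        where
        v = inv a₀≉0
        v∈F = In-inverse a₀≉0 a₀∈F

    -- Since (X i , Y i) and (X j , Y j) form a K-basis, the first coefficients satisfy
    -- `Λ k * A = A′`, a fractional linear relation between `Λ k` and `Λ i`. Solved for `Λ i` it has
    -- denominator `Λ k` - b₁ / a₁, whence d.
    dependent⇒S : S k i
    dependent⇒S with elF-surj (- b₁ * v) (In-* (In-neg b₁∈F) v∈F)
      where
      v = inv a₁≉0
      v∈F = In-inverse a₁≉0 a₁∈F
    ... | d , d≈ = d , b₀ * v , - a₀ * v , In-* b₀∈F v∈F , In-* (In-neg a₀∈F) v∈F , (begin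
        Λ i * (Λ k + elF d)                     ≈⟨ *-congˡ (+-congˡ d≈) ⟩
        Λ i * (Λ k + - b₁ * v)                  ≈⟨ *-congˡ (+-congʳ (x*[y*x⁻¹]≈y a₁≉0 (Λ k))) ⟨
        Λ i * (a₁ * (Λ k * v) + - b₁ * v)       ≈⟨ solve 6 (λ l m a a′ b v → m :* (a′ :* (l :* v) :+ :- b :* v) := v :* (l :* (a :+ a′ :* m)) :- v :* (l :* a) :- v :* b :* m) refl (Λ k) (Λ i) a₀ a₁ b₁ v ⟩
        v * (Λ k * A) - v * (Λ k * a₀) - v * b₁ * Λ i ≈⟨ +-congʳ (+-congʳ (*-congˡ ΛA≈A′)) ⟩
        v * A′ - v * (Λ k * a₀) - v * b₁ * Λ i  ≈⟨ solve 6 (λ l m a b b′ v → v :* (b :+ b′ :* m) :- v :* (l :* a) :- v :* b′ :* m := b :* v :+ :- a :* v :* l) refl (Λ k) (Λ i) a₀ b₀ b₁ v ⟩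
        b₀ * v + - a₀ * v * Λ k                 ∎)
      where
      v = inv a₁≉0
      v∈F = In-inverse a₁≉0 a₁∈F

  -- If neither `u k` nor `u′ k` can be separated, both are F-combinations of the four vectors of i
  -- and j. Then `dependent⇒S` applies twice, the second time with i and j exchanged.
  point-separation₃ : ∀ {i j k} → i ≢ j → i ≢ k → j ≢ k → ¬ (S k i × S k j) →
                      ∃[ ψ ] Φ i ψ ≈ 0# × Φ j ψ ≈ 0# × ¬ Φ k ψ ≈ 0#
  point-separation₃ {i} {j} {k} i≢j i≢k j≢k ¬S
    with separate 4 ts ts∈F (u k) (u∈F k) | separate 4 ts ts∈F (u′ k) (u′∈F k)
    where
    ts = u i ◂ (u′ i ◂ (u j ◂ (u′ j ◂ ◇)))
    ts∈F : ∀ m n → In (ts m n)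
    ts∈F = λ { zero → u∈F i ; (suc zero) → u′∈F i ; (suc (suc zero)) → u∈F j ; (suc (suc (suc zero))) → u′∈F j }
  ... | inj₂ (ψ , ψ∈F , ts⊥ , ne) | _ =
    ψ , Φ-zero i {ψ} (ts⊥ zero) (ts⊥ (suc zero)) , Φ-zero j {ψ} (ts⊥ (suc (suc zero))) (ts⊥ (suc (suc (suc zero)))) , Φ≉0 k {ψ} ψ∈F (inj₁ ne)
  ... | inj₁ _ | inj₂ (ψ , ψ∈F , ts⊥ , ne) =
    ψ , Φ-zero i {ψ} (ts⊥ zero) (ts⊥ (suc zero)) , Φ-zero j {ψ} (ts⊥ (suc (suc zero))) (ts⊥ (suc (suc (suc zero)))) , Φ≉0 k {ψ} ψ∈F (inj₂ ne)
  ... | inj₁ (a , a∈F , u≈) | inj₁ (b , b∈F , u′≈) = contradiction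
      ( dependent⇒S i≢k (j≢k ∘ ≡.sym) i≢j (a∈F zero) (a∈F (suc zero)) (b∈F zero) (b∈F (suc zero))
          (X-eq a (ξ-lin a ts u≈)) (Y-eq a (trans (sym (ζ-u k)) (ζ-lin a a∈F ts u≈)))
          (X-eq b (trans (sym (ξ-u′ k)) (ξ-lin b ts u′≈))) (Y-eq b (trans (sym (ζ-u′ k)) (ζ-lin b b∈F ts u′≈)))
      , dependent⇒S j≢k (i≢k ∘ ≡.sym) (i≢j ∘ ≡.sym) (a∈F _) (a∈F _) (b∈F _) (b∈F _)
          (swap (X-eq a (ξ-lin a ts u≈))) (swap (Y-eq a (trans (sym (ζ-u k)) (ζ-lin a a∈F ts u≈))))
          (swap (X-eq b (trans (sym (ξ-u′ k)) (ξ-lin b ts u′≈)))) (swap (Y-eq b (trans (sym (ζ-u′ k)) (ζ-lin b b∈F ts u′≈))))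
      ) ¬S
    where
    ts = u i ◂ (u′ i ◂ (u j ◂ (u′ j ◂ ◇)))
    swap : ∀ {x y z} → x ≈ y + z → x ≈ z + y
    swap eq = trans eq (+-comm _ _)
    2F = suc (suc (zero {1}))
    3F = suc (suc (suc (zero {0})))
    collect : ∀ (a : Fin 4 → Carrier) x y →
      a zero * x + (a (suc zero) * (Λ i * x) + (a 2F * y + (a 3F * (Λ j * y) + 0#)))
      ≈ (a zero + a (suc zero) * Λ i) * x + (a 2F + a 3F * Λ j) * y
    collect a x y = solve 8 (λ a b c d l m x y →
      a :* x :+ (b :* (l :* x) :+ (c :* y :+ (d :* (m :* y) :+ :0))) := (a :+ b :* l) :* x :+ (c :+ d :* m) :* y) refl
      (a zero) (a (suc zero)) (a 2F) (a 3F) (Λ i) (Λ j) x y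
    X-eq : ∀ a {x} → x ≈ lin a (ξ ∘ ts) → x ≈ (a zero + a (suc zero) * Λ i) * X i + (a 2F + a 3F * Λ j) * X j
    X-eq a x≈ = trans x≈ (trans
      (+-congˡ (+-cong (*-congˡ (ξ-u′ i)) (+-congˡ (+-congʳ (*-congˡ (ξ-u′ j)))))) (collect a (X i) (X j)))
    Y-eq : ∀ a {x} → x ≈ lin a (ζ ∘ ts) → x ≈ (a zero + a (suc zero) * Λ i) * Y i + (a 2F + a 3F * Λ j) * Y j
    Y-eq a x≈ = trans x≈ (trans
      (+-cong (*-congˡ (ζ-u i)) (+-cong (*-congˡ (ζ-u′ i)) (+-cong (*-congˡ (ζ-u j)) (+-congʳ (*-congˡ (ζ-u′ j))))))
      (collect a (Y i) (Y j)))

  -- From Λ i (Λ k + d) = s + s′ Λ k follows Λ i = s′ + (s - s′ d) / (Λ k + d). For given d the only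
  -- possible class is therefore that of 1 / (Λ k + d).
  S-unique : ∀ k d i j → V (Λ k) (Λ i * (Λ k + elF d)) → V (Λ k) (Λ j * (Λ k + elF d)) → i ≡ j
  S-unique k d i j (s , s′ , s∈F , s′∈F , eqi) (n , n′ , n∈F , n′∈F , eqj) =
    Λ-inj i j (n′ - w * s′ , w , In-sub n′∈F (In-* w∈F s′∈F) , w∈F , (begin
      Λ j                               ≈⟨ solve 2 (λ l n → l := n :+ (l :- n)) refl (Λ j) n′ ⟩
      n′ + (Λ j - n′)                   ≈⟨ +-congˡ Λj ⟩
      n′ + w * (Λ i - s′)               ≈⟨ solve 4 (λ n w s l → n :+ w :* (l :- s) := (n :- w :* s) :+ w :* l) refl n′ w s′ (Λ i) ⟩
      (n′ - w * s′) + w * Λ i           ∎))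
    where
    open ≈-R
    δ = elF d
    y = Λ k + δ
    y≉0 : ¬ y ≈ 0#
    y≉0 y≈0 = Λ∉F k (In-resp (sym (begin
      Λ k            ≈⟨ solve 2 (λ l d → l := (l :+ d) :- d) refl (Λ k) δ ⟩
      y - δ          ≈⟨ trans (+-congʳ y≈0) (+-identityˡ _) ⟩
      - δ            ∎)) (In-neg (elF-in d)))
    remainder : ∀ {l s s′} → l * y ≈ s + s′ * Λ k → y * (l - s′) ≈ s - s′ * δ
    remainder {l} {s} {s′} eq = begin
      y * (l - s′)               ≈⟨ solve 4 (λ k d l s′ → (k :+ d) :* (l :- s′) := l :* (k :+ d) :- s′ :* (k :+ d)) refl (Λ k) δ l s′ ⟩
      l * y - s′ * y             ≈⟨ +-congʳ eq ⟩
      (s + s′ * Λ k) - s′ * y    ≈⟨ solve 4 (λ k d s s′ → (s :+ s′ :* k) :- s′ :* (k :+ d) := s :- s′ :* d) refl (Λ k) δ s s′ ⟩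
      s - s′ * δ                 ∎
    m = s - s′ * δ
    r = n - n′ * δ
    m≉0 : ¬ m ≈ 0#
    m≉0 m≈0 = Λ∉F i (In-resp (sym (x-y≈0⇒x≈y (*-cancelˡ-0 y≉0 (trans (remainder eqi) m≈0)))) s′∈F)
    w = r * inv m≉0
    w∈F : In w
    w∈F = In-* (In-sub n∈F (In-* n′∈F (elF-in d))) (In-inverse m≉0 (In-sub s∈F (In-* s′∈F (elF-in d))))
    Λj : Λ j - n′ ≈ w * (Λ i - s′)
    Λj = *-cancelˡ-≈ y≉0 (begin
      y * (Λ j - n′)          ≈⟨ remainder eqj ⟩
      r                       ≈⟨ x*[y*x⁻¹]≈y m≉0 r ⟨
      m * w                   ≈⟨ *-congʳ (remainder eqi) ⟨
      y * (Λ i - s′) * w      ≈⟨ solve 3 (λ y l w → y :* l :* w := y :* (w :* l)) refl y (Λ i - s′) w ⟩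
      y * (w * (Λ i - s′))    ∎)

  S-count : ∀ k → sum (λ i → ind (S? k i)) Nat.≤ q
  S-count k = begin
    sum (λ i → ind (S? k i))
      ≤⟨ sum-mono (λ i → ind-∃≤sum (λ d → V? (Λ k) (Λ i * (Λ k + elF d))) (S? k i)) ⟩
    sum (λ i → sum (λ d → ind (V? (Λ k) (Λ i * (Λ k + elF d)))))
      ≡⟨ sum-swap (λ i d → ind (V? (Λ k) (Λ i * (Λ k + elF d)))) ⟩
    sum (λ d → sum (λ i → ind (V? (Λ k) (Λ i * (Λ k + elF d)))))
      ≤⟨ sum-mono (λ d → sum-ind-≤1 (λ i → V? (Λ k) (Λ i * (Λ k + elF d))) (S-unique k d)) ⟩
    sum {q} (λ _ → 1)
      ≡⟨ ≡.trans (sum-const q 1) (ℕₚ.*-identityʳ q) ⟩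
    q ∎
    where open ℕₚ.≤-Reasoning

-- The polynomial inequality that compares the moments.

module MomentArithmetic where
  open ℕₚ.≤-Reasoning
  open Nat using (_+_; _*_; _≤_; _<_)

  private
    -- Here c = q³, s = q - 1 and m′ = D - 2. The padding q² + 3 q c + 2 q² c avoids subtraction;
    -- with it, what remains of the factor of D after cancelling 5 c (D - 1) is 8 c² + c.
    quadratic : ∀ s → let q = suc s ; c = q * (q * q) ; m′ = s + q * q + c in
      12 * (c * c) + (suc m′ * m′ + s * (1 + q + q * q) * (q * s)) + (q * q + 3 * (q * c) + 2 * (q * q * c))
      ≡ 5 * (c * suc m′) + (8 * (c * c) + c)
    quadratic = solve-∀

    cubic : ∀ q → let c = q * (q * q) ; D = 1 + (q + q * q + c) in
      12 * (c * c * c) + D * (q * q + 3 * (q * c) + 2 * (q * q * c)) + q * q * c * (6 * c + 3 * (q * q) + 4 * q)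
      ≡ D * (8 * (c * c) + c) + (q * q * c * (4 * (q * q * (q * q)) + 5) + (3 * (q * c) + q * q))
    cubic = solve-∀

    -- With q = r + 2 the slack has natural coefficients; at q = 2 it is only 1.
    quartic : ∀ r → let q = suc (suc r) in
      6 * (q * (q * q)) + 3 * (q * q) + 4 * q + (1 + r * (40 + r * (57 + r * (26 + r * 4)))) ≡ 4 * (q * q * (q * q)) + 5
    quartic = solve-∀

    -- The comparison of moments multiplied by c³ and divided by Q. The summand with `q * s` pays
    -- for the exceptional triples: at most `D * (q * s)` of them, each exceeding the independent
    -- value by at most c - 1 = s (1 + q + q²).
    balance : ∀ r → let s = suc r ; q = suc s ; c = q * (q * q) ; m′ = s + q * q + c ; D = suc (suc m′) in
      12 * (c * c) * D + (D * suc m′ * m′ + s * (1 + q + q * q) * (D * (q * s))) < 12 * (c * c * c) + 5 * c * (D * suc m′)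
    balance r = ℕₚ.+-cancelʳ-< (D * X) _ _ (begin-strict
      12 * (c * c) * D + (D * suc m′ * m′ + c′ * (D * (q * s))) + D * X
        ≡⟨ factor (c * c) D (suc m′) m′ c′ (q * s) X ⟩
      D * (12 * (c * c) + (suc m′ * m′ + c′ * (q * s)) + X)
        ≡⟨ ≡.cong (D *_) (quadratic s) ⟩
      D * (5 * (c * suc m′) + Y)
        ≡⟨ ℕₚ.*-distribˡ-+ D (5 * (c * suc m′)) Y ⟩
      D * (5 * (c * suc m′)) + D * Y
        <⟨ ℕₚ.+-monoʳ-< (D * (5 * (c * suc m′))) DY< ⟩
      D * (5 * (c * suc m′)) + (12 * (c * c * c) + D * X)
        ≡⟨ regroup D c (suc m′) (12 * (c * c * c)) (D * X) ⟩
      12 * (c * c * c) + 5 * c * (D * suc m′) + D * X ∎)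
      where
      s q c m′ D c′ X Y L : ℕ
      s = suc r
      q = suc s
      c = q * (q * q)
      m′ = s + q * q + c
      D = suc (suc m′)
      c′ = s * (1 + q + q * q)
      X = q * q + 3 * (q * c) + 2 * (q * q * c)
      Y = 8 * (c * c) + c
      L = 6 * c + 3 * (q * q) + 4 * q
      factor : ∀ cc D n m′ c′ w X → 12 * cc * D + (D * n * m′ + c′ * (D * w)) + D * X ≡ D * (12 * cc + (n * m′ + c′ * w) + X)
      factor = solve-∀
      regroup : ∀ D c n x y → D * (5 * (c * n)) + (x + y) ≡ x + 5 * c * (D * n) + y
      regroup = solve-∀
      L≤ : L ≤ 4 * (q * q * (q * q)) + 5
      L≤ = ℕₚ.≤-trans (ℕₚ.m≤m+n L _) (ℕₚ.≤-reflexive (quartic r))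
      DY< : D * Y < 12 * (c * c * c) + D * X
      DY< = ℕₚ.+-cancelʳ-< (q * q * c * L) _ _ (begin-strict
        D * Y + q * q * c * L
          ≤⟨ ℕₚ.+-monoʳ-≤ (D * Y) (ℕₚ.*-monoʳ-≤ (q * q * c) L≤) ⟩
        D * Y + q * q * c * (4 * (q * q * (q * q)) + 5)
          <⟨ ℕₚ.+-monoʳ-< (D * Y) (ℕₚ.m<m+n _ (ℕₚ.<-≤-trans (s≤s z≤n) (ℕₚ.m≤n+m (q * q) (3 * (q * c))))) ⟩
        D * Y + (q * q * c * (4 * (q * q * (q * q)) + 5) + (3 * (q * c) + q * q))
          ≡⟨ cubic q ⟨
        12 * (c * c * c) + D * X + q * q * c * L ∎)

  -- Pure arithmetic: x₁, x₂, x₃ stand for the falling factorials summed over all φ, Q for the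
  -- number of φ, N₂ and N₃ for the numbers of ordered pairs and triples of classes, and P for the
  -- number of exceptional triples.
  moment-comparison : ∀ q c c′ D N₂ N₃ P Q x₁ x₂ x₃ → 2 ≤ q → 1 ≤ Q →
    D ≡ 1 + q + q * q + q * q * q → c ≡ q * (q * q) → c ≡ 1 + c′ →
    N₂ + D ≡ D * D → N₃ + 2 * N₂ ≡ N₂ * D → P + D * q ≤ D * (q * q) →
    c * x₁ ≡ D * Q → c * c * x₂ ≡ N₂ * Q → c * c * c * x₃ ≤ (N₃ + c′ * P) * Q →
    12 * x₁ + x₃ < 12 * Q + 5 * x₂
  moment-comparison 1 _ _ _ _ _ _ _ _ _ _ (s≤s ())
  moment-comparison (suc (suc r)) c c′ D N₂ N₃ P Q x₁ x₂ x₃ _ 1≤Q D≡₀ c≡₀ c′≡ N₂≡ N₃≡ P≤₀ first second third =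
    ℕₚ.≰⇒> λ A≤B → ℕₚ.<⇒≱ B<A (scale A≤B)
    where
    s q m′ m c″ B A : ℕ
    s = suc r
    q = suc s
    m′ = s + q * q + c
    m = suc m′
    c″ = s * (1 + q + q * q)
    B = (12 * (c * c) * D + (D * m * m′ + c″ * (D * (q * s)))) * Q
    A = (12 * (c * c * c) + 5 * c * (D * m)) * Q
    D≡m : D ≡ suc m
    D≡m = ≡.trans D≡₀ (≡.cong (λ z → suc (suc (s + q * q + z))) (≡.trans (ℕₚ.*-assoc q q q) (≡.sym c≡₀)))
    B<A : B < A
    B<A = ℕₚ.*-monoˡ-< Q {{Nat.>-nonZero 1≤Q}}
      (≡.subst₂ (λ c D → 12 * (c * c) * D + (D * suc (s + q * q + c) * (s + q * q + c) + c″ * (D * (q * s)))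
                         < 12 * (c * c * c) + 5 * c * (D * suc (s + q * q + c)))
         (≡.sym c≡₀) (≡.sym (≡.trans D≡m (≡.cong (λ z → suc (suc (s + q * q + z))) c≡₀))) (balance r))
    N₂-value : N₂ ≡ D * m
    N₂-value = ℕₚ.+-cancelʳ-≡ D _ _ (≡.trans N₂≡ (split D m D≡m))
      where
      split : ∀ D m → D ≡ suc m → D * D ≡ D * m + D
      split D m ≡.refl = ≡.trans (ℕₚ.*-suc D m) (ℕₚ.+-comm D _)
    N₃-value : N₃ ≡ D * m * m′
    N₃-value = ℕₚ.+-cancelʳ-≡ (2 * N₂) _ _ (≡.trans N₃≡
      (≡.trans (≡.trans (≡.cong (N₂ *_) D≡m) (split N₂ m′)) (≡.cong (λ z → z * m′ + 2 * N₂) N₂-value)))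
      where
      split : ∀ n k → n * suc (suc k) ≡ n * k + 2 * n
      split = solve-∀
    c′-value : c′ ≡ c″
    c′-value = ℕₚ.suc-injective (≡.trans (≡.sym c′≡) (≡.trans c≡₀ (c-shape s)))
      where
      c-shape : ∀ s → let q = suc s in q * (q * q) ≡ 1 + s * (1 + q + q * q)
      c-shape = solve-∀
    P-bound : P ≤ D * (q * s)
    P-bound = ℕₚ.+-cancelʳ-≤ (D * suc (suc r)) _ _ (ℕₚ.≤-trans P≤₀ (ℕₚ.≤-reflexive (split D r)))
      where
      split : ∀ D r → D * (suc (suc r) * suc (suc r)) ≡ D * (suc (suc r) * suc r) + D * suc (suc r)
      split = solve-∀
    expandA : ∀ c Q x n → c * c * x ≡ n * Q → (12 * (c * c * c) + 5 * c * n) * Q ≡ c * c * c * (12 * Q + 5 * x)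
    expandA c Q x n eq = ≡.trans (left c Q n) (≡.trans (≡.cong (λ z → 12 * (c * c * c) * Q + 5 * c * z) (≡.sym eq)) (right c Q x))
      where
      left : ∀ c Q n → (12 * (c * c * c) + 5 * c * n) * Q ≡ 12 * (c * c * c) * Q + 5 * c * (n * Q)
      left = solve-∀
      right : ∀ c Q x → 12 * (c * c * c) * Q + 5 * c * (c * c * x) ≡ c * c * c * (12 * Q + 5 * x)
      right = solve-∀
    left₁ : ∀ c x y → c * c * c * (12 * x + y) ≡ 12 * (c * c) * (c * x) + c * c * c * y
    left₁ = solve-∀
    right₁ : ∀ a D Q n → a * (D * Q) + n * Q ≡ (a * D + n) * Q
    right₁ = solve-∀
    scale : 12 * Q + 5 * x₂ ≤ 12 * x₁ + x₃ → A ≤ B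
    scale A≤B = begin
      A                                                 ≡⟨ ≡.cong (λ z → (12 * (c * c * c) + 5 * c * z) * Q) N₂-value ⟨
      (12 * (c * c * c) + 5 * c * N₂) * Q               ≡⟨ expandA c Q x₂ N₂ second ⟩
      c * c * c * (12 * Q + 5 * x₂)                     ≤⟨ ℕₚ.*-monoʳ-≤ (c * c * c) A≤B ⟩
      c * c * c * (12 * x₁ + x₃)                        ≡⟨ left₁ c x₁ x₃ ⟩
      12 * (c * c) * (c * x₁) + c * c * c * x₃          ≤⟨ ℕₚ.+-mono-≤ (ℕₚ.≤-reflexive (≡.cong (12 * (c * c) *_) first)) third ⟩
      12 * (c * c) * (D * Q) + (N₃ + c′ * P) * Q        ≡⟨ right₁ (12 * (c * c)) D Q (N₃ + c′ * P) ⟩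
      (12 * (c * c) * D + (N₃ + c′ * P)) * Q            ≤⟨ ℕₚ.*-monoˡ-≤ Q (ℕₚ.+-monoʳ-≤ (12 * (c * c) * D)
                                                             (ℕₚ.+-mono-≤ (ℕₚ.≤-reflexive N₃-value) (ℕₚ.*-mono-≤ (ℕₚ.≤-reflexive c′-value) P-bound))) ⟩
      B                                                 ∎

-- Averaging the number of bad classes over all φ in K⁶.

module Moments {c ℓ} (K : CommutativeRing c ℓ) (isField : IsField K)
  (q : ℕ) (cardK : HasCard K (q ^ 5)) (F : Subfield K) (cardF : SubfieldCard K F q) where
  open CommutativeRing K using (Carrier; _≈_; 0#; refl; sym; trans; +-congˡ; *-cong)
    renaming (_+_ to _+ᴷ_; _*_ to _*ᴷ_)
  open IntegerSolver K
  open FieldProperties K isField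
  open FiniteField K isField q cardK F cardF
  open Spans K isField q cardK F cardF
  open Points K isField q cardK F cardF
  open Counting
  open MomentArithmetic
  open Nat using (_+_; _*_; _∸_; _≤_; _<_)

  Vector : ℕ → Set c
  Vector n = Fin n → Carrier

  _⊕_ : ∀ {n} → Vector n → Vector n → Vector n
  (v ⊕ w) j = v j +ᴷ w j

  -- Vectors are functions that agree only pointwise up to `≈`; this invariance takes the place of
  -- extensionality when vectors are translated.
  Respectful : ∀ {n} → (Vector n → ℕ) → Set (c ⊔ ℓ)
  Respectful g = ∀ {v w} → (∀ j → v j ≈ w j) → g v ≡ g w

  opaque
    ∑V : ∀ n → (Vector n → ℕ) → ℕ
    ∑V zero    g = g ◇
    ∑V (suc n) g = sum λ i → ∑V n λ v → g (el i ◂ v)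

    ∑V-cong : ∀ n {g h : Vector n → ℕ} → (∀ v → g v ≡ h v) → ∑V n g ≡ ∑V n h
    ∑V-cong zero    g≡h = g≡h ◇
    ∑V-cong (suc n) g≡h = sum-cong (λ i → ∑V-cong n (λ v → g≡h (el i ◂ v)))

    ∑V-mono : ∀ n {g h : Vector n → ℕ} → (∀ v → g v ≤ h v) → ∑V n g ≤ ∑V n h
    ∑V-mono zero    g≤h = g≤h ◇
    ∑V-mono (suc n) g≤h = sum-mono (λ i → ∑V-mono n (λ v → g≤h (el i ◂ v)))

    ∑V-find : ∀ n {g h : Vector n → ℕ} → ∑V n g < ∑V n h → ∃[ v ] g v < h v
    ∑V-find zero    lt = ◇ , lt
    ∑V-find (suc n) lt with sum-find _ _ lt
    ... | i , lt′ with ∑V-find n lt′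
    ...   | v , lt″ = el i ◂ v , lt″

    ∑V-+ : ∀ n (g h : Vector n → ℕ) → ∑V n (λ v → g v + h v) ≡ ∑V n g + ∑V n h
    ∑V-+ zero    g h = ≡.refl
    ∑V-+ (suc n) g h = ≡.trans (sum-cong (λ i → ∑V-+ n (λ v → g (el i ◂ v)) (λ v → h (el i ◂ v))))
      (sum-+ (λ i → ∑V n (λ v → g (el i ◂ v))) (λ i → ∑V n (λ v → h (el i ◂ v))))

    ∑V-* : ∀ n k (g : Vector n → ℕ) → ∑V n (λ v → k * g v) ≡ k * ∑V n g
    ∑V-* zero    k g = ≡.refl
    ∑V-* (suc n) k g = ≡.trans (sum-cong (λ i → ∑V-* n k (λ v → g (el i ◂ v)))) (sum-*ˡ k (λ i → ∑V n (λ v → g (el i ◂ v))))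

    ∑V-sum : ∀ n {m} (h : Fin m → Vector n → ℕ) → ∑V n (λ v → sum (λ i → h i v)) ≡ sum (λ i → ∑V n (h i))
    ∑V-sum zero    h = ≡.refl
    ∑V-sum (suc n) h = ≡.trans (sum-cong (λ k → ∑V-sum n (λ i v → h i (el k ◂ v))))
      (sum-swap (λ k i → ∑V n (λ v → h i (el k ◂ v))))

    ∑V-translate : ∀ n (g : Vector n → ℕ) → Respectful g → ∀ a → ∑V n (λ v → g (v ⊕ a)) ≡ ∑V n g
    ∑V-translate zero    g resp a = resp λ ()
    ∑V-translate (suc n) g resp a = begin
      sum (λ i → ∑V n (λ v → g ((el i ◂ v) ⊕ a)))
        ≡⟨ sum-cong (λ i → ∑V-cong n (λ v → resp {(el i ◂ v) ⊕ a} {(el i +ᴷ a zero) ◂ (v ⊕ (a ∘ suc))} (λ { zero → refl ; (suc j) → refl }))) ⟩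
      sum (λ i → ∑V n (λ v → g ((el i +ᴷ a zero) ◂ (v ⊕ (a ∘ suc)))))
        ≡⟨ sum-cong (λ i → ∑V-translate n (λ v → g ((el i +ᴷ a zero) ◂ v)) (λ v≈w → resp (λ { zero → refl ; (suc j) → v≈w j })) (a ∘ suc)) ⟩
      sum (λ i → ∑V n (λ v → g ((el i +ᴷ a zero) ◂ v)))
        ≡⟨ sum-translate (λ x → ∑V n (λ v → g (x ◂ v))) (λ x≈y → ∑V-cong n (λ v → resp (λ { zero → x≈y ; (suc j) → refl }))) (a zero) ⟩
      sum (λ i → ∑V n (λ v → g (el i ◂ v))) ∎
      where open ≡.≡-Reasoning

    ∑V-positive : ∀ n → 1 ≤ ∑V n (λ _ → 1)
    ∑V-positive zero    = ℕₚ.≤-refl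
    ∑V-positive (suc n) = ℕₚ.≤-trans (ℕₚ.*-mono-≤ (Nat.>-nonZero⁻¹ (q ^ 5) {{ℕₚ.m^n≢0 q 5}}) (∑V-positive n))
      (ℕₚ.≤-reflexive (≡.sym (sum-const (q ^ 5) (∑V n (λ _ → 1)))))

  Q : ℕ
  Q = ∑V 6 (λ _ → 1)

  bad : Fin D → Vector 6 → ℕ
  bad i φ = ind (V? (Λ i) (Φ i φ))

  private
    V-ind-cong : ∀ i {x y} → x ≈ y → ind (V? (Λ i) x) ≡ ind (V? (Λ i) y)
    V-ind-cong i {x} {y} x≈y = ind-cong (V? (Λ i) x) (V? (Λ i) y) (V-resp x≈y) (V-resp (sym x≈y))

  bad-resp : ∀ i → Respectful (bad i)
  bad-resp i v≈w = V-ind-cong i (Φ-cong i v≈w)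

  bad-idem : ∀ φ i → bad i φ * bad i φ ≡ bad i φ
  bad-idem φ i = ind-idem (V? (Λ i) (Φ i φ))

  _·_ : Carrier → Vector 6 → Vector 6
  (κ · ψ) j = κ *ᴷ ψ j

  bad-invariant : ∀ i {ψ} → Φ i ψ ≈ 0# → ∀ κ φ → bad i (φ ⊕ (κ · ψ)) ≡ bad i φ
  bad-invariant i {ψ} Φψ≈0 κ φ = V-ind-cong i
    (trans (Φ-add i κ φ ψ) (trans (+-congˡ (*-cong refl Φψ≈0)) (solve 2 (λ x k → x :+ k :* :0 := x) refl (Φ i φ) κ)))

  volume : ℕ
  volume = q * (q * q)

  -- Translating φ along ψ spreads the value of Φ i over all of K, of which V (Λ i) is the fraction 1/q³.
  thin : (g : Vector 6 → ℕ) → Respectful g → ∀ i ψ → (∀ κ φ → g (φ ⊕ (κ · ψ)) ≡ g φ) → ¬ Φ i ψ ≈ 0# →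
         volume * ∑V 6 (λ φ → g φ * bad i φ) ≡ ∑V 6 g
  thin g g-resp i ψ g-inv Φψ≉0 = ℕₚ.*-cancelʳ-≡ _ _ (q ^ 2) {{ℕₚ.m^n≢0 q 2}} (begin
    volume * total * q ^ 2                                ≡⟨ powers q total ⟩
    q ^ 5 * total                                         ≡⟨ sum-const (q ^ 5) total ⟨
    sum {q ^ 5} (λ _ → total)                             ≡⟨ sum-cong (λ k → shifted (el k)) ⟩
    sum (λ k → ∑V 6 (λ φ → g φ * ind (V? (Λ i) (el k +ᴷ Φ i φ))))
                                                          ≡⟨ ∑V-sum 6 (λ k φ → g φ * ind (V? (Λ i) (el k +ᴷ Φ i φ))) ⟨
    ∑V 6 (λ φ → sum (λ k → g φ * ind (V? (Λ i) (el k +ᴷ Φ i φ))))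
                                                          ≡⟨ ∑V-cong 6 fibre ⟩
    ∑V 6 (λ φ → q ^ 2 * g φ)                              ≡⟨ ∑V-* 6 (q ^ 2) g ⟩
    q ^ 2 * ∑V 6 g                                        ≡⟨ ℕₚ.*-comm (q ^ 2) _ ⟩
    ∑V 6 g * q ^ 2                                        ∎)
    where
    open ≡.≡-Reasoning
    total = ∑V 6 (λ φ → g φ * bad i φ)
    powers : ∀ q t → q * (q * q) * t * (q * (q * 1)) ≡ q * (q * (q * (q * (q * 1)))) * t
    powers = solve-∀
    shifted : ∀ κ → total ≡ ∑V 6 (λ φ → g φ * ind (V? (Λ i) (κ +ᴷ Φ i φ)))
    shifted κ = ≡.trans
      (≡.sym (∑V-translate 6 (λ φ → g φ * bad i φ) (λ v≈w → ≡.cong₂ _*_ (g-resp v≈w) (bad-resp i v≈w)) (κ′ · ψ)))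
      (∑V-cong 6 (λ φ → ≡.cong₂ _*_ (g-inv κ′ φ) (V-ind-cong i (trans (Φ-add i κ′ φ ψ)
        (trans (+-congˡ κ′Φψ) (solve 2 (λ x y → x :+ y := y :+ x) refl (Φ i φ) κ))))))
      where
      -- Translation by `κ′ · ψ` shifts the value of `Φ i` by exactly κ.
      κ′ = κ *ᴷ inv Φψ≉0
      κ′Φψ : κ′ *ᴷ Φ i ψ ≈ κ
      κ′Φψ = trans (solve 2 (λ x y → x :* y := y :* x) refl κ′ (Φ i ψ)) (x*[y*x⁻¹]≈y Φψ≉0 κ)
    fibre : ∀ φ → sum (λ k → g φ * ind (V? (Λ i) (el k +ᴷ Φ i φ))) ≡ q ^ 2 * g φ
    fibre φ = begin
      sum (λ k → g φ * ind (V? (Λ i) (el k +ᴷ Φ i φ)))  ≡⟨ sum-*ˡ (g φ) (λ k → ind (V? (Λ i) (el k +ᴷ Φ i φ))) ⟩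
      g φ * sum (λ k → ind (V? (Λ i) (el k +ᴷ Φ i φ)))  ≡⟨ ≡.cong (g φ *_) (sum-translate (λ x → ind (V? (Λ i) x)) (V-ind-cong i) (Φ i φ)) ⟩
      g φ * sum (λ k → ind (V? (Λ i) (el k)))           ≡⟨ ≡.cong (g φ *_) (V-card (Λ∉F i)) ⟩
      g φ * q ^ 2                                       ≡⟨ ℕₚ.*-comm (g φ) _ ⟩
      q ^ 2 * g φ                                       ∎

  first-moment : ∀ i → volume * ∑V 6 (bad i) ≡ Q
  first-moment i with point-separation₁ i
  ... | ψ , ne = ≡.trans (≡.cong (volume *_) (∑V-cong 6 (λ φ → ≡.sym (ℕₚ.*-identityˡ (bad i φ)))))
                         (thin (λ _ → 1) (λ _ → ≡.refl) i ψ (λ _ _ → ≡.refl) ne)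

  second-moment : ∀ {i j} → i ≢ j → volume * volume * ∑V 6 (λ φ → bad i φ * bad j φ) ≡ Q
  second-moment {i} {j} i≢j with point-separation₂ (i≢j ∘ ≡.sym)
  ... | ψ , Φi≈0 , ne = ≡.trans (ℕₚ.*-assoc volume volume _)
    (≡.trans (≡.cong (volume *_) (thin (bad i) (bad-resp i) j ψ (bad-invariant i {ψ} Φi≈0) ne)) (first-moment i))

  -- For an exceptional triple the event of class k is dropped; the pair that is left gives
  -- `volume * Q` instead of Q, hence the surplus `volume ∸ 1`.
  third-moment : ∀ {i j k} → i ≢ j → i ≢ k → j ≢ k →
                 volume * volume * volume * ∑V 6 (λ φ → bad i φ * (bad j φ * bad k φ))
                 ≤ Q + (volume ∸ 1) * (ind (S? k i) * ind (S? k j)) * Q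
  third-moment {i} {j} {k} i≢j i≢k j≢k with S? k i ×-dec S? k j
  ... | no ¬S with point-separation₃ i≢j i≢k j≢k ¬S
  ...   | ψ , Φi≈0 , Φj≈0 , ne = ℕₚ.≤-trans (ℕₚ.≤-reflexive (begin
      volume * volume * volume * ∑V 6 (λ φ → bad i φ * (bad j φ * bad k φ))
        ≡⟨ ≡.cong (volume * volume * volume *_) (∑V-cong 6 (λ φ → ≡.sym (ℕₚ.*-assoc (bad i φ) (bad j φ) (bad k φ)))) ⟩
      volume * volume * volume * ∑V 6 (λ φ → bad i φ * bad j φ * bad k φ)
        ≡⟨ ℕₚ.*-assoc (volume * volume) volume _ ⟩
      volume * volume * (volume * ∑V 6 (λ φ → bad i φ * bad j φ * bad k φ))
        ≡⟨ ≡.cong (volume * volume *_) (thin (λ φ → bad i φ * bad j φ)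
             (λ v≈w → ≡.cong₂ _*_ (bad-resp i v≈w) (bad-resp j v≈w)) k ψ
             (λ κ φ → ≡.cong₂ _*_ (bad-invariant i {ψ} Φi≈0 κ φ) (bad-invariant j {ψ} Φj≈0 κ φ)) ne) ⟩
      volume * volume * ∑V 6 (λ φ → bad i φ * bad j φ)
        ≡⟨ second-moment i≢j ⟩
      Q ∎)) (ℕₚ.m≤m+n Q _)
    where open ≡.≡-Reasoning
  third-moment {i} {j} {k} i≢j i≢k j≢k | yes (ski , skj) = begin
      volume * volume * volume * ∑V 6 (λ φ → bad i φ * (bad j φ * bad k φ))
        ≤⟨ ℕₚ.*-monoʳ-≤ (volume * volume * volume) (∑V-mono 6 (λ φ → drop φ)) ⟩
      volume * volume * volume * ∑V 6 (λ φ → bad i φ * bad j φ)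
        ≡⟨ rotate volume (∑V 6 (λ φ → bad i φ * bad j φ)) ⟩
      volume * (volume * volume * ∑V 6 (λ φ → bad i φ * bad j φ))
        ≡⟨ ≡.cong (volume *_) (second-moment i≢j) ⟩
      volume * Q
        ≡⟨ ≡.cong (_* Q) (ℕₚ.m+[n∸m]≡n {1} {volume} 1≤volume) ⟨
      (1 + (volume ∸ 1)) * Q
        ≡⟨ spread (volume ∸ 1) Q ⟩
      Q + (volume ∸ 1) * (1 * 1) * Q
        ≡⟨ ≡.cong₂ (λ x y → Q + (volume ∸ 1) * (x * y) * Q) (ind-yes (S? k i) ski) (ind-yes (S? k j) skj) ⟨
      Q + (volume ∸ 1) * (ind (S? k i) * ind (S? k j)) * Q ∎
    where
    open ℕₚ.≤-Reasoning
    drop : ∀ φ → bad i φ * (bad j φ * bad k φ) ≤ bad i φ * bad j φ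
    -- The true proposition 0 ≡ 0 has indicator 1 and thereby bounds `bad k φ`.
    drop φ = ℕₚ.*-monoʳ-≤ (bad i φ) (ℕₚ.≤-trans (ℕₚ.*-monoʳ-≤ (bad j φ) (ind-mono (V? (Λ k) (Φ k φ)) (yes ≡.refl) (λ _ → ≡.refl {x = 0})))
      (ℕₚ.≤-reflexive (ℕₚ.*-identityʳ _)))
    rotate : ∀ v t → v * v * v * t ≡ v * (v * v * t)
    rotate = solve-∀
    spread : ∀ v t → (1 + v) * t ≡ t + v * (1 * 1) * t
    spread = solve-∀
    1≤volume : 1 ≤ volume
    1≤volume = ℕₚ.*-mono-≤ 1≤q (ℕₚ.*-mono-≤ 1≤q 1≤q)
      where
      1≤q : 1 ≤ q
      1≤q = ℕₚ.≤-trans (s≤s z≤n) 2≤q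

  private
    N₂ N₃ P : ℕ
    N₂ = pairs {D} (λ _ → 1)
    N₃ = triples {D} (λ _ → 1)
    P  = sum λ k → pairs λ i → ind (S? k i)

    D≡sum : sum {D} (λ _ → 1) ≡ D
    D≡sum = ≡.trans (sum-const D 1) (ℕₚ.*-identityʳ D)

    N₂-equation : N₂ + D ≡ D * D
    N₂-equation = ≡.subst (λ s → N₂ + s ≡ s * s) D≡sum (pairs+sum {D} (λ _ → 1) (λ _ → ≡.refl))

    N₃-equation : N₃ + 2 * N₂ ≡ N₂ * D
    N₃-equation = ≡.subst (λ s → N₃ + 2 * N₂ ≡ N₂ * s) D≡sum (triples+pairs {D} (λ _ → 1) (λ _ → ≡.refl))

    -- A set S k of s ≤ q classes contributes s (s - 1) ≤ q (q - 1), stated without subtraction.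
    P-bound : P + D * q ≤ D * (q * q)
    P-bound = begin
      P + D * q                                          ≡⟨ ≡.cong (P +_) (sum-const D q) ⟨
      P + sum {D} (λ _ → q)                              ≡⟨ sum-+ (λ k → pairs (λ i → ind (S? k i))) (λ _ → q) ⟨
      sum (λ k → pairs (λ i → ind (S? k i)) + q)         ≤⟨ sum-mono bound ⟩
      sum {D} (λ _ → q * q)                              ≡⟨ sum-const D (q * q) ⟩
      D * (q * q)                                        ∎
      where
      open ℕₚ.≤-Reasoning
      square : ∀ p s q → 1 ≤ q → s ≤ q → p + s ≡ s * s → p + q ≤ q * q
      square p zero    q 1≤q _   eq rewrite ℕₚ.m+n≡0⇒m≡0 p eq = ℕₚ.m≤m*n q q {{Nat.>-nonZero 1≤q}}
      square p (suc m) q 1≤q s≤q eq with ℕₚ.m≤n⇒∃[o]m+o≡n s≤q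
      ... | d , ≡.refl = begin
        p + (suc m + d)                 ≡⟨ ℕₚ.+-assoc p (suc m) d ⟨
        p + suc m + d                   ≡⟨ ≡.cong (_+ d) eq ⟩
        suc m * suc m + d               ≤⟨ ℕₚ.m≤m+n _ _ ⟩
        suc m * suc m + d + (d + 2 * (m * d) + d * d) ≡⟨ expand m d ⟩
        (suc m + d) * (suc m + d)       ∎
        where
        expand : ∀ m d → suc m * suc m + d + (d + 2 * (m * d) + d * d) ≡ (suc m + d) * (suc m + d)
        expand = solve-∀
      bound : ∀ k → pairs (λ i → ind (S? k i)) + q ≤ q * q
      bound k = square (pairs (λ i → ind (S? k i))) (sum (λ i → ind (S? k i))) q (ℕₚ.≤-trans (s≤s z≤n) 2≤q) (S-count k)
        (pairs+sum (λ i → ind (S? k i)) (λ i → ind-idem (S? k i)))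

    off-split : ∀ {m} (i j : Fin m) → (i ≢ j × off i j ≡ 1) ⊎ off i j ≡ 0
    off-split i j with i ≟ j
    ... | yes _  = inj₂ ≡.refl
    ... | no i≢j = inj₁ (i≢j , ≡.refl)

    badness : Vector 6 → Fin D → ℕ
    badness φ i = bad i φ

    total₁ : volume * ∑V 6 (λ φ → sum (badness φ)) ≡ D * Q
    total₁ = begin
      volume * ∑V 6 (λ φ → sum (badness φ))   ≡⟨ ≡.cong (volume *_) (∑V-sum 6 bad) ⟩
      volume * sum (λ i → ∑V 6 (bad i))       ≡⟨ sum-*ˡ volume (λ i → ∑V 6 (bad i)) ⟨
      sum (λ i → volume * ∑V 6 (bad i))       ≡⟨ sum-cong first-moment ⟩
      sum {D} (λ _ → Q)                       ≡⟨ sum-const D Q ⟩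
      D * Q                                   ∎
      where open ≡.≡-Reasoning

    -- The factors `1 * 1` are those of `pairs (λ _ → 1)`, so that the final sum is N₂ by
    -- definition.
    total₂ : volume * volume * ∑V 6 (λ φ → pairs (badness φ)) ≡ N₂ * Q
    total₂ = begin
      v * ∑V 6 (λ φ → sum λ i → sum λ j → off i j * (bad i φ * bad j φ))
        ≡⟨ ≡.cong (v *_) (≡.trans (∑V-sum 6 (λ i φ → sum λ j → off i j * (bad i φ * bad j φ)))
             (sum-cong (λ i → ∑V-sum 6 (λ j φ → off i j * (bad i φ * bad j φ))))) ⟩
      v * sum (λ i → sum λ j → ∑V 6 (λ φ → off i j * (bad i φ * bad j φ)))
        ≡⟨ ≡.trans (≡.sym (sum-*ˡ v (λ i → sum (S₂ i)))) (sum-cong (λ i → ≡.sym (sum-*ˡ v (S₂ i)))) ⟩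
      sum (λ i → sum λ j → v * ∑V 6 (λ φ → off i j * (bad i φ * bad j φ)))
        ≡⟨ sum-cong (λ i → sum-cong (λ j → term i j)) ⟩
      sum (λ i → sum λ j → off i j * (1 * 1) * Q)
        ≡⟨ ≡.trans (sum-cong (λ i → sum-*ʳ Q (λ j → off i j * (1 * 1)))) (sum-*ʳ Q (λ i → sum λ j → off i j * (1 * 1))) ⟩
      N₂ * Q ∎
      where
      open ≡.≡-Reasoning
      v = volume * volume
      S₂ : Fin D → Fin D → ℕ
      S₂ i j = ∑V 6 (λ φ → off i j * (bad i φ * bad j φ))
      term : ∀ i j → v * ∑V 6 (λ φ → off i j * (bad i φ * bad j φ)) ≡ off i j * (1 * 1) * Q
      term i j = ≡.trans (≡.cong (v *_) (∑V-* 6 (off i j) (λ φ → bad i φ * bad j φ))) (step (off-split i j))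
        where
        x = ∑V 6 (λ φ → bad i φ * bad j φ)
        step : (i ≢ j × off i j ≡ 1) ⊎ off i j ≡ 0 → v * (off i j * x) ≡ off i j * (1 * 1) * Q
        step (inj₁ (i≢j , eq)) rewrite eq = ≡.trans (≡.cong (v *_) (ℕₚ.*-identityˡ x)) (≡.trans (second-moment i≢j) (≡.sym (ℕₚ.*-identityˡ Q)))
        step (inj₂ eq) rewrite eq = ℕₚ.*-zeroʳ v

    sum₃ : (Fin D → Fin D → Fin D → ℕ) → ℕ
    sum₃ f = sum λ i → sum λ j → sum λ k → f i j k

    sum₃-*ˡ : ∀ a f → sum₃ (λ i j k → a * f i j k) ≡ a * sum₃ f
    sum₃-*ˡ a f = ≡.trans (sum-cong (λ i → ≡.trans (sum-cong (λ j → sum-*ˡ a (f i j))) (sum-*ˡ a (λ j → sum (f i j)))))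
      (sum-*ˡ a (λ i → sum λ j → sum (f i j)))

    sum₃-+ : ∀ f g → sum₃ (λ i j k → f i j k + g i j k) ≡ sum₃ f + sum₃ g
    sum₃-+ f g = ≡.trans (sum-cong (λ i → ≡.trans (sum-cong (λ j → sum-+ (f i j) (g i j)))
        (sum-+ (λ j → sum (f i j)) (λ j → sum (g i j)))))
      (sum-+ (λ i → sum λ j → sum (f i j)) (λ i → sum λ j → sum (g i j)))

    o₃ : Fin D → Fin D → Fin D → ℕ → ℕ
    o₃ i j k x = off i j * (off i k * (off j k * x))

    σ : Fin D → Fin D → Fin D → ℕ
    σ i j k = ind (S? k i) * ind (S? k j)

    -- In the surplus only `off i j` is kept. Forgetting k ≠ i and k ≠ j can only enlarge it, and
    -- with k as the outermost index the sum is exactly P.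
    total₃ : volume * volume * volume * ∑V 6 (λ φ → triples (badness φ)) ≤ (N₃ + (volume ∸ 1) * P) * Q
    total₃ = begin
      v * ∑V 6 (λ φ → sum₃ λ i j k → o₃ i j k (bad i φ * (bad j φ * bad k φ)))
        ≡⟨ ≡.cong (v *_) (≡.trans (∑V-sum 6 (λ i φ → sum λ j → sum λ k → o₃ i j k (bad i φ * (bad j φ * bad k φ))))
             (sum-cong (λ i → ≡.trans (∑V-sum 6 (λ j φ → sum λ k → o₃ i j k (bad i φ * (bad j φ * bad k φ))))
               (sum-cong (λ j → ∑V-sum 6 (λ k φ → o₃ i j k (bad i φ * (bad j φ * bad k φ)))))))) ⟩
      v * sum₃ (λ i j k → ∑V 6 (λ φ → o₃ i j k (bad i φ * (bad j φ * bad k φ))))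
        ≡⟨ sum₃-*ˡ v (λ i j k → ∑V 6 (λ φ → o₃ i j k (bad i φ * (bad j φ * bad k φ)))) ⟨
      sum₃ (λ i j k → v * ∑V 6 (λ φ → o₃ i j k (bad i φ * (bad j φ * bad k φ))))
        ≤⟨ sum-mono (λ i → sum-mono (λ j → sum-mono (λ k → term i j k))) ⟩
      sum₃ (λ i j k → Q * o₃ i j k (1 * (1 * 1)) + Q * (w * (off i j * σ i j k)))
        ≡⟨ sum₃-+ (λ i j k → Q * o₃ i j k (1 * (1 * 1))) (λ i j k → Q * (w * (off i j * σ i j k))) ⟩
      sum₃ (λ i j k → Q * o₃ i j k (1 * (1 * 1))) + sum₃ (λ i j k → Q * (w * (off i j * σ i j k)))
        ≡⟨ ≡.cong₂ _+_ (sum₃-*ˡ Q (λ i j k → o₃ i j k (1 * (1 * 1))))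
             (≡.trans (sum₃-*ˡ Q (λ i j k → w * (off i j * σ i j k))) (≡.cong (Q *_) (sum₃-*ˡ w (λ i j k → off i j * σ i j k)))) ⟩
      Q * N₃ + Q * (w * sum₃ (λ i j k → off i j * σ i j k))
        ≡⟨ ≡.cong (λ z → Q * N₃ + Q * (w * z)) reorder ⟩
      Q * N₃ + Q * (w * P)
        ≡⟨ collect Q N₃ (w * P) ⟩
      (N₃ + w * P) * Q ∎
      where
      open ℕₚ.≤-Reasoning
      v = volume * volume * volume
      w = volume ∸ 1
      collect : ∀ q n p → q * n + q * p ≡ (n + p) * q
      collect = solve-∀
      reorder : sum₃ (λ i j k → off i j * σ i j k) ≡ P
      reorder = ≡.trans (sum-cong (λ i → sum-swap (λ j k → off i j * σ i j k))) (sum-swap (λ i k → sum λ j → off i j * σ i j k))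
      term : ∀ i j k → v * ∑V 6 (λ φ → o₃ i j k (bad i φ * (bad j φ * bad k φ)))
                       ≤ Q * o₃ i j k (1 * (1 * 1)) + Q * (w * (off i j * σ i j k))
      term i j k = ℕₚ.≤-trans (ℕₚ.≤-reflexive (≡.cong (v *_) pull)) (step (off-split i j) (off-split i k) (off-split j k))
        where
        b : Vector 6 → ℕ
        b φ = bad i φ * (bad j φ * bad k φ)
        x = ∑V 6 b
        pull : ∑V 6 (λ φ → o₃ i j k (b φ)) ≡ o₃ i j k x
        pull = ≡.trans (∑V-* 6 (off i j) (λ φ → off i k * (off j k * b φ)))
          (≡.cong (off i j *_) (≡.trans (∑V-* 6 (off i k) (λ φ → off j k * b φ)) (≡.cong (off i k *_) (∑V-* 6 (off j k) b))))
        zero-case : ∀ {n} → n ≡ 0 → ∀ y → v * n ≤ y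
        zero-case ≡.refl y = ℕₚ.≤-trans (ℕₚ.≤-reflexive (ℕₚ.*-zeroʳ v)) z≤n
        one-case : ∀ {o₁ o₂ o₃} → o₁ ≡ 1 → o₂ ≡ 1 → o₃ ≡ 1 → ∀ s → v * x ≤ Q + w * s * Q →
                   v * (o₁ * (o₂ * (o₃ * x))) ≤ Q * (o₁ * (o₂ * (o₃ * (1 * (1 * 1))))) + Q * (w * (o₁ * s))
        one-case ≡.refl ≡.refl ≡.refl s le = ℕₚ.≤-trans (ℕₚ.≤-reflexive (units v x)) (ℕₚ.≤-trans le (ℕₚ.≤-reflexive (units′ Q w s)))
          where
          units : ∀ v x → v * (1 * (1 * (1 * x))) ≡ v * x
          units = solve-∀
          units′ : ∀ q w s → q + w * s * q ≡ q * (1 * (1 * (1 * (1 * (1 * 1))))) + q * (w * (1 * s))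
          units′ = solve-∀
        step : (i ≢ j × off i j ≡ 1) ⊎ off i j ≡ 0 → (i ≢ k × off i k ≡ 1) ⊎ off i k ≡ 0 → (j ≢ k × off j k ≡ 1) ⊎ off j k ≡ 0 →
               v * o₃ i j k x ≤ Q * o₃ i j k (1 * (1 * 1)) + Q * (w * (off i j * σ i j k))
        step (inj₂ eq) _ _ = zero-case (≡.cong (_* (off i k * (off j k * x))) eq) _
        step (inj₁ _) (inj₂ eq) _ =
          zero-case (≡.trans (≡.cong (λ z → off i j * (z * (off j k * x))) eq) (ℕₚ.*-zeroʳ (off i j))) _
        step (inj₁ _) (inj₁ _) (inj₂ eq) =
          zero-case (≡.trans (≡.cong (λ z → off i j * (off i k * (z * x))) eq)
            (≡.trans (≡.cong (off i j *_) (ℕₚ.*-zeroʳ (off i k))) (ℕₚ.*-zeroʳ (off i j)))) _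
        step (inj₁ (i≢j , e₁)) (inj₁ (i≢k , e₂)) (inj₁ (j≢k , e₃)) =
          one-case e₁ e₂ e₃ (σ i j k) (third-moment i≢j i≢k j≢k)

  private
    lower upper : Vector 6 → ℕ
    lower φ = 12 * sum (badness φ) + triples (badness φ)
    upper φ = 12 * 1 + 5 * pairs (badness φ)

    ∑-lower : ∑V 6 lower ≡ 12 * ∑V 6 (λ φ → sum (badness φ)) + ∑V 6 (λ φ → triples (badness φ))
    ∑-lower = ≡.trans (∑V-+ 6 (λ φ → 12 * sum (badness φ)) (λ φ → triples (badness φ)))
      (≡.cong (_+ ∑V 6 (λ φ → triples (badness φ))) (∑V-* 6 12 (λ φ → sum (badness φ))))

    ∑-upper : ∑V 6 upper ≡ 12 * Q + 5 * ∑V 6 (λ φ → pairs (badness φ))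
    ∑-upper = ≡.trans (∑V-+ 6 (λ _ → 12 * 1) (λ φ → 5 * pairs (badness φ)))
      (≡.cong₂ _+_ (∑V-* 6 12 (λ _ → 1)) (∑V-* 6 5 (λ φ → pairs (badness φ))))

    volume-suc : volume ≡ 1 + (volume ∸ 1)
    volume-suc = ≡.sym (ℕₚ.m+[n∸m]≡n {1} {volume} (ℕₚ.*-mono-≤ 1≤q (ℕₚ.*-mono-≤ 1≤q 1≤q)))
      where
      1≤q : 1 ≤ q
      1≤q = ℕₚ.≤-trans (s≤s z≤n) 2≤q

    ∑-comparison : ∑V 6 lower < ∑V 6 upper
    ∑-comparison = ≡.subst₂ _<_ (≡.sym ∑-lower) (≡.sym ∑-upper)
      (moment-comparison q volume (volume ∸ 1) D N₂ N₃ P Q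
        (∑V 6 (λ φ → sum (badness φ))) (∑V 6 (λ φ → pairs (badness φ))) (∑V 6 (λ φ → triples (badness φ)))
        2≤q (∑V-positive 6) D-value ≡.refl volume-suc N₂-equation N₃-equation P-bound total₁ total₂ total₃)

    bad⇒upper≤lower : ∀ φ i → V (Λ i) (Φ i φ) → upper φ ≤ lower φ
    bad⇒upper≤lower φ i v = moment-inequality (badness φ) (bad-idem φ) (λ s≡0 →
      ℕₚ.1+n≰n (ℕₚ.≤-trans (ℕₚ.≤-reflexive (≡.sym (ind-yes (V? (Λ i) (Φ i φ)) v)))
        (ℕₚ.≤-trans (term≤sum (badness φ) i) (ℕₚ.≤-reflexive s≡0))))

    find : ∃[ φ ] lower φ < upper φ
    find = ∑V-find 6 ∑-comparison

  opaque
    -- The comparison of totals gives some φ with `lower φ < upper φ`, and one bad class would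
    -- reverse this inequality.
    good-functional : ∃[ φ ] ∀ i → ¬ V (Λ i) (Φ i φ)
    good-functional = proj₁ find , λ i v → ℕₚ.<⇒≱ (proj₂ find) (bad⇒upper≤lower (proj₁ find) i v)

-- The subspace U and its scatteredness.

module ScatteredSubspace {c ℓ} (K : CommutativeRing c ℓ) (isField : IsField K)
  (q : ℕ) (cardK : HasCard K (q ^ 5)) (F : Subfield K) (cardF : SubfieldCard K F q) where
  open CommutativeRing K hiding (zero)
  open IntegerSolver K
  open FieldProperties K isField
  open FiniteField K isField q cardK F cardF
  open Spans K isField q cardK F cardF
  open Separation K isField q cardK F cardF
  open Points K isField q cardK F cardF
  open Moments K isField q cardK F cardF using (good-functional)
  open Subfield F
  open import Relation.Binary.Reasoning.Setoid setoid

  private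
    φ : Fin 6 → Carrier
    φ = proj₁ good-functional

    Coords : Set c
    Coords = Fin 6 → Carrier

    mix : Carrier → Carrier → ∀ {n} → (Fin n → Carrier) → (Fin n → Carrier) → Fin n → Carrier
    mix κ ρ t t′ j = κ * t j + ρ * t′ j

    mix-in : ∀ {κ ρ n} {t t′ : Fin n → Carrier} → In κ → In ρ → (∀ j → In (t j)) → (∀ j → In (t′ j)) → ∀ j → In (mix κ ρ t t′ j)
    mix-in κ∈F ρ∈F t∈F t′∈F j = In-+ (In-* κ∈F (t∈F j)) (In-* ρ∈F (t′∈F j))

    lin-mix : ∀ κ ρ {n} (t t′ e : Fin n → Carrier) → lin (mix κ ρ t t′) e ≈ κ * lin t e + ρ * lin t′ e
    lin-mix κ ρ {zero}  t t′ e = solve 2 (λ k r → :0 := k :* :0 :+ r :* :0) refl κ ρ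
    lin-mix κ ρ {suc n} t t′ e = trans (+-congˡ (lin-mix κ ρ (t ∘ suc) (t′ ∘ suc) (e ∘ suc)))
      (solve 7 (λ k r x y e u v → (k :* x :+ r :* y) :* e :+ (k :* u :+ r :* v) := k :* (x :* e :+ u) :+ r :* (y :* e :+ v)) refl
        κ ρ (t zero) (t′ zero) (e zero) (lin (t ∘ suc) (e ∘ suc)) (lin (t′ ∘ suc) (e ∘ suc)))

    ζ-mix : ∀ {κ ρ} → In κ → In ρ → ∀ t t′ → ζ (mix κ ρ t t′) ≈ κ * ζ t + ρ * ζ t′
    ζ-mix {κ} {ρ} κ∈F ρ∈F t t′ = begin
      θ (ξ (mix κ ρ t t′)) + (κ * t zero + ρ * t′ zero)
        ≈⟨ +-congʳ (trans (θ-cong (lin-mix κ ρ (t ∘ suc) (t′ ∘ suc) basis)) (trans (θ-+ _ _) (+-cong (θ-* _ _) (θ-* _ _)))) ⟩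
      (θ κ * θ (ξ t) + θ ρ * θ (ξ t′)) + (κ * t zero + ρ * t′ zero)
        ≈⟨ +-congʳ (+-cong (*-congʳ (θ-F κ∈F)) (*-congʳ (θ-F ρ∈F))) ⟩
      (κ * θ (ξ t) + ρ * θ (ξ t′)) + (κ * t zero + ρ * t′ zero)
        ≈⟨ solve 6 (λ k r x y u v → (k :* x :+ r :* y) :+ (k :* u :+ r :* v) := k :* (x :+ u) :+ r :* (y :+ v)) refl κ ρ (θ (ξ t)) (θ (ξ t′)) (t zero) (t′ zero) ⟩
      κ * ζ t + ρ * ζ t′ ∎

    ξ-injective : ∀ {t t′ : Coords} → (∀ j → In (t j)) → (∀ j → In (t′ j)) →
                  t zero ≈ t′ zero → ξ t ≈ ξ t′ → ∀ j → t j ≈ t′ j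
    ξ-injective t∈F t′∈F t₀≈ ξ≈ zero = t₀≈
    ξ-injective {t} {t′} t∈F t′∈F t₀≈ ξ≈ (suc j) = x-y≈0⇒x≈y (trans
      (solve 2 (λ x y → x :- y := :1 :* x :+ :- :1 :* y) refl (t (suc j)) (t′ (suc j)))
      (indep⇒lin≈0 5 basis basis-indep (mix 1# (- 1#) (t ∘ suc) (t′ ∘ suc))
        (mix-in {t = t ∘ suc} {t′ = t′ ∘ suc} In-1 (In-neg In-1) (t∈F ∘ suc) (t′∈F ∘ suc)) (begin
          ξ (mix 1# (- 1#) t t′)           ≈⟨ lin-mix 1# (- 1#) (t ∘ suc) (t′ ∘ suc) basis ⟩
          1# * ξ t + - 1# * ξ t′           ≈⟨ solve 2 (λ x y → :1 :* x :+ :- :1 :* y := x :- y) refl (ξ t) (ξ t′) ⟩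
          ξ t - ξ t′                       ≈⟨ x≈y⇒x-y≈0 ξ≈ ⟩
          0#                               ∎) j))

    ∉F⇒coeffs≈0 : ∀ {μ a b} → ¬ In μ → In a → In b → b ≈ μ * a → a ≈ 0#
    ∉F⇒coeffs≈0 {μ} {a} {b} μ∉F a∈F b∈F b≈ = decidable-stable (a ≈? 0#) λ a≉0 →
      μ∉F (In-resp (begin
        b * inv a≉0          ≈⟨ *-congʳ b≈ ⟩
        μ * a * inv a≉0      ≈⟨ solve 3 (λ m a i → m :* a :* i := a :* (m :* i)) refl μ a (inv a≉0) ⟩
        a * (μ * inv a≉0)    ≈⟨ x*[y*x⁻¹]≈y a≉0 μ ⟩
        μ                    ∎) (In-* b∈F (In-inverse a≉0 a∈F)))

  -- Write λ̂ = a + b Λ i. Since the proportionality equation has only one solution, u i = b s and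
  -- u′ i = s′ - a s. Hence Φ i φ = β′ - λ̂ β lies in `V (Λ i)`, against the choice of φ.
  no-normalised-pair : ∀ {λ̂ β β′} {s s′ : Fin 6 → Carrier} → ¬ In λ̂ → In β → In β′ →
    (∀ j → In (s j)) → (∀ j → In (s′ j)) → s zero ≈ 0# → s′ zero ≈ 1# →
    ξ s′ ≈ λ̂ * ξ s → ζ s′ ≈ λ̂ * ζ s → ¬ β′ + lin s′ φ ≈ λ̂ * (β + lin s φ)
  no-normalised-pair {λ̂} {β} {β′} {s} {s′} λ̂∉F β∈F β′∈F s∈F s′∈F s₀ s′₀ ξ≈ ζ≈ g≈ with Λ-surj λ̂ λ̂∉F
  ... | i , a , b , a∈F , b∈F , λ̂≈ = proj₂ good-functional i
    (β′ - a * β , - (b * β) , In-sub β′∈F (In-* a∈F β∈F) , In-neg (In-* b∈F β∈F) , (begin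
      Λ i * lin (u i) φ - lin (u′ i) φ
        ≈⟨ +-cong (*-congˡ (trans (lin-cong {e = φ} u≈ (λ _ → refl)) (lin-mix b 0# s s φ)))
                  (-‿cong (trans (lin-cong {e = φ} u′≈ (λ _ → refl)) (lin-mix 1# (- a) s′ s φ))) ⟩
      Λ i * (b * lin s φ + 0# * lin s φ) - (1# * lin s′ φ + - a * lin s φ)
        ≈⟨ solve 5 (λ l b x y a → l :* (b :* x :+ :0 :* x) :- (:1 :* y :+ :- a :* x) := (a :+ b :* l) :* x :- y) refl (Λ i) b (lin s φ) (lin s′ φ) a ⟩
      (a + b * Λ i) * lin s φ - lin s′ φ
        ≈⟨ +-congʳ (*-congʳ λ̂≈) ⟨
      λ̂ * lin s φ - lin s′ φ
        ≈⟨ solve 5 (λ l x y p r → l :* x :- y := (r :- l :* p) :+ (l :* (p :+ x) :- (r :+ y))) refl λ̂ (lin s φ) (lin s′ φ) β β′ ⟩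
      (β′ - λ̂ * β) + (λ̂ * (β + lin s φ) - (β′ + lin s′ φ))
        ≈⟨ +-cong (+-congˡ (-‿cong (*-congʳ λ̂≈))) (x≈y⇒x-y≈0 (sym g≈)) ⟩
      (β′ - (a + b * Λ i) * β) + 0#
        ≈⟨ solve 5 (λ r a b l p → (r :- (a :+ b :* l) :* p) :+ :0 := (r :- a :* p) :+ :- (b :* p) :* l) refl β′ a b (Λ i) β ⟩
      (β′ - a * β) + - (b * β) * Λ i ∎))
    where
    δ = Λ i - θ (Λ i)
    spread : b * δ ≈ λ̂ - θ λ̂
    spread = sym (begin
      λ̂ - θ λ̂                                   ≈⟨ +-cong λ̂≈ (-‿cong (trans (θ-cong λ̂≈) (trans (θ-+ _ _) (+-cong (θ-F a∈F) (trans (θ-* _ _) (*-congʳ (θ-F b∈F))))))) ⟩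
      (a + b * Λ i) - (a + b * θ (Λ i))         ≈⟨ solve 4 (λ a b l t → (a :+ b :* l) :- (a :+ b :* t) := b :* (l :- t)) refl a b (Λ i) (θ (Λ i)) ⟩
      b * δ                                     ∎)
    root : θ (ξ s) * (λ̂ - θ λ̂) ≈ 1#
    root = begin
      θ (ξ s) * (λ̂ - θ λ̂)                       ≈⟨ solve 4 (λ x l t z → x :* (l :- t) := (l :* (x :+ z) :- (t :* x)) :- l :* z) refl (θ (ξ s)) λ̂ (θ λ̂) (s zero) ⟩
      (λ̂ * ζ s - θ λ̂ * θ (ξ s)) - λ̂ * s zero   ≈⟨ +-cong (+-cong (sym ζ≈) (-‿cong (trans (sym (θ-* _ _)) (θ-cong (sym ξ≈))))) (-‿cong (trans (*-congˡ s₀) (zeroʳ _))) ⟩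
      ((θ (ξ s′) + s′ zero) - θ (ξ s′)) - 0#    ≈⟨ solve 2 (λ x z → (x :+ z :- x) :- :0 := z) refl (θ (ξ s′)) (s′ zero) ⟩
      s′ zero                                   ≈⟨ s′₀ ⟩
      1#                                        ∎
    δ≉0 : ¬ δ ≈ 0#
    δ≉0 δ≈0 = 1≉0 (trans (sym (θξ-u i)) (trans (*-congˡ δ≈0) (zeroʳ _)))
    Xi≈ : X i ≈ b * ξ s
    Xi≈ = θ-injective (*-cancelˡ-≈ δ≉0 (begin
      δ * Y i                ≈⟨ *-comm _ _ ⟩
      Y i * δ                ≈⟨ θξ-u i ⟩
      1#                     ≈⟨ root ⟨
      θ (ξ s) * (λ̂ - θ λ̂)    ≈⟨ *-congˡ spread ⟨
      θ (ξ s) * (b * δ)      ≈⟨ solve 3 (λ x b d → x :* (b :* d) := d :* (b :* x)) refl (θ (ξ s)) b δ ⟩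
      δ * (b * θ (ξ s))      ≈⟨ *-congˡ (trans (θ-* b (ξ s)) (*-congʳ (θ-F b∈F))) ⟨
      δ * θ (b * ξ s)        ∎))
    -- `mix b 0# s s` is the multiple of s by b, written so that the lemmas on `mix` apply.
    u≈ : ∀ j → u i j ≈ mix b 0# s s j
    u≈ = ξ-injective (u∈F i) (mix-in {t = s} {t′ = s} b∈F In-0 s∈F s∈F)
      (trans (u₀ i) (sym (trans (+-cong (*-congˡ s₀) (zeroˡ _)) (trans (+-congʳ (zeroʳ b)) (+-identityˡ 0#)))))
      (trans Xi≈ (sym (trans (lin-mix b 0# (s ∘ suc) (s ∘ suc) basis) (trans (+-congˡ (zeroˡ _)) (+-identityʳ _)))))
    u′≈ : ∀ j → u′ i j ≈ mix 1# (- a) s′ s j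
    u′≈ = ξ-injective (u′∈F i) (mix-in {t = s′} {t′ = s} In-1 (In-neg a∈F) s′∈F s∈F)
      (trans (u′₀ i) (sym (trans (+-cong (trans (*-identityˡ _) s′₀) (trans (*-congˡ s₀) (zeroʳ _))) (+-identityʳ 1#))))
      (begin
        ξ (u′ i)                       ≈⟨ trans (ξ-u′ i) (*-congˡ Xi≈) ⟩
        Λ i * (b * ξ s)                ≈⟨ solve 4 (λ l b a x → l :* (b :* x) := (a :+ b :* l) :* x :+ :- a :* x) refl (Λ i) b a (ξ s) ⟩
        (a + b * Λ i) * ξ s + - a * ξ s ≈⟨ +-congʳ (trans (*-congʳ (sym λ̂≈)) (sym ξ≈)) ⟩
        ξ s′ + - a * ξ s               ≈⟨ +-congʳ (*-identityˡ _) ⟨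
        1# * ξ s′ + - a * ξ s          ≈⟨ lin-mix 1# (- a) (s′ ∘ suc) (s ∘ suc) basis ⟨
        ξ (mix 1# (- a) s′ s)          ∎)

  module _ {μ α α′ : Carrier} {t t′ : Fin 6 → Carrier} (μ∉F : ¬ In μ) (α∈F : In α) (α′∈F : In α′)
           (t∈F : ∀ j → In (t j)) (t′∈F : ∀ j → In (t′ j))
           (ξ≈ : ξ t′ ≈ μ * ξ t) (ζ≈ : ζ t′ ≈ μ * ζ t) (g≈ : α′ + lin t′ φ ≈ μ * (α + lin t φ)) where
    private
      b b′ y : Carrier
      b = t zero
      b′ = t′ zero
      y = b′ - b * μ

      -- `ξ t′` is eliminated from the two proportionalities. Because μ ∉ F, y = 0 forces both extra
      -- coordinates to vanish, and then this relation gives `ξ t` = 0 as well.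
      θ-relation : (μ - θ μ) * θ (ξ t) ≈ y
      θ-relation = begin
        (μ - θ μ) * θ (ξ t)                      ≈⟨ solve 4 (λ m n x z → (m :- n) :* x := (m :* (x :+ z) :- n :* x) :- z :* m) refl μ (θ μ) (θ (ξ t)) b ⟩
        (μ * ζ t - θ μ * θ (ξ t)) - b * μ        ≈⟨ +-congʳ (+-cong (sym ζ≈) (-‿cong (trans (sym (θ-* _ _)) (θ-cong (sym ξ≈))))) ⟩
        ((θ (ξ t′) + b′) - θ (ξ t′)) - b * μ     ≈⟨ +-congʳ (solve 2 (λ x z → x :+ z :- x := z) refl (θ (ξ t′)) b′) ⟩
        y                                        ∎

      b≈0 : y ≈ 0# → b ≈ 0#
      b≈0 y≈0 = ∉F⇒coeffs≈0 μ∉F (t∈F zero) (t′∈F zero) (trans (x-y≈0⇒x≈y y≈0) (*-comm b μ))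

      zero∈F : ∀ (j : Fin 6) → In 0#
      zero∈F _ = In-0

      vanish : ∀ {s : Coords} → (∀ j → In (s j)) → s zero ≈ 0# → ξ s ≈ 0# → ∀ j → s j ≈ 0#
      vanish s∈F s₀ ξs≈0 = ξ-injective s∈F zero∈F s₀ (trans ξs≈0 (sym (lin-zeroˡ _ basis (λ _ → refl))))

      ξt≈0 : y ≈ 0# → ξ t ≈ 0#
      ξt≈0 y≈0 = θ-injective (trans (*-cancelˡ-0 (λ d≈0 → μ∉F (θ-fixed (sym (x-y≈0⇒x≈y d≈0)))) (trans θ-relation y≈0)) (sym θ-0))

      y≈0⇒zero : y ≈ 0# → (∀ j → t j ≈ 0#) × α ≈ 0#
      y≈0⇒zero y≈0 = t≈0 , ∉F⇒coeffs≈0 μ∉F α∈F α′∈F (begin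
          α′                   ≈⟨ +-identityʳ _ ⟨
          α′ + 0#              ≈⟨ +-congˡ (lin-zeroˡ t′ φ t′≈0) ⟨
          α′ + lin t′ φ        ≈⟨ g≈ ⟩
          μ * (α + lin t φ)    ≈⟨ *-congˡ (trans (+-congˡ (lin-zeroˡ t φ t≈0)) (+-identityʳ α)) ⟩
          μ * α                ∎)
        where
        t≈0 = vanish t∈F (b≈0 y≈0) (ξt≈0 y≈0)
        t′≈0 = vanish t′∈F (trans (x-y≈0⇒x≈y y≈0) (trans (*-congʳ (b≈0 y≈0)) (zeroˡ μ))) (trans ξ≈ (trans (*-congˡ (ξt≈0 y≈0)) (zeroʳ μ)))

      -- A linear substitution in the pair (t , t′) makes the extra coordinates 0 and 1.
      normalise : ¬ y ≈ 0# → ∀ {κ ρ} → In κ → In ρ → κ * b + ρ * b′ ≈ 1# → ⊥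
      normalise y≉0 {κ} {ρ} κ∈F ρ∈F unit≈ =
        no-normalised-pair {λ̂} {mixᶠ b′ (- b)} {mixᶠ κ ρ} {s} {s′} λ̂∉F
          (In-+ (In-* b′∈F α∈F) (In-* -b∈F α′∈F)) (In-+ (In-* κ∈F α∈F) (In-* ρ∈F α′∈F)) s∈F s′∈F s₀ unit≈
          (proportional (ξ-scale b′ (- b)) (ξ-scale κ ρ))
          (proportional (ζ-scale b′∈F -b∈F) (ζ-scale κ∈F ρ∈F))
          (proportional (g-scale b′ (- b)) (g-scale κ ρ))
        where
        mixᶠ : Carrier → Carrier → Carrier
        mixᶠ κ ρ = κ * α + ρ * α′
        b′∈F = t′∈F zero
        -b∈F = In-neg (t∈F zero)
        s s′ : Coords
        s = mix b′ (- b) t t′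
        s′ = mix κ ρ t t′
        s∈F : ∀ j → In (s j)
        s∈F = mix-in {t = t} {t′ = t′} b′∈F -b∈F t∈F t′∈F
        s′∈F : ∀ j → In (s′ j)
        s′∈F = mix-in {t = t} {t′ = t′} κ∈F ρ∈F t∈F t′∈F
        s₀ : s zero ≈ 0#
        s₀ = solve 2 (λ x y → y :* x :+ :- x :* y := :0) refl b b′
        z = κ + ρ * μ
        -- The substitution multiplies the vector of t by y to give that of s, and by z to give that
        -- of s′.
        λ̂ = z * inv y≉0
        scale : ∀ κ ρ {x x′} → x′ ≈ μ * x → κ * x + ρ * x′ ≈ (κ + ρ * μ) * x
        scale κ ρ {x} {x′} eq = trans (+-congˡ (*-congˡ eq)) (solve 4 (λ k r m x → k :* x :+ r :* (m :* x) := (k :+ r :* m) :* x) refl κ ρ μ x)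
        ξ-scale : ∀ κ ρ → ξ (mix κ ρ t t′) ≈ (κ + ρ * μ) * ξ t
        ξ-scale κ ρ = trans (lin-mix κ ρ (t ∘ suc) (t′ ∘ suc) basis) (scale κ ρ ξ≈)
        ζ-scale : ∀ {κ ρ} → In κ → In ρ → ζ (mix κ ρ t t′) ≈ (κ + ρ * μ) * ζ t
        ζ-scale {κ} {ρ} κ∈F ρ∈F = trans (ζ-mix κ∈F ρ∈F t t′) (scale κ ρ ζ≈)
        g-scale : ∀ κ ρ → mixᶠ κ ρ + lin (mix κ ρ t t′) φ ≈ (κ + ρ * μ) * (α + lin t φ)
        g-scale κ ρ = trans (+-congˡ (lin-mix κ ρ t t′ φ)) (trans
          (solve 6 (λ k r x y u v → (k :* x :+ r :* y) :+ (k :* u :+ r :* v) := k :* (x :+ u) :+ r :* (y :+ v)) refl κ ρ α α′ (lin t φ) (lin t′ φ))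
          (scale κ ρ g≈))
        y-shape : b′ + - b * μ ≈ y
        y-shape = solve 3 (λ x y m → y :+ :- x :* m := y :- x :* m) refl b b′ μ
        proportional : ∀ {x x₁ x₂} → x₁ ≈ (b′ + - b * μ) * x → x₂ ≈ z * x → x₂ ≈ λ̂ * x₁
        proportional {x} {x₁} {x₂} eq₁ eq₂ = begin
          x₂                  ≈⟨ eq₂ ⟩
          z * x               ≈⟨ *-congʳ (x*[y*x⁻¹]≈y y≉0 z) ⟨
          y * λ̂ * x           ≈⟨ solve 3 (λ y l x → y :* l :* x := l :* (y :* x)) refl y λ̂ x ⟩
          λ̂ * (y * x)         ≈⟨ *-congˡ (trans eq₁ (*-congʳ y-shape)) ⟨
          λ̂ * x₁              ∎
        -- A ratio in F would commute with θ, so the extra coordinates would have the same ratio: 1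
        -- = λ̂ 0.
        λ̂∉F : ¬ In λ̂
        λ̂∉F λ̂∈F = 1≉0 (begin
          1#                                              ≈⟨ unit≈ ⟨
          s′ zero                                         ≈⟨ solve 2 (λ x z → z := (x :+ z) :- x) refl (θ (ξ s′)) (s′ zero) ⟩
          ζ s′ - θ (ξ s′)                                 ≈⟨ +-cong (proportional (ζ-scale b′∈F -b∈F) (ζ-scale κ∈F ρ∈F))
                                                               (-‿cong (trans (θ-cong (proportional (ξ-scale b′ (- b)) (ξ-scale κ ρ))) (trans (θ-* _ _) (*-congʳ (θ-F λ̂∈F))))) ⟩
          λ̂ * (θ (ξ s) + s zero) - λ̂ * θ (ξ s)            ≈⟨ solve 3 (λ l x z → l :* (x :+ z) :- l :* x := l :* z) refl λ̂ (θ (ξ s)) (s zero) ⟩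
          λ̂ * s zero                                      ≈⟨ trans (*-congˡ s₀) (zeroʳ _) ⟩
          0#                                              ∎)

    -- If y ≠ 0 then b or b′ is invertible, which supplies κ and ρ for `normalise`.
    proportional⇒zero : (∀ j → t j ≈ 0#) × α ≈ 0#
    proportional⇒zero with y ≈? 0#
    ... | yes y≈0 = y≈0⇒zero y≈0
    ... | no y≉0 with b ≈? 0#
    ...   | no b≉0 = ⊥-elim (normalise y≉0 (In-inverse b≉0 (t∈F zero)) In-0
              (trans (+-cong (trans (*-comm _ _) (inv-inverseʳ b≉0)) (zeroˡ _)) (+-identityʳ 1#)))
    ...   | yes b≈0 = ⊥-elim (normalise y≉0 In-0 (In-inverse b′≉0 (t′∈F zero))
              (trans (+-cong (zeroˡ _) (trans (*-comm _ _) (inv-inverseʳ b′≉0))) (+-identityˡ 1#)))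
      where
      b′≉0 : ¬ b′ ≈ 0#
      b′≉0 b′≈0 = y≉0 (trans (+-cong b′≈0 (-‿cong (trans (*-congʳ b≈0) (zeroˡ μ)))) (-‿inverseʳ 0#))

  -- Index 0 carries the free scalar of the middle coordinate, index 1 the scalar b, the rest a
  -- basis of K. A combination with coefficients a is thus (ξ t , a zero + lin t φ , ζ t) for t =
  -- `a ∘ suc`.
  generator : Fin 7 → Vec K 3
  generator i zero             = (0# ◂ (0# ◂ basis)) i
  generator i (suc zero)       = (1# ◂ φ) i
  generator i (suc (suc zero)) = (0# ◂ (1# ◂ (θ ∘ basis))) i

  private
    lincomb≈lin : ∀ k (a : Fin k → Carrier) (w : Fin k → Vec K 3) d → lincomb K k a w d ≈ lin a (λ i → w i d)
    lincomb≈lin zero    a w d = refl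
    lincomb≈lin (suc k) a w d = +-congˡ (lincomb≈lin k (a ∘ suc) (w ∘ suc) d)

    module _ (a : Fin 7 → Carrier) where
      coordinate₀ : lincomb K 7 a generator zero ≈ ξ (a ∘ suc)
      coordinate₀ = trans (lincomb≈lin 7 a generator zero)
        (trans (+-cong (zeroʳ _) (trans (+-congʳ (zeroʳ _)) (+-identityˡ _))) (+-identityˡ _))

      coordinate₁ : lincomb K 7 a generator (suc zero) ≈ a zero + lin (a ∘ suc) φ
      coordinate₁ = trans (lincomb≈lin 7 a generator (suc zero)) (+-congʳ (*-identityʳ _))

      coordinate₂ : (∀ i → In (a i)) → lincomb K 7 a generator (suc (suc zero)) ≈ ζ (a ∘ suc)
      coordinate₂ a∈F = trans (lincomb≈lin 7 a generator (suc (suc zero)))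
        (trans (+-cong (zeroʳ _) (+-cong (*-identityʳ _) (sym (θ-lin (λ j → a (suc (suc j))) basis (λ j → a∈F (suc (suc j)))))))
        (trans (+-identityˡ _) (+-comm _ _)))

  U : Vec K 3 → Set (c ⊔ ℓ)
  U = FSpan K F generator

  generator-independent : FIndependent K F generator
  generator-independent a a∈F eq = λ { zero → a₀≈0 ; (suc j) → t≈0 j }
    where
    t : Coords
    t = a ∘ suc
    ξ≈0 : ξ t ≈ 0#
    ξ≈0 = trans (sym (coordinate₀ a)) (eq zero)
    t≈0 : ∀ j → t j ≈ 0#
    t≈0 = ξ-injective {t} {λ _ → 0#} (a∈F ∘ suc) (λ _ → In-0)
      (begin
        t zero                   ≈⟨ +-identityˡ _ ⟨
        0# + t zero              ≈⟨ +-congʳ (trans (θ-cong ξ≈0) θ-0) ⟨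
        ζ t                      ≈⟨ coordinate₂ a a∈F ⟨
        lincomb K 7 a generator (suc (suc zero)) ≈⟨ eq (suc (suc zero)) ⟩
        0#                       ∎)
      (trans ξ≈0 (sym (lin-zeroˡ _ basis (λ _ → refl))))
    a₀≈0 : a zero ≈ 0#
    a₀≈0 = begin
      a zero                     ≈⟨ +-identityʳ _ ⟨
      a zero + 0#                ≈⟨ +-congˡ (lin-zeroˡ t φ t≈0) ⟨
      a zero + lin t φ           ≈⟨ coordinate₁ a ⟨
      lincomb K 7 a generator (suc zero) ≈⟨ eq (suc zero) ⟩
      0#                         ∎

  U-nonzero : ∃[ x ] U x × ¬ _≈V_ K x (0V K)
  U-nonzero = lincomb K 7 (unit zero) generator , (unit zero , unit-in zero , λ _ → refl) , λ eq → 1≉0 (begin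
    1#                               ≈⟨ +-identityʳ _ ⟨
    1# + 0#                          ≈⟨ +-congˡ (lin-zeroˡ _ φ (λ _ → refl)) ⟨
    1# + lin (λ j → unit (zero {6}) (suc j)) φ ≈⟨ coordinate₁ (unit zero) ⟨
    lincomb K 7 (unit zero) generator (suc zero) ≈⟨ eq (suc zero) ⟩
    0#                               ∎)

  -- If the ratio μ of w₂ to w₁ lies in F, it is itself the required relation; otherwise
  -- `proportional⇒zero` makes w₁ vanish, and with it v.
  U-points : ∀ v → ¬ _≈V_ K v (0V K) → FDimAtMostOne K F (λ w → U w × KSpan K F v w)
  U-points v v≉0 w₁ w₂ ((a , a∈F , w₁≈) , (λ₁ , w₁≈λ₁v)) ((a′ , a′∈F , w₂≈) , (λ₂ , w₂≈λ₂v)) with λ₁ ≈? 0#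
  ... | yes λ₁≈0 = 1# , 0# , In-1 , In-0 , 1≉0 ∘ proj₁ , λ d → begin
      1# * w₁ d + 0# * w₂ d    ≈⟨ +-congʳ (*-congˡ (trans (w₁≈λ₁v d) (trans (*-congʳ λ₁≈0) (zeroˡ _)))) ⟩
      1# * 0# + 0# * w₂ d      ≈⟨ solve 1 (λ w → :1 :* :0 :+ :0 :* w := :0) refl (w₂ d) ⟩
      0#                       ∎
  ... | no λ₁≉0 with In? (λ₂ * inv λ₁≉0)
  ...   | yes μ∈F = - μ , 1# , In-neg μ∈F , In-1 , 1≉0 ∘ proj₂ , λ d → begin
      - μ * w₁ d + 1# * w₂ d   ≈⟨ +-cong (*-congˡ (w₁≈λ₁v d)) (*-congˡ (w₂≈λ₂v d)) ⟩
      - μ * (λ₁ * v d) + 1# * (λ₂ * v d) ≈⟨ solve 4 (λ i l m x → :- (m :* i) :* (l :* x) :+ :1 :* (m :* x) := (m :- l :* (m :* i)) :* x) refl (inv λ₁≉0) λ₁ λ₂ (v d) ⟩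
      (λ₂ - λ₁ * μ) * v d      ≈⟨ *-congʳ (x≈y⇒x-y≈0 (sym (x*[y*x⁻¹]≈y λ₁≉0 λ₂))) ⟩
      0# * v d                 ≈⟨ zeroˡ _ ⟩
      0#                       ∎
    where μ = λ₂ * inv λ₁≉0
  ...   | no μ∉F = contradiction v≈0 v≉0
    where
    μ = λ₂ * inv λ₁≉0
    w₂≈μw₁ : ∀ d → w₂ d ≈ μ * w₁ d
    w₂≈μw₁ d = begin
      w₂ d               ≈⟨ w₂≈λ₂v d ⟩
      λ₂ * v d           ≈⟨ *-congʳ (x*[y*x⁻¹]≈y λ₁≉0 λ₂) ⟨
      λ₁ * μ * v d       ≈⟨ solve 3 (λ l m x → l :* m :* x := m :* (l :* x)) refl λ₁ μ (v d) ⟩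
      μ * (λ₁ * v d)     ≈⟨ *-congˡ (w₁≈λ₁v d) ⟨
      μ * w₁ d           ∎
    transfer : ∀ d {x x′} → lincomb K 7 a generator d ≈ x → lincomb K 7 a′ generator d ≈ x′ → x′ ≈ μ * x
    transfer d eq eq′ = trans (sym (trans (w₂≈ d) eq′)) (trans (w₂≈μw₁ d) (*-congˡ (trans (w₁≈ d) eq)))
    coefficients≈0 : (∀ j → a (suc j) ≈ 0#) × a zero ≈ 0#
    coefficients≈0 = proportional⇒zero {μ} {a zero} {a′ zero} {a ∘ suc} {a′ ∘ suc} μ∉F (a∈F zero) (a′∈F zero) (a∈F ∘ suc) (a′∈F ∘ suc)
      (transfer zero (coordinate₀ a) (coordinate₀ a′))
      (transfer (suc (suc zero)) (coordinate₂ a a∈F) (coordinate₂ a′ a′∈F))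
      (transfer (suc zero) (coordinate₁ a) (coordinate₁ a′))
    a≈0 : ∀ i → a i ≈ 0#
    a≈0 zero    = proj₂ coefficients≈0
    a≈0 (suc j) = proj₁ coefficients≈0 j
    v≈0 : ∀ d → v d ≈ 0#
    v≈0 d = *-cancelˡ-0 λ₁≉0 (begin
      λ₁ * v d                       ≈⟨ w₁≈λ₁v d ⟨
      w₁ d                           ≈⟨ w₁≈ d ⟩
      lincomb K 7 a generator d      ≈⟨ lincomb≈lin 7 a generator d ⟩
      lin a (λ i → generator i d)    ≈⟨ lin-zeroˡ a (λ i → generator i d) a≈0 ⟩
      0#                             ∎)

  scattered-subspace : ∃[ U ] (FSubspaceOfDim K F {3} 7 U × Scattered K F U)
  scattered-subspace = U , (generator , generator-independent , λ v → id , id) , U-nonzero , U-points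

open import Data.Integer using (ℤ; +_)

theorem5p1 : ∀ {c ℓ : Level} (p h : ℕ) (s : ℤ) (e : ℕ) → Prime p →
    (+ e) ≡ (+ (15 Data.Nat.* h)) Data.Integer.+ s →
    ((p ≡ 2 ⊎ p ≡ 3) → gcd s (+ 15) ≡ + 1) →
    (p ≡ 5 → s ≡ + 1) →
    (K : CommutativeRing c ℓ) → IsField K → HasCard K ((p ^ e) ^ 5) →
    (F : Subfield K) → SubfieldCard K F (p ^ e) →
    ∃[ U ] (FSubspaceOfDim K F {3} 7 U × Scattered K F U)
theorem5p1 p h s e _ _ _ _ K isField cardK F cardF = ScatteredSubspace.scattered-subspace K isField (p ^ e) cardK F cardF
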